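{- Let $|q|<1$ and let $x,y,s,t$ be complex numbers with $|t|,|s|,|xt|,|xs|<1$. Then $$\sum_{n=0}^\infty\sum_{m=0}^\infty h_{n+m}(x,y|q)\frac{t^n}{(q;q)_n}\frac{s^m}{(q;q)_m}=\frac{(ys;q)_\infty}{(s,xs,xt;q)_\infty}\ {}_2\phi_1\left(\begin{array}{c} y,\ xs\\ ys\end{array}; q,\ t\right).$$
   Context: Throughout $|q|<1$. $(a;q)_n=\prod_{k=0}^{n-1}(1-aq^k)$, $(a;q)_\infty=\prod_{k\ge0}(1-aq^k)$, $(a_1,\dots,a_m;q)_n=\prod_i(a_i;q)_n$ (also for $n=\infty$), ${n\brack k}=\frac{(q;q)_n}{(q;q)_k(q;q)_{n-k}}$, and ${}_2\phi_1\left(\begin{array}{c}a_1,a_2\\ b_1\end{array};q,z\right)=\sum_{n\ge0}\frac{(a_1,a_2;q)_n}{(q,b_1;q)_n}z^n$. $P_n(x,y)=(x-y)(x-qy)\cdots(x-q^{n-1}y)$ with $P_0=1$, and $h_n(x,y|q)=\sum_{k=0}^n{n\brack k}P_k(x,y)$. -}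

module Defs where

open import Data.Nat.Base as ℕ using (ℕ; zero; suc; _∸_; _⊔_)
import Data.Nat.Properties as ℕₚ
open import Data.Product.Base using (Σ; _×_; _,_; proj₁; proj₂; ∃; Σ-syntax; ∃-syntax)
open import Data.Rational.Base as ℚ using (ℚ; 0ℚ; 1ℚ; ½)
import Data.Rational.Properties as ℚₚ
open import Data.Rational.Solver using (module +-*-Solver)
open import Data.Sum.Base using (inj₁; inj₂)
open import Relation.Binary.PropositionalEquality
open import Relation.Nullary using (yes; no; contradiction)

module Rat where

  pos : ∀ {p} → 0ℚ ℚ.< p → ℚ.Positive p
  pos = ℚ.positive

  nonNeg : ∀ {p} → 0ℚ ℚ.≤ p → ℚ.NonNegative p
  nonNeg = ℚ.nonNegative

  *-pos : ∀ {p r} → 0ℚ ℚ.< p → 0ℚ ℚ.< r → 0ℚ ℚ.< p ℚ.* r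
  *-pos {p} {r} 0<p 0<r =
    subst (ℚ._< p ℚ.* r) (ℚₚ.*-zeroʳ p) (ℚₚ.*-monoʳ-<-pos p {{pos 0<p}} 0<r)

  *-nonNeg : ∀ {p r} → 0ℚ ℚ.≤ p → 0ℚ ℚ.≤ r → 0ℚ ℚ.≤ p ℚ.* r
  *-nonNeg {p} {r} 0≤p 0≤r =
    subst (ℚ._≤ p ℚ.* r) (ℚₚ.*-zeroʳ p) (ℚₚ.*-monoˡ-≤-nonNeg p {{nonNeg 0≤p}} 0≤r)

  *-mono-≤ : ∀ {p p′ r r′} → 0ℚ ℚ.≤ p → 0ℚ ℚ.≤ r′ →
             p ℚ.≤ p′ → r ℚ.≤ r′ → p ℚ.* r ℚ.≤ p′ ℚ.* r′
  *-mono-≤ {p} {p′} {r} {r′} 0≤p 0≤r′ p≤p′ r≤r′ = ℚₚ.≤-trans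
    (ℚₚ.*-monoˡ-≤-nonNeg p {{nonNeg 0≤p}} r≤r′)
    (ℚₚ.*-monoʳ-≤-nonNeg r′ {{nonNeg 0≤r′}} p≤p′)

  0≤p*p : ∀ p → 0ℚ ℚ.≤ p ℚ.* p
  0≤p*p p with ℚₚ.≤-total 0ℚ p
  ... | inj₁ 0≤p = *-nonNeg 0≤p 0≤p
  ... | inj₂ p≤0 = subst (0ℚ ℚ.≤_)
    (solve 1 (λ a → (:- a) :* (:- a) := a :* a) refl p)
    (*-nonNeg 0≤-p 0≤-p)
    where
    open +-*-Solver
    0≤-p : 0ℚ ℚ.≤ ℚ.- p
    0≤-p = ℚₚ.neg-antimono-≤ p≤0

  half-pos : ∀ {ε} → 0ℚ ℚ.< ε → 0ℚ ℚ.< ½ ℚ.* ε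
  half-pos = *-pos (ℚₚ.positive⁻¹ ½)

  half+half : ∀ ε → ½ ℚ.* ε ℚ.+ ½ ℚ.* ε ≡ ε
  half+half = solve 1 (λ e → con ½ :* e :+ con ½ :* e := e) refl
    where open +-*-Solver

  -- Total reciprocal, with recip 0 = 0; it is only ever used away from 0.
  recip : ℚ → ℚ
  recip p with p ℚₚ.≟ 0ℚ
  ... | yes _   = 0ℚ
  ... | no  p≢0 = ℚ.1/_ p {{ℚ.≢-nonZero p≢0}}

  recip-inverse : ∀ {p} → 0ℚ ℚ.< p → recip p ℚ.* p ≡ 1ℚ
  recip-inverse {p} 0<p with p ℚₚ.≟ 0ℚ
  ... | yes refl = contradiction 0<p (ℚₚ.<-irrefl refl)
  ... | no  p≢0  = ℚₚ.*-inverseˡ p {{ℚ.≢-nonZero p≢0}}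

  recip-pos : ∀ {p} → 0ℚ ℚ.< p → 0ℚ ℚ.< recip p
  recip-pos {p} 0<p with p ℚₚ.≟ 0ℚ
  ... | yes refl = contradiction 0<p (ℚₚ.<-irrefl refl)
  ... | no  p≢0  = ℚₚ.positive⁻¹ (ℚ.1/_ p {{ℚ.≢-nonZero p≢0}}) {{ℚₚ.1/pos⇒pos p {{pos 0<p}}}}

  recip-close : ∀ {a b c e} → 0ℚ ℚ.< c → c ℚ.≤ a → c ℚ.≤ b →
                ℚ.∣ a ℚ.- b ∣ ℚ.< e ℚ.* (c ℚ.* c) →
                ℚ.∣ recip a ℚ.- recip b ∣ ℚ.< e
  recip-close {a} {b} {c} {e} 0<c c≤a c≤b close =
    ℚₚ.*-cancelʳ-<-nonNeg (c ℚ.* c) {{nonNeg (ℚₚ.<⇒≤ (*-pos 0<c 0<c))}} (begin-strict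
      ℚ.∣ d ∣ ℚ.* (c ℚ.* c)         ≤⟨ ℚₚ.*-monoˡ-≤-nonNeg ℚ.∣ d ∣ {{ℚₚ.∣-∣-nonNeg d}}
                                         (*-mono-≤ 0≤c 0≤b c≤a c≤b) ⟩
      ℚ.∣ d ∣ ℚ.* (a ℚ.* b)         ≡⟨ cong (ℚ.∣ d ∣ ℚ.*_) (ℚₚ.0≤p⇒∣p∣≡p (*-nonNeg 0≤a 0≤b)) ⟨
      ℚ.∣ d ∣ ℚ.* ℚ.∣ a ℚ.* b ∣     ≡⟨ ℚₚ.∣p*q∣≡∣p∣*∣q∣ d (a ℚ.* b) ⟨
      ℚ.∣ d ℚ.* (a ℚ.* b) ∣         ≡⟨ cong ℚ.∣_∣ clear ⟩
      ℚ.∣ ℚ.- (a ℚ.- b) ∣           ≡⟨ ℚₚ.∣-p∣≡∣p∣ (a ℚ.- b) ⟩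
      ℚ.∣ a ℚ.- b ∣                 <⟨ close ⟩
      e ℚ.* (c ℚ.* c)               ∎)
    where
    open ℚₚ.≤-Reasoning
    open +-*-Solver
    d = recip a ℚ.- recip b
    0<a = ℚₚ.<-≤-trans 0<c c≤a
    0<b = ℚₚ.<-≤-trans 0<c c≤b
    0≤a = ℚₚ.<⇒≤ 0<a
    0≤b = ℚₚ.<⇒≤ 0<b
    0≤c = ℚₚ.<⇒≤ 0<c
    clear : d ℚ.* (a ℚ.* b) ≡ ℚ.- (a ℚ.- b)
    clear = begin-equality
      d ℚ.* (a ℚ.* b)
        ≡⟨ solve 4 (λ a b r s → (r :- s) :* (a :* b) := (r :* a) :* b :- (s :* b) :* a)
             refl a b (recip a) (recip b) ⟩
      (recip a ℚ.* a) ℚ.* b ℚ.- (recip b ℚ.* b) ℚ.* a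
        ≡⟨ cong₂ (λ u v → u ℚ.* b ℚ.- v ℚ.* a) (recip-inverse 0<a) (recip-inverse 0<b) ⟩
      1ℚ ℚ.* b ℚ.- 1ℚ ℚ.* a
        ≡⟨ solve 2 (λ a b → con 1ℚ :* b :- con 1ℚ :* a := :- (a :- b)) refl a b ⟩
      ℚ.- (a ℚ.- b) ∎

  *-small : ∀ B δ a d → 0ℚ ℚ.< B → ℚ.∣ a ∣ ℚ.≤ B → ℚ.∣ d ∣ ℚ.< recip B ℚ.* δ →
            ℚ.∣ a ℚ.* d ∣ ℚ.< δ
  *-small B δ a d 0<B a≤B d<δ = begin-strict
    ℚ.∣ a ℚ.* d ∣              ≡⟨ ℚₚ.∣p*q∣≡∣p∣*∣q∣ a d ⟩
    ℚ.∣ a ∣ ℚ.* ℚ.∣ d ∣        ≤⟨ ℚₚ.*-monoʳ-≤-nonNeg ℚ.∣ d ∣ {{ℚₚ.∣-∣-nonNeg d}} a≤B ⟩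
    B ℚ.* ℚ.∣ d ∣              <⟨ ℚₚ.*-monoʳ-<-pos B {{pos 0<B}} d<δ ⟩
    B ℚ.* (recip B ℚ.* δ)      ≡⟨ solve 3 (λ b r e → b :* (r :* e) := (r :* b) :* e)
                                    refl B (recip B) δ ⟩
    (recip B ℚ.* B) ℚ.* δ      ≡⟨ cong (ℚ._* δ) (recip-inverse 0<B) ⟩
    1ℚ ℚ.* δ                   ≡⟨ ℚₚ.*-identityˡ δ ⟩
    δ                          ∎
    where
    open ℚₚ.≤-Reasoning
    open +-*-Solver

  *-close : ∀ ε B C a b c d → 0ℚ ℚ.< B → 0ℚ ℚ.< C → ℚ.∣ a ∣ ℚ.≤ B → ℚ.∣ d ∣ ℚ.≤ C →
            ℚ.∣ b ℚ.- d ∣ ℚ.< recip B ℚ.* (½ ℚ.* ε) →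
            ℚ.∣ a ℚ.- c ∣ ℚ.< recip C ℚ.* (½ ℚ.* ε) →
            ℚ.∣ a ℚ.* b ℚ.- c ℚ.* d ∣ ℚ.< ε
  *-close ε B C a b c d 0<B 0<C a≤B d≤C b~d a~c = begin-strict
    ℚ.∣ a ℚ.* b ℚ.- c ℚ.* d ∣
      ≡⟨ cong ℚ.∣_∣ (solve 4 (λ a b c d → a :* b :- c :* d := a :* (b :- d) :+ d :* (a :- c))
           refl a b c d) ⟩
    ℚ.∣ a ℚ.* (b ℚ.- d) ℚ.+ d ℚ.* (a ℚ.- c) ∣
      ≤⟨ ℚₚ.∣p+q∣≤∣p∣+∣q∣ (a ℚ.* (b ℚ.- d)) (d ℚ.* (a ℚ.- c)) ⟩
    ℚ.∣ a ℚ.* (b ℚ.- d) ∣ ℚ.+ ℚ.∣ d ℚ.* (a ℚ.- c) ∣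
      <⟨ ℚₚ.+-mono-< (*-small B (½ ℚ.* ε) a (b ℚ.- d) 0<B a≤B b~d)
                     (*-small C (½ ℚ.* ε) d (a ℚ.- c) 0<C d≤C a~c) ⟩
    ½ ℚ.* ε ℚ.+ ½ ℚ.* ε
      ≡⟨ half+half ε ⟩
    ε ∎
    where
    open ℚₚ.≤-Reasoning
    open +-*-Solver

open Rat

IsCauchy : (ℕ → ℚ) → Set
IsCauchy x = ∀ ε → 0ℚ ℚ.< ε →
  ∃[ N ] ∀ m n → N ℕ.≤ m → N ℕ.≤ n → ℚ.∣ x m ℚ.- x n ∣ ℚ.< ε

-- A real number is a Cauchy sequence of rationals; different sequences may represent
-- the same number, and order and convergence below depend only on the number.
record ℝ : Set where
  no-eta-equality
  constructor mkℝ
  field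
    seq    : ℕ → ℚ
    cauchy : IsCauchy seq

open ℝ public

infix 4 _<ᴿ_

-- Strict inequality of limits requires a fixed gap, not just termwise inequality.
record _<ᴿ_ (x y : ℝ) : Set where
  constructor mk<
  field
    gap     : ℚ
    gap-pos : 0ℚ ℚ.< gap
    from    : ℕ
    below   : ∀ n → from ℕ.≤ n → seq x n ℚ.+ gap ℚ.≤ seq y n

open _<ᴿ_ public

fromℚ : ℚ → ℝ
fromℚ p = mkℝ (λ _ → p) λ ε 0<ε → 0 , λ _ _ _ _ →
  subst (λ z → ℚ.∣ z ∣ ℚ.< ε) (sym (ℚₚ.+-inverseʳ p)) 0<ε

infixl 6 _+ᴿ_ _-ᴿ_
infixl 7 _*ᴿ_
infix  8 -ᴿ_

⊔-left : ∀ {M N n} → M ⊔ N ℕ.≤ n → M ℕ.≤ n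
⊔-left {M} {N} = ℕₚ.≤-trans (ℕₚ.m≤m⊔n M N)

⊔-right : ∀ {M N n} → M ⊔ N ℕ.≤ n → N ℕ.≤ n
⊔-right {M} {N} = ℕₚ.≤-trans (ℕₚ.m≤n⊔m M N)

_+ᴿ_ : ℝ → ℝ → ℝ
seq    (x +ᴿ y) n = seq x n ℚ.+ seq y n
cauchy (x +ᴿ y) ε 0<ε
  with M , f ← cauchy x (½ ℚ.* ε) (half-pos 0<ε)
     | N , g ← cauchy y (½ ℚ.* ε) (half-pos 0<ε)
  = M ⊔ N , λ m n p r → begin-strict
    ℚ.∣ (seq x m ℚ.+ seq y m) ℚ.- (seq x n ℚ.+ seq y n) ∣
      ≡⟨ cong ℚ.∣_∣ (solve 4 (λ a b c d → (a :+ b) :- (c :+ d) := (a :- c) :+ (b :- d))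
           refl (seq x m) (seq y m) (seq x n) (seq y n)) ⟩
    ℚ.∣ (seq x m ℚ.- seq x n) ℚ.+ (seq y m ℚ.- seq y n) ∣
      ≤⟨ ℚₚ.∣p+q∣≤∣p∣+∣q∣ (seq x m ℚ.- seq x n) (seq y m ℚ.- seq y n) ⟩
    ℚ.∣ seq x m ℚ.- seq x n ∣ ℚ.+ ℚ.∣ seq y m ℚ.- seq y n ∣
      <⟨ ℚₚ.+-mono-< (f m n (⊔-left p) (⊔-left r)) (g m n (⊔-right {M} p) (⊔-right {M} r)) ⟩
    ½ ℚ.* ε ℚ.+ ½ ℚ.* ε
      ≡⟨ half+half ε ⟩
    ε ∎
  where
  open ℚₚ.≤-Reasoning
  open +-*-Solver

-ᴿ_ : ℝ → ℝ
seq    (-ᴿ x) n = ℚ.- seq x n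
cauchy (-ᴿ x) ε 0<ε with N , f ← cauchy x ε 0<ε
  = N , λ m n p r → subst (ℚ._< ε) (sym (flip m n)) (f m n p r)
  where
  open +-*-Solver
  flip : ∀ m n → ℚ.∣ ℚ.- seq x m ℚ.- ℚ.- seq x n ∣ ≡ ℚ.∣ seq x m ℚ.- seq x n ∣
  flip m n = trans
    (cong ℚ.∣_∣ (solve 2 (λ a b → (:- a) :- (:- b) := :- (a :- b)) refl (seq x m) (seq x n)))
    (ℚₚ.∣-p∣≡∣p∣ (seq x m ℚ.- seq x n))

_-ᴿ_ : ℝ → ℝ → ℝ
x -ᴿ y = x +ᴿ -ᴿ y

eventuallyBounded : ∀ x → ∃[ B ] 0ℚ ℚ.< B × ∃[ N ] ∀ n → N ℕ.≤ n → ℚ.∣ seq x n ∣ ℚ.≤ B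
eventuallyBounded x with N , f ← cauchy x 1ℚ (ℚₚ.positive⁻¹ 1ℚ)
  = 1ℚ ℚ.+ ℚ.∣ seq x N ∣
  , ℚₚ.+-mono-<-≤ (ℚₚ.positive⁻¹ 1ℚ) (ℚₚ.0≤∣p∣ (seq x N))
  , N , λ n p → begin
    ℚ.∣ seq x n ∣
      ≡⟨ cong ℚ.∣_∣ (solve 2 (λ a b → a := (a :- b) :+ b) refl (seq x n) (seq x N)) ⟩
    ℚ.∣ (seq x n ℚ.- seq x N) ℚ.+ seq x N ∣
      ≤⟨ ℚₚ.∣p+q∣≤∣p∣+∣q∣ (seq x n ℚ.- seq x N) (seq x N) ⟩
    ℚ.∣ seq x n ℚ.- seq x N ∣ ℚ.+ ℚ.∣ seq x N ∣
      ≤⟨ ℚₚ.+-monoˡ-≤ ℚ.∣ seq x N ∣ (ℚₚ.<⇒≤ (f n N p ℕₚ.≤-refl)) ⟩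
    1ℚ ℚ.+ ℚ.∣ seq x N ∣ ∎
  where
  open ℚₚ.≤-Reasoning
  open +-*-Solver

_*ᴿ_ : ℝ → ℝ → ℝ
seq    (x *ᴿ y) n = seq x n ℚ.* seq y n
cauchy (x *ᴿ y) ε 0<ε =
  let B , 0<B , K , bx = eventuallyBounded x
      C , 0<C , L , by = eventuallyBounded y
      M , f = cauchy x (recip C ℚ.* (½ ℚ.* ε))
                (*-pos {recip C} {½ ℚ.* ε} (recip-pos {C} 0<C) (half-pos {ε} 0<ε))
      N , g = cauchy y (recip B ℚ.* (½ ℚ.* ε))
                (*-pos {recip B} {½ ℚ.* ε} (recip-pos {B} 0<B) (half-pos {ε} 0<ε))
  in (K ⊔ L) ⊔ (M ⊔ N) , λ m n p r →
    *-close ε B C (seq x m) (seq y m) (seq x n) (seq y n) 0<B 0<C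
      (bx m (⊔-left {K} {L} (⊔-left {K ⊔ L} {M ⊔ N} p)))
      (by n (⊔-right {K} {L} (⊔-left {K ⊔ L} {M ⊔ N} r)))
      (g m n (⊔-right {M} {N} (⊔-right {K ⊔ L} {M ⊔ N} p)) (⊔-right {M} {N} (⊔-right {K ⊔ L} {M ⊔ N} r)))
      (f m n (⊔-left {M} {N} (⊔-right {K ⊔ L} {M ⊔ N} p)) (⊔-left {M} {N} (⊔-right {K ⊔ L} {M ⊔ N} r)))

recipᴿ : (x : ℝ) → fromℚ 0ℚ <ᴿ x → ℝ
seq    (recipᴿ x _) n = recip (seq x n)
cauchy (recipᴿ x (mk< c 0<c M lower)) ε 0<ε
  with N , f ← cauchy x (ε ℚ.* (c ℚ.* c)) (*-pos 0<ε (*-pos 0<c 0<c))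
  = M ⊔ N , λ m n p r →
    recip-close 0<c (lower′ m (⊔-left p)) (lower′ n (⊔-left r))
      (f m n (⊔-right {M} p) (⊔-right {M} r))
  where
  lower′ : ∀ n → M ℕ.≤ n → c ℚ.≤ seq x n
  lower′ n p = subst (ℚ._≤ seq x n) (ℚₚ.+-identityˡ c) (lower n p)

record ℂ : Set where
  constructor _+i_
  field
    re : ℝ
    im : ℝ

open ℂ public

infixl 6 _+_ _-_
infixl 7 _*_ _/_∵_
infixr 8 _^_
infix  4 ∣_∣<_ _#0

0ℂ 1ℂ : ℂ
0ℂ = fromℚ 0ℚ +i fromℚ 0ℚ
1ℂ = fromℚ 1ℚ +i fromℚ 0ℚ

_+_ _-_ _*_ : ℂ → ℂ → ℂ
re (z + w) = re z +ᴿ re w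
im (z + w) = im z +ᴿ im w
re (z - w) = re z -ᴿ re w
im (z - w) = im z -ᴿ im w
re (z * w) = re z *ᴿ re w -ᴿ im z *ᴿ im w
im (z * w) = re z *ᴿ im w +ᴿ im z *ᴿ re w

_^_ : ℂ → ℕ → ℂ
z ^ zero  = 1ℂ
z ^ suc n = z * z ^ n

normSq : ℂ → ℝ
normSq z = re z *ᴿ re z +ᴿ im z *ᴿ im z

-- The modulus is √(re² + im²), so for r > 0 this is ∣z∣ < r with both sides squared;
-- the bound r is positive wherever the relation is used.
∣_∣<_ : ℂ → ℚ → Set
∣ z ∣< r = normSq z <ᴿ fromℚ (r ℚ.* r)

-- Being nonzero is taken in the positive (apartness) form needed to divide.
_#0 : ℂ → Set
z #0 = fromℚ 0ℚ <ᴿ normSq z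

-- z / w = z · w̄ / ∣w∣²
_/_∵_ : (z w : ℂ) → w #0 → ℂ
z / w ∵ w#0 = z * ((re w *ᴿ r) +i (-ᴿ im w *ᴿ r))
  where r = recipᴿ (normSq w) w#0

infix 4 _⟶_

_⟶_ : (ℕ → ℂ) → ℂ → Set
z ⟶ l = ∀ ε → 0ℚ ℚ.< ε → ∃[ N ] ∀ n → N ℕ.≤ n → ∣ z n - l ∣< ε

-- ∑< n f = f 0 + ⋯ + f (n - 1)
∑< : ℕ → (ℕ → ℂ) → ℂ
∑< zero    f = 0ℂ
∑< (suc n) f = ∑< n f + f n

∏< : ℕ → (ℕ → ℂ) → ℂ
∏< zero    f = 1ℂ
∏< (suc n) f = ∏< n f * f n

HasSum : (ℕ → ℂ) → ℂ → Set
HasSum f S = (λ n → ∑< n f) ⟶ S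

-- Iterated sum: ∑ₙ (∑ₘ f n m) = S, each inner series being convergent.
HasDoubleSum : (ℕ → ℕ → ℂ) → ℂ → Set
HasDoubleSum f S = ∃[ g ] (∀ n → HasSum (f n) (g n)) × HasSum g S

-- (a;q)ₙ
poch : (a q : ℂ) → ℕ → ℂ
poch a q n = ∏< n λ k → 1ℂ - a * q ^ k

-- (a;q)_∞ = A
IsPoch∞ : (a q A : ℂ) → Set
IsPoch∞ a q A = (λ n → poch a q n) ⟶ A

-- a ≠ q⁻ᵏ for every k, so that (a;q)ₙ may occur in a denominator
NonVanishing : (a q : ℂ) → Set
NonVanishing a q = ∀ k → 1ℂ - a * q ^ k #0

-- Equality of reals here is equality of representing sequences, which
-- suffices because the field operations act termwise.
<ᴿ-respʳ : ∀ {x y z} → (∀ n → seq y n ≡ seq z n) → x <ᴿ y → x <ᴿ z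
<ᴿ-respʳ {x} y≗z (mk< ε 0<ε N f) =
  mk< ε 0<ε N λ n p → subst (seq x n ℚ.+ ε ℚ.≤_) (y≗z n) (f n p)

<ᴿ-respˡ : ∀ {x y z} → (∀ n → seq y n ≡ seq z n) → y <ᴿ x → z <ᴿ x
<ᴿ-respˡ {x} y≗z (mk< ε 0<ε N f) =
  mk< ε 0<ε N λ n p → subst (λ a → a ℚ.+ ε ℚ.≤ seq x n) (y≗z n) (f n p)

normSq-* : ∀ z w n → seq (normSq z *ᴿ normSq w) n ≡ seq (normSq (z * w)) n
normSq-* z w n = solve 4
  (λ a b c d → (a :* a :+ b :* b) :* (c :* c :+ d :* d) :=
               (a :* c :- b :* d) :* (a :* c :- b :* d) :+
               (a :* d :+ b :* c) :* (a :* d :+ b :* c))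
  refl (seq (re z) n) (seq (im z) n) (seq (re w) n) (seq (im w) n)
  where open +-*-Solver

normSq-nonNeg : ∀ z n → 0ℚ ℚ.≤ seq (normSq z) n
normSq-nonNeg z n = ℚₚ.+-mono-≤ (0≤p*p (seq (re z) n)) (0≤p*p (seq (im z) n))

*-#0 : ∀ {z w} → z #0 → w #0 → z * w #0
*-#0 {z} {w} (mk< ε 0<ε M f) (mk< δ 0<δ N g) =
  <ᴿ-respʳ {fromℚ 0ℚ} {normSq z *ᴿ normSq w} {normSq (z * w)} (normSq-* z w)
    (mk< (ε ℚ.* δ) (*-pos 0<ε 0<δ) (M ⊔ N) λ n p → begin
        0ℚ ℚ.+ ε ℚ.* δ                       ≡⟨ ℚₚ.+-identityˡ (ε ℚ.* δ) ⟩
        ε ℚ.* δ                              ≤⟨ *-mono-≤ {ε} {seq (normSq z) n} {δ} {seq (normSq w) n} (ℚₚ.<⇒≤ 0<ε) (normSq-nonNeg w n)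
                                                  (drop0 ε (f n (⊔-left p)))
                                                  (drop0 δ (g n (⊔-right {M} p))) ⟩
        seq (normSq z) n ℚ.* seq (normSq w) n ∎ )
  where
  open ℚₚ.≤-Reasoning
  drop0 : ∀ e {a} → 0ℚ ℚ.+ e ℚ.≤ a → e ℚ.≤ a
  drop0 e {a} = subst (ℚ._≤ a) (ℚₚ.+-identityˡ e)

1ℂ#0 : 1ℂ #0
1ℂ#0 = mk< 1ℚ (ℚₚ.positive⁻¹ 1ℚ) 0 λ _ _ → ℚₚ.≤-refl

*-∣∣<1 : ∀ {z w} → ∣ z ∣< 1ℚ → ∣ w ∣< 1ℚ → ∣ z * w ∣< 1ℚ
*-∣∣<1 {z} {w} (mk< ε 0<ε M f) (mk< δ 0<δ N g) =
  <ᴿ-respˡ {fromℚ 1ℚ} {normSq z *ᴿ normSq w} {normSq (z * w)} (normSq-* z w)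
    (mk< ε 0<ε (M ⊔ N) λ n p → let a = seq (normSq z) n ; b = seq (normSq w) n in begin
        a ℚ.* b ℚ.+ ε   ≤⟨ ℚₚ.+-monoˡ-≤ ε (ℚₚ.*-monoˡ-≤-nonNeg a {{nonNeg (normSq-nonNeg z n)}}
                             (≤1 (g n (⊔-right {M} p)))) ⟩
        a ℚ.* 1ℚ ℚ.+ ε  ≡⟨ cong (ℚ._+ ε) (ℚₚ.*-identityʳ a) ⟩
        a ℚ.+ ε         ≤⟨ f n (⊔-left p) ⟩
        1ℚ              ∎ )
  where
  open ℚₚ.≤-Reasoning
  ≤1 : ∀ {b} → b ℚ.+ δ ℚ.≤ 1ℚ → b ℚ.≤ 1ℚ
  ≤1 {b} b+δ≤1 = begin
    b           ≡⟨ ℚₚ.+-identityʳ b ⟨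
    b ℚ.+ 0ℚ    ≤⟨ ℚₚ.+-monoʳ-≤ b (ℚₚ.<⇒≤ 0<δ) ⟩
    b ℚ.+ δ     ≤⟨ b+δ≤1 ⟩
    1ℚ          ∎

-- With u = 1 - a, the bound a² + b² + ε ≤ 1 reads ε + u² + b² ≤ 2u, so ε/2 ≤ u.
1-z#0 : ∀ {z} → ∣ z ∣< 1ℚ → 1ℂ - z #0
1-z#0 {z} (mk< ε 0<ε N f) = mk< (ε/2 ℚ.* ε/2) (*-pos 0<ε/2 0<ε/2) N λ n p →
  let a = seq (re z) n ; b = seq (im z) n ; u = 1ℚ ℚ.- a ; v = 0ℚ ℚ.- b
      ε/2≤u : ε/2 ℚ.≤ u
      ε/2≤u = begin
        ½ ℚ.* ε
          ≤⟨ ℚₚ.*-monoˡ-≤-nonNeg ½ (begin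
               ε                                          ≡⟨ solve 1 (λ e → e := (e :+ con 0ℚ) :+ con 0ℚ) refl ε ⟩
               (ε ℚ.+ 0ℚ) ℚ.+ 0ℚ                          ≤⟨ ℚₚ.+-mono-≤ (ℚₚ.+-monoʳ-≤ ε (0≤p*p u)) (0≤p*p b) ⟩
               (ε ℚ.+ u ℚ.* u) ℚ.+ b ℚ.* b                ≡⟨ solve 3 (λ a b e →
                     (e :+ (con 1ℚ :- a) :* (con 1ℚ :- a)) :+ b :* b :=
                     ((a :* a :+ b :* b) :+ e) :+ (con 1ℚ :- (a :+ a))) refl a b ε ⟩
               ((a ℚ.* a ℚ.+ b ℚ.* b) ℚ.+ ε) ℚ.+ (1ℚ ℚ.- (a ℚ.+ a))
                                                          ≤⟨ ℚₚ.+-monoˡ-≤ (1ℚ ℚ.- (a ℚ.+ a)) (f n p) ⟩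
               1ℚ ℚ.+ (1ℚ ℚ.- (a ℚ.+ a))                  ≡⟨ solve 1 (λ a →
                     con 1ℚ :+ (con 1ℚ :- (a :+ a)) := (con 1ℚ :- a) :+ (con 1ℚ :- a)) refl a ⟩
               u ℚ.+ u                                    ∎) ⟩
        ½ ℚ.* (u ℚ.+ u)
          ≡⟨ solve 1 (λ u → con ½ :* (u :+ u) := u) refl u ⟩
        u ∎
  in begin
    0ℚ ℚ.+ ε/2 ℚ.* ε/2     ≡⟨ ℚₚ.+-comm 0ℚ (ε/2 ℚ.* ε/2) ⟩
    ε/2 ℚ.* ε/2 ℚ.+ 0ℚ     ≤⟨ ℚₚ.+-mono-≤
                                (*-mono-≤ 0≤ε/2 (ℚₚ.≤-trans 0≤ε/2 ε/2≤u) ε/2≤u ε/2≤u)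
                                (0≤p*p v) ⟩
    u ℚ.* u ℚ.+ v ℚ.* v    ∎
  where
  open ℚₚ.≤-Reasoning
  open +-*-Solver
  ε/2 = ½ ℚ.* ε
  0<ε/2 = half-pos 0<ε
  0≤ε/2 = ℚₚ.<⇒≤ 0<ε/2

qq^k<1 : ∀ {q} → ∣ q ∣< 1ℚ → ∀ k → ∣ q * q ^ k ∣< 1ℚ
qq^k<1 {q} q<1 zero    = <ᴿ-respˡ {fromℚ 1ℚ} {normSq q} {normSq (q * 1ℂ)} same q<1
  where
  open +-*-Solver
  same : ∀ n → seq (normSq q) n ≡ seq (normSq (q * 1ℂ)) n
  same n = solve 2
    (λ a b → a :* a :+ b :* b :=
       (a :* con 1ℚ :- b :* con 0ℚ) :* (a :* con 1ℚ :- b :* con 0ℚ) :+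
       (a :* con 0ℚ :+ b :* con 1ℚ) :* (a :* con 0ℚ :+ b :* con 1ℚ))
    refl (seq (re q) n) (seq (im q) n)
qq^k<1 {q} q<1 (suc k) = *-∣∣<1 {q} {q * q ^ k} q<1 (qq^k<1 {q} q<1 k)

q-nonVanishing : ∀ {q} → ∣ q ∣< 1ℚ → NonVanishing q q
q-nonVanishing {q} q<1 k = 1-z#0 {q * q ^ k} (qq^k<1 {q} q<1 k)

poch#0 : ∀ {a q} → NonVanishing a q → ∀ n → poch a q n #0
poch#0         nv zero    = 1ℂ#0
poch#0 {a} {q} nv (suc n) = *-#0 {poch a q n} {1ℂ - a * q ^ n} (poch#0 {a} {q} nv n) (nv n)

pochPair#0 : ∀ {a b q} → NonVanishing a q → NonVanishing b q →
             ∀ n → poch a q n * poch b q n #0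
pochPair#0 {a} {b} {q} nva nvb n =
  *-#0 {poch a q n} {poch b q n} (poch#0 {a} {q} nva n) (poch#0 {b} {q} nvb n)

module _ (q : ℂ) (q<1 : ∣ q ∣< 1ℚ) where

  -- (q;q)ₙ / ((q;q)ₖ (q;q)ₙ₋ₖ); meaningful for k ≤ n, as ∸ truncates
  qBinomial : ℕ → ℕ → ℂ
  qBinomial n k = poch q q n / (poch q q k * poch q q (n ∸ k)) ∵
    *-#0 {poch q q k} {poch q q (n ∸ k)}
      (poch#0 {q} {q} (q-nonVanishing {q} q<1) k)
      (poch#0 {q} {q} (q-nonVanishing {q} q<1) (n ∸ k))

  P : ℕ → (x y : ℂ) → ℂ
  P n x y = ∏< n λ k → x - q ^ k * y

  h : ℕ → (x y : ℂ) → ℂ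
  h n x y = ∑< (suc n) λ k → qBinomial n k * P k x y

  expTerm : ℂ → ℕ → ℂ
  expTerm z n = z ^ n / poch q q n ∵ poch#0 {q} {q} (q-nonVanishing {q} q<1) n

  -- ₂φ₁(a₁,a₂;b₁;q,z) = Φ
  Is₂φ₁ : (a₁ a₂ b₁ : ℂ) → NonVanishing b₁ q → (z Φ : ℂ) → Set
  Is₂φ₁ a₁ a₂ b₁ nv z Φ = HasSum term Φ
    where
    term : ℕ → ℂ
    term n = ((poch a₁ q n * poch a₂ q n) / (poch q q n * poch b₁ q n) ∵
                pochPair#0 {q} {b₁} {q} (q-nonVanishing {q} q<1) nv n)
             * z ^ n

-- Write η_j(m) = h_m(q^j x, q^j y | q). The q-Pascal rule gives
--   η_j(m+1) = q^j x η_j(m) + (1 - q^j y) η_{j+1}(m),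
-- and hence, by induction on n,
--   h_{n+m}(x,y|q) = ∑_{k≤n} [n k] (y;q)_k x^{n-k} η_k(m).
-- By the q-binomial theorem ∑_m η_k(m) s^m/(q;q)_m = (ysq^k;q)_∞ / ((s;q)_∞ (xsq^k;q)_∞), so the
-- inner sum over m is the product of (ys;q)_∞ / ((s,xs;q)_∞) with a finite sum over k. Summed over n,
-- these finite sums form the Cauchy product of the ₂φ₁ series with ∑_j (xt)^j/(q;q)_j = 1/(xt;q)_∞.
--
-- A complex number is a pair of Cauchy sequences of rationals on which all operations act termwise.
-- So the identities hold exactly in ℚ[i] at each index k, with error estimates uniform in k ≥ K,
-- and the limits u_∞ are the diagonal sequences k ↦ u_k at index k.

module Submission where

open import Defs
open import Algebra.Bundles using (CommutativeRing)
import Algebra.Solver.Ring.AlmostCommutativeRing as ACR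
import Algebra.Solver.Ring.Simple as RingSolver
open import Data.Integer.Base as ℤ using (ℤ)
import Data.Integer.Properties as ℤₚ
open import Data.Integer.Solver using (module +-*-Solver)
open import Data.Nat.Base as ℕ using (ℕ; zero; suc; _∸_; _⊔_; _⊓_)
import Data.Nat.Coprimality as Coprime
import Data.Nat.Properties as ℕₚ
open import Data.Product.Base using (_×_; _,_; proj₁; proj₂; Σ-syntax; ∃-syntax)
open import Data.Rational.Base as ℚ using (ℚ; 0ℚ; 1ℚ; ½)
import Data.Rational.Properties as ℚₚ
import Data.Rational.Solver as ℚ-Solver
import Data.Rational.Unnormalised.Base as ℚᵘ
import Data.Rational.Unnormalised.Properties as ℚᵘₚ
open import Data.Sum.Base using (_⊎_; inj₁; inj₂)
open import Relation.Binary.Definitions using (DecidableEquality)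
open import Relation.Binary.PropositionalEquality
open import Relation.Nullary using (Dec; yes; no; contradiction)
open Rat

-- Every series and product occurs only in truncated form, and the obstacle is to keep all constants
-- independent of the representation index. The estimates are therefore developed for families over
-- an abstract index set `I`, each constant and threshold being chosen before `i : I`. On the
-- indices to which this is applied, one rational `r < 1` dominates q, s, t, xs and xt, and one
-- constant bounds every inverse of 1 - ysqʲ; the hypothesis on ys by itself controls each j
-- separately. Moduli appear only squared, through `z ⊑ ρ`, so that all bounds stay rational.
--
-- Truncation leaves errors of order n rⁿ rather than rⁿ: a product of two partial sums differs from
-- the partial sum of the Cauchy product by n terms of size rⁿ, and the functional equation of the
-- q-binomial series has to be applied M times to a sum of M terms. Since x need not be small,
-- powers of x are summed only after multiplication by powers of s or t.

p+r≤p′ : ∀ {p r p′} → p ℚ.+ r ℚ.≤ p′ → 0ℚ ℚ.≤ r → p ℚ.≤ p′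
p+r≤p′ {p} le 0≤r = ℚₚ.≤-trans
  (ℚₚ.≤-trans (ℚₚ.≤-reflexive (sym (ℚₚ.+-identityʳ p))) (ℚₚ.+-monoʳ-≤ p 0≤r)) le

sq-cancel-≤ : ∀ {p r} → 0ℚ ℚ.≤ r → p ℚ.* p ℚ.≤ r ℚ.* r → p ℚ.≤ r
sq-cancel-≤ {p} {r} 0≤r pp≤rr with p ℚₚ.≤? r
... | yes p≤r = p≤r
... | no  p≰r = contradiction (ℚₚ.<-≤-trans (ℚₚ.≤-<-trans
        (ℚₚ.*-monoˡ-≤-nonNeg r {{nonNeg 0≤r}} (ℚₚ.<⇒≤ r<p))
        (ℚₚ.*-monoˡ-<-pos p {{pos (ℚₚ.≤-<-trans 0≤r r<p)}} r<p)) pp≤rr) (ℚₚ.<-irrefl refl)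
  where r<p = ℚₚ.≰⇒> p≰r

recip-inverse′ : ∀ {p} → p ≢ 0ℚ → recip p ℚ.* p ≡ 1ℚ
recip-inverse′ {p} p≢0 with p ℚₚ.≟ 0ℚ
... | yes p≡0 = contradiction p≡0 p≢0
... | no  p≢0 = ℚₚ.*-inverseˡ p {{ℚ.≢-nonZero p≢0}}

*-integral : ∀ {p r} → p ≢ 0ℚ → p ℚ.* r ≡ 0ℚ → r ≡ 0ℚ
*-integral {p} {r} p≢0 pr≡0 = begin
  r                       ≡⟨ ℚₚ.*-identityˡ r ⟨
  1ℚ ℚ.* r                ≡⟨ cong (ℚ._* r) (recip-inverse′ p≢0) ⟨
  recip p ℚ.* p ℚ.* r     ≡⟨ ℚₚ.*-assoc (recip p) p r ⟩
  recip p ℚ.* (p ℚ.* r)   ≡⟨ cong (recip p ℚ.*_) pr≡0 ⟩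
  recip p ℚ.* 0ℚ          ≡⟨ ℚₚ.*-zeroʳ (recip p) ⟩
  0ℚ                      ∎
  where open ≡-Reasoning

-- Holds at zero as well because `recip 0ℚ` is `0ℚ`; this makes `inv-⊗` an identity without side
-- conditions.
recip-* : ∀ p r → recip (p ℚ.* r) ≡ recip p ℚ.* recip r
recip-* p r = split (p ℚₚ.≟ 0ℚ) (r ℚₚ.≟ 0ℚ)
  where
  open ≡-Reasoning
  open ℚ-Solver.+-*-Solver
  split : Dec (p ≡ 0ℚ) → Dec (r ≡ 0ℚ) → recip (p ℚ.* r) ≡ recip p ℚ.* recip r
  split (yes p≡0) _ = trans
    (cong recip (trans (cong (ℚ._* r) p≡0) (ℚₚ.*-zeroˡ r)))
    (sym (trans (cong (λ a → recip a ℚ.* recip r) p≡0) (ℚₚ.*-zeroˡ (recip r))))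
  split (no _) (yes r≡0) = trans
    (cong recip (trans (cong (p ℚ.*_) r≡0) (ℚₚ.*-zeroʳ p)))
    (sym (trans (cong (λ a → recip p ℚ.* recip a) r≡0) (ℚₚ.*-zeroʳ (recip p))))
  split (no p≢0) (no r≢0) = begin
    a
      ≡⟨ solve 1 (λ a → a := a :* con 1ℚ :* con 1ℚ) refl a ⟩
    a ℚ.* 1ℚ ℚ.* 1ℚ
      ≡⟨ cong₂ (λ u v → a ℚ.* u ℚ.* v) (recip-inverse′ p≢0) (recip-inverse′ r≢0) ⟨
    a ℚ.* (b ℚ.* p) ℚ.* (c ℚ.* r)
      ≡⟨ solve 5 (λ a b c p r → a :* (b :* p) :* (c :* r) := a :* (p :* r) :* (b :* c)) refl a b c p r ⟩
    a ℚ.* (p ℚ.* r) ℚ.* (b ℚ.* c)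
      ≡⟨ cong (ℚ._* (b ℚ.* c)) (recip-inverse′ λ pr≡0 → r≢0 (*-integral p≢0 pr≡0)) ⟩
    1ℚ ℚ.* (b ℚ.* c)
      ≡⟨ ℚₚ.*-identityˡ _ ⟩
    b ℚ.* c ∎
    where
    a = recip (p ℚ.* r)
    b = recip p
    c = recip r

-- Gaussian rationals

record ℚ[i] : Set where
  no-eta-equality
  pattern
  constructor _,ᵢ_
  field
    Re Im : ℚ

open ℚ[i]


infixl 6 _⊕_ _⊖_
infixl 7 _⊗_
infixr 8 _↑_
infix  8 ⊝_

𝟘 𝟙 : ℚ[i]
𝟘 = 0ℚ ,ᵢ 0ℚ
𝟙 = 1ℚ ,ᵢ 0ℚ

_⊕_ _⊖_ _⊗_ : ℚ[i] → ℚ[i] → ℚ[i]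
z ⊕ w = (Re z ℚ.+ Re w) ,ᵢ (Im z ℚ.+ Im w)
z ⊖ w = (Re z ℚ.- Re w) ,ᵢ (Im z ℚ.- Im w)
z ⊗ w = (Re z ℚ.* Re w ℚ.- Im z ℚ.* Im w) ,ᵢ (Re z ℚ.* Im w ℚ.+ Im z ℚ.* Re w)

⊝_ : ℚ[i] → ℚ[i]
⊝ z = (ℚ.- Re z) ,ᵢ (ℚ.- Im z)

_↑_ : ℚ[i] → ℕ → ℚ[i]
z ↑ zero  = 𝟙
z ↑ suc n = z ⊗ z ↑ n

∥_∥² : ℚ[i] → ℚ
∥ z ∥² = Re z ℚ.* Re z ℚ.+ Im z ℚ.* Im z

-- The conjugate over the squared modulus, written exactly as division in `ℂ` acts on
-- representatives, so that `at` turns a quotient into `_⊗ inv _` by computation. Its value at 0 is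
-- 0.
inv : ℚ[i] → ℚ[i]
inv z = (Re z ℚ.* recip ∥ z ∥²) ,ᵢ (ℚ.- Im z ℚ.* recip ∥ z ∥²)

≡ᵢ : ∀ {z w} → Re z ≡ Re w → Im z ≡ Im w → z ≡ w
≡ᵢ {_ ,ᵢ _} {_ ,ᵢ _} = cong₂ _,ᵢ_

_≟ᵢ_ : DecidableEquality ℚ[i]
(a ,ᵢ b) ≟ᵢ (c ,ᵢ d) with a ℚₚ.≟ c | b ℚₚ.≟ d
... | yes refl | yes refl = yes refl
... | no a≢c   | _        = no λ { refl → a≢c refl }
... | yes _    | no b≢d   = no λ { refl → b≢d refl }

⊗-assoc : ∀ z w v → (z ⊗ w) ⊗ v ≡ z ⊗ (w ⊗ v)
⊗-assoc (a ,ᵢ b) (c ,ᵢ d) (e ,ᵢ f) = cong₂ _,ᵢ_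
  (solve 6 (λ a b c d e f → (a :* c :- b :* d) :* e :- (a :* d :+ b :* c) :* f :=
                            a :* (c :* e :- d :* f) :- b :* (c :* f :+ d :* e)) refl a b c d e f)
  (solve 6 (λ a b c d e f → (a :* c :- b :* d) :* f :+ (a :* d :+ b :* c) :* e :=
                            a :* (c :* f :+ d :* e) :+ b :* (c :* e :- d :* f)) refl a b c d e f)
  where open ℚ-Solver.+-*-Solver

⊗-comm : ∀ z w → z ⊗ w ≡ w ⊗ z
⊗-comm (a ,ᵢ b) (c ,ᵢ d) = cong₂ _,ᵢ_
  (solve 4 (λ a b c d → a :* c :- b :* d := c :* a :- d :* b) refl a b c d)
  (solve 4 (λ a b c d → a :* d :+ b :* c := c :* b :+ d :* a) refl a b c d)
  where open ℚ-Solver.+-*-Solver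

⊗-identityˡ : ∀ z → 𝟙 ⊗ z ≡ z
⊗-identityˡ (a ,ᵢ b) = cong₂ _,ᵢ_
  (solve 2 (λ a b → con 1ℚ :* a :- con 0ℚ :* b := a) refl a b)
  (solve 2 (λ a b → con 1ℚ :* b :+ con 0ℚ :* a := b) refl a b)
  where open ℚ-Solver.+-*-Solver

⊗-distribˡ-⊕ : ∀ z w v → z ⊗ (w ⊕ v) ≡ z ⊗ w ⊕ z ⊗ v
⊗-distribˡ-⊕ (a ,ᵢ b) (c ,ᵢ d) (e ,ᵢ f) = cong₂ _,ᵢ_
  (solve 6 (λ a b c d e f → a :* (c :+ e) :- b :* (d :+ f) :=
                            (a :* c :- b :* d) :+ (a :* e :- b :* f)) refl a b c d e f)
  (solve 6 (λ a b c d e f → a :* (d :+ f) :+ b :* (c :+ e) :=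
                            (a :* d :+ b :* c) :+ (a :* f :+ b :* e)) refl a b c d e f)
  where open ℚ-Solver.+-*-Solver

⊕-⊗-commutativeRing : CommutativeRing _ _
⊕-⊗-commutativeRing = record
  { _≈_ = _≡_ ; _+_ = _⊕_ ; _*_ = _⊗_ ; -_ = ⊝_ ; 0# = 𝟘 ; 1# = 𝟙
  ; isCommutativeRing = record
    { isRing = record
      { +-isAbelianGroup = record
        { isGroup = record
          { isMonoid = record
            { isSemigroup = record
              { isMagma = record { isEquivalence = isEquivalence ; ∙-cong = cong₂ _⊕_ }
              ; assoc = λ z w v → ≡ᵢ (ℚₚ.+-assoc (Re z) (Re w) (Re v)) (ℚₚ.+-assoc (Im z) (Im w) (Im v)) }
            ; identity = (λ z → ≡ᵢ (ℚₚ.+-identityˡ (Re z)) (ℚₚ.+-identityˡ (Im z)))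
                       , (λ z → ≡ᵢ (ℚₚ.+-identityʳ (Re z)) (ℚₚ.+-identityʳ (Im z))) }
          ; inverse = (λ z → ≡ᵢ (ℚₚ.+-inverseˡ (Re z)) (ℚₚ.+-inverseˡ (Im z)))
                    , (λ z → ≡ᵢ (ℚₚ.+-inverseʳ (Re z)) (ℚₚ.+-inverseʳ (Im z)))
          ; ⁻¹-cong = cong ⊝_ }
        ; comm = λ z w → ≡ᵢ (ℚₚ.+-comm (Re z) (Re w)) (ℚₚ.+-comm (Im z) (Im w)) }
      ; *-cong = cong₂ _⊗_
      ; *-assoc = ⊗-assoc
      ; *-identity = ⊗-identityˡ , (λ z → trans (⊗-comm z 𝟙) (⊗-identityˡ z))
      ; distrib = ⊗-distribˡ-⊕
                , (λ z w v → trans (⊗-comm (w ⊕ v) z) (trans (⊗-distribˡ-⊕ z w v) (cong₂ _⊕_ (⊗-comm z w) (⊗-comm z v)))) }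
    ; *-comm = ⊗-comm } }

module ℚ[i]-Solver = RingSolver (ACR.fromCommutativeRing ⊕-⊗-commutativeRing) _≟ᵢ_

-- Bounds on moduli and on inverses

infix 4 _⊑_

-- The bound ∣z∣ ≤ ρ with both sides squared. The sign of `ρ` is carried along because squared
-- bounds can only be compared and multiplied for nonnegative `ρ`.
record _⊑_ (z : ℚ[i]) (ρ : ℚ) : Set where
  constructor mk⊑
  field
    0≤bound : 0ℚ ℚ.≤ ρ
    ∥∥²≤    : ∥ z ∥² ℚ.≤ ρ ℚ.* ρ

open _⊑_


∥∥²-⊗ : ∀ z w → ∥ z ⊗ w ∥² ≡ ∥ z ∥² ℚ.* ∥ w ∥²
∥∥²-⊗ (a ,ᵢ b) (c ,ᵢ d) = solve 4
  (λ a b c d → (a :* c :- b :* d) :* (a :* c :- b :* d) :+ (a :* d :+ b :* c) :* (a :* d :+ b :* c) :=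
               (a :* a :+ b :* b) :* (c :* c :+ d :* d)) refl a b c d
  where open ℚ-Solver.+-*-Solver

0≤∥∥² : ∀ z → 0ℚ ℚ.≤ ∥ z ∥²
0≤∥∥² z = ℚₚ.+-mono-≤ (0≤p*p (Re z)) (0≤p*p (Im z))

⊑-mono : ∀ {z ρ σ} → ρ ℚ.≤ σ → z ⊑ ρ → z ⊑ σ
⊑-mono ρ≤σ (mk⊑ 0≤ρ z≤) = mk⊑ 0≤σ (ℚₚ.≤-trans z≤ (*-mono-≤ 0≤ρ 0≤σ ρ≤σ ρ≤σ))
  where 0≤σ = ℚₚ.≤-trans 0≤ρ ρ≤σ

⊑-cong : ∀ {z w ρ} → w ≡ z → z ⊑ ρ → w ⊑ ρ
⊑-cong refl z⊑ρ = z⊑ρ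

⊑-⊗ : ∀ {z w ρ σ} → z ⊑ ρ → w ⊑ σ → z ⊗ w ⊑ ρ ℚ.* σ
⊑-⊗ {z} {w} {ρ} {σ} (mk⊑ 0≤ρ z≤) (mk⊑ 0≤σ w≤) = mk⊑ (*-nonNeg 0≤ρ 0≤σ) (begin
  ∥ z ⊗ w ∥²                  ≡⟨ ∥∥²-⊗ z w ⟩
  ∥ z ∥² ℚ.* ∥ w ∥²           ≤⟨ *-mono-≤ (0≤∥∥² z) (*-nonNeg 0≤σ 0≤σ) z≤ w≤ ⟩
  ρ ℚ.* ρ ℚ.* (σ ℚ.* σ)       ≡⟨ solve 2 (λ ρ σ → ρ :* ρ :* (σ :* σ) := ρ :* σ :* (ρ :* σ)) refl ρ σ ⟩
  ρ ℚ.* σ ℚ.* (ρ ℚ.* σ)       ∎)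
  where
  open ℚₚ.≤-Reasoning
  open ℚ-Solver.+-*-Solver

-- Cauchy–Schwarz bounds the cross term ac + bd of ∥z + w∥² by ρσ.
⊑-⊕ : ∀ {z w ρ σ} → z ⊑ ρ → w ⊑ σ → z ⊕ w ⊑ ρ ℚ.+ σ
⊑-⊕ {z@(a ,ᵢ b)} {w@(c ,ᵢ d)} {ρ} {σ} (mk⊑ 0≤ρ z≤) (mk⊑ 0≤σ w≤) = mk⊑ (ℚₚ.+-mono-≤ 0≤ρ 0≤σ) (begin
  ∥ z ⊕ w ∥²
    ≡⟨ solve 4 (λ a b c d → (a :+ c) :* (a :+ c) :+ (b :+ d) :* (b :+ d) :=
                  ((a :* a :+ b :* b) :+ (c :* c :+ d :* d)) :+ ((a :* c :+ b :* d) :+ (a :* c :+ b :* d))) refl a b c d ⟩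
  (∥ z ∥² ℚ.+ ∥ w ∥²) ℚ.+ (p ℚ.+ p)
    ≤⟨ ℚₚ.+-mono-≤ (ℚₚ.+-mono-≤ z≤ w≤) (ℚₚ.+-mono-≤ p≤ρσ p≤ρσ) ⟩
  (ρ ℚ.* ρ ℚ.+ σ ℚ.* σ) ℚ.+ (ρ ℚ.* σ ℚ.+ ρ ℚ.* σ)
    ≡⟨ solve 2 (λ ρ σ → (ρ :* ρ :+ σ :* σ) :+ (ρ :* σ :+ ρ :* σ) := (ρ :+ σ) :* (ρ :+ σ)) refl ρ σ ⟩
  (ρ ℚ.+ σ) ℚ.* (ρ ℚ.+ σ) ∎)
  where
  open ℚₚ.≤-Reasoning
  open ℚ-Solver.+-*-Solver
  p = a ℚ.* c ℚ.+ b ℚ.* d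
  e = a ℚ.* d ℚ.- b ℚ.* c
  p≤ρσ : p ℚ.≤ ρ ℚ.* σ
  p≤ρσ = sq-cancel-≤ (*-nonNeg 0≤ρ 0≤σ) (begin
    p ℚ.* p                   ≤⟨ p+r≤p′ ℚₚ.≤-refl (0≤p*p e) ⟩
    p ℚ.* p ℚ.+ e ℚ.* e       ≡⟨ solve 4 (λ a b c d →
        (a :* c :+ b :* d) :* (a :* c :+ b :* d) :+ (a :* d :- b :* c) :* (a :* d :- b :* c) :=
        (a :* a :+ b :* b) :* (c :* c :+ d :* d)) refl a b c d ⟩
    ∥ z ∥² ℚ.* ∥ w ∥²         ≤⟨ *-mono-≤ (0≤∥∥² z) (*-nonNeg 0≤σ 0≤σ) z≤ w≤ ⟩
    ρ ℚ.* ρ ℚ.* (σ ℚ.* σ)     ≡⟨ solve 2 (λ ρ σ → ρ :* ρ :* (σ :* σ) := ρ :* σ :* (ρ :* σ)) refl ρ σ ⟩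
    ρ ℚ.* σ ℚ.* (ρ ℚ.* σ)     ∎)

⊑-⊝ : ∀ {z ρ} → z ⊑ ρ → ⊝ z ⊑ ρ
⊑-⊝ {a ,ᵢ b} {ρ} (mk⊑ 0≤ρ z≤) = mk⊑ 0≤ρ (subst (ℚ._≤ ρ ℚ.* ρ)
  (solve 2 (λ a b → a :* a :+ b :* b := (:- a) :* (:- a) :+ (:- b) :* (:- b)) refl a b) z≤)
  where open ℚ-Solver.+-*-Solver

⊑-⊖ : ∀ {z w ρ σ} → z ⊑ ρ → w ⊑ σ → z ⊖ w ⊑ ρ ℚ.+ σ
⊑-⊖ z⊑ρ w⊑σ = ⊑-⊕ z⊑ρ (⊑-⊝ w⊑σ)

𝟘⊑0 : 𝟘 ⊑ 0ℚ
𝟘⊑0 = mk⊑ ℚₚ.≤-refl ℚₚ.≤-refl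

𝟙⊑1 : 𝟙 ⊑ 1ℚ
𝟙⊑1 = mk⊑ (ℚₚ.nonNegative⁻¹ 1ℚ) ℚₚ.≤-refl

Re≤ : ∀ {z ρ} → z ⊑ ρ → Re z ℚ.≤ ρ
Re≤ {z} (mk⊑ 0≤ρ z≤) = sq-cancel-≤ 0≤ρ (p+r≤p′ z≤ (0≤p*p (Im z)))

Im≤ : ∀ {z ρ} → z ⊑ ρ → Im z ℚ.≤ ρ
Im≤ {z} (mk⊑ 0≤ρ z≤) = sq-cancel-≤ 0≤ρ
  (p+r≤p′ (ℚₚ.≤-trans (ℚₚ.≤-reflexive (ℚₚ.+-comm (Im z ℚ.* Im z) (Re z ℚ.* Re z))) z≤) (0≤p*p (Re z)))

inv-⊗ : ∀ z w → inv (z ⊗ w) ≡ inv z ⊗ inv w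
inv-⊗ z@(a ,ᵢ b) w@(c ,ᵢ d) = trans
  (cong (λ s → ((a ℚ.* c ℚ.- b ℚ.* d) ℚ.* s) ,ᵢ (ℚ.- (a ℚ.* d ℚ.+ b ℚ.* c) ℚ.* s))
    (trans (cong recip (∥∥²-⊗ z w)) (recip-* ∥ z ∥² ∥ w ∥²)))
  (cong₂ _,ᵢ_
    (solve 6 (λ a b c d u v → (a :* c :- b :* d) :* (u :* v) :=
        (a :* u) :* (c :* v) :- ((:- b) :* u) :* ((:- d) :* v)) refl a b c d (recip ∥ z ∥²) (recip ∥ w ∥²))
    (solve 6 (λ a b c d u v → (:- (a :* d :+ b :* c)) :* (u :* v) :=
        (a :* u) :* ((:- d) :* v) :+ ((:- b) :* u) :* (c :* v)) refl a b c d (recip ∥ z ∥²) (recip ∥ w ∥²)))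
  where open ℚ-Solver.+-*-Solver

recip-antimono : ∀ {p r} → 0ℚ ℚ.< p → p ℚ.≤ r → recip r ℚ.≤ recip p
recip-antimono {p} {r} 0<p p≤r = begin
  recip r                     ≡⟨ ℚₚ.*-identityʳ (recip r) ⟨
  recip r ℚ.* 1ℚ              ≡⟨ cong (recip r ℚ.*_) (recip-inverse 0<p) ⟨
  recip r ℚ.* (recip p ℚ.* p) ≤⟨ ℚₚ.*-monoˡ-≤-nonNeg (recip r) {{nonNeg (ℚₚ.<⇒≤ (recip-pos 0<r))}}
                                   (ℚₚ.*-monoˡ-≤-nonNeg (recip p) {{nonNeg (ℚₚ.<⇒≤ (recip-pos 0<p))}} p≤r) ⟩
  recip r ℚ.* (recip p ℚ.* r) ≡⟨ solve 3 (λ a b c → a :* (b :* c) := b :* (a :* c)) refl (recip r) (recip p) r ⟩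
  recip p ℚ.* (recip r ℚ.* r) ≡⟨ cong (recip p ℚ.*_) (recip-inverse 0<r) ⟩
  recip p ℚ.* 1ℚ              ≡⟨ ℚₚ.*-identityʳ (recip p) ⟩
  recip p                     ∎
  where
  open ℚₚ.≤-Reasoning
  open ℚ-Solver.+-*-Solver
  0<r = ℚₚ.<-≤-trans 0<p p≤r

infix 4 _⁻¹⊑_

-- Since `inv` is total, a bound on `inv z` alone would also hold at z = 0; the equation records
-- that the inverse is genuine.
record _⁻¹⊑_ (z : ℚ[i]) (ρ : ℚ) : Set where
  constructor mk⁻¹⊑
  field
    inverseʳ : z ⊗ inv z ≡ 𝟙
    inv⊑     : inv z ⊑ ρ

open _⁻¹⊑_


-- The squared modulus of `inv z` is the reciprocal of that of `z`, so a lower bound for one is an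
-- upper bound for the other.
⁻¹⊑-lower : ∀ {z c ρ} → 0ℚ ℚ.< c → c ℚ.≤ ∥ z ∥² → 0ℚ ℚ.≤ ρ → recip c ℚ.≤ ρ ℚ.* ρ → z ⁻¹⊑ ρ
⁻¹⊑-lower {z@(a ,ᵢ b)} {c} {ρ} 0<c c≤ 0≤ρ c⁻¹≤ = mk⁻¹⊑
  (cong₂ _,ᵢ_
    (trans (solve 3 (λ a b s → a :* (a :* s) :- b :* ((:- b) :* s) := s :* (a :* a :+ b :* b)) refl a b s) s∥z∥²≡1)
    (solve 3 (λ a b s → a :* ((:- b) :* s) :+ b :* (a :* s) := con 0ℚ) refl a b s))
  (mk⊑ 0≤ρ (begin
    ∥ inv z ∥²           ≡⟨ solve 3 (λ a b s → (a :* s) :* (a :* s) :+ ((:- b) :* s) :* ((:- b) :* s) :=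
                              s :* (s :* (a :* a :+ b :* b))) refl a b s ⟩
    s ℚ.* (s ℚ.* ∥ z ∥²) ≡⟨ cong (s ℚ.*_) s∥z∥²≡1 ⟩
    s ℚ.* 1ℚ             ≡⟨ ℚₚ.*-identityʳ s ⟩
    s                    ≤⟨ recip-antimono 0<c c≤ ⟩
    recip c              ≤⟨ c⁻¹≤ ⟩
    ρ ℚ.* ρ              ∎))
  where
  open ℚₚ.≤-Reasoning
  open ℚ-Solver.+-*-Solver
  s = recip ∥ z ∥²
  s∥z∥²≡1 : s ℚ.* ∥ z ∥² ≡ 1ℚ
  s∥z∥²≡1 = recip-inverse (ℚₚ.<-≤-trans 0<c c≤)

p<r⇒0<r-p : ∀ {p r} → p ℚ.< r → 0ℚ ℚ.< r ℚ.- p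
p<r⇒0<r-p {p} {r} p<r = subst (ℚ._< r ℚ.- p) (ℚₚ.+-inverseʳ p) (ℚₚ.+-monoˡ-< (ℚ.- p) p<r)

-- The real part suffices: Re (1 - z) ≥ 1 - ρ > 0, hence ∣1 - z∣ ≥ 1 - ρ.
1-z⁻¹⊑ : ∀ {z ρ} → ρ ℚ.< 1ℚ → z ⊑ ρ → 𝟙 ⊖ z ⁻¹⊑ recip (1ℚ ℚ.- ρ)
1-z⁻¹⊑ {z@(a ,ᵢ b)} {ρ} ρ<1 z⊑ρ = ⁻¹⊑-lower (*-pos 0<d 0<d) (begin
  d ℚ.* d                                   ≤⟨ *-mono-≤ (ℚₚ.<⇒≤ 0<d) (ℚₚ.≤-trans (ℚₚ.<⇒≤ 0<d) d≤) d≤ d≤ ⟩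
  (1ℚ ℚ.- a) ℚ.* (1ℚ ℚ.- a)                 ≤⟨ p+r≤p′ ℚₚ.≤-refl (0≤p*p (0ℚ ℚ.- b)) ⟩
  ∥ 𝟙 ⊖ z ∥²                                ∎)
  (ℚₚ.<⇒≤ (recip-pos 0<d))
  (ℚₚ.≤-reflexive (recip-* d d))
  where
  open ℚₚ.≤-Reasoning
  d = 1ℚ ℚ.- ρ
  0<d = p<r⇒0<r-p ρ<1
  d≤ : d ℚ.≤ 1ℚ ℚ.- a
  d≤ = ℚₚ.+-monoʳ-≤ 1ℚ (ℚₚ.neg-antimono-≤ (Re≤ z⊑ρ))

-- Geometric decay

ι : ℕ → ℚ
ι zero    = 0ℚ
ι (suc n) = 1ℚ ℚ.+ ι n

n/1 : ℕ → ℚ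
n/1 n = ℚ.mkℚ (ℤ.+ n) 0 (Coprime.sym (Coprime.1-coprimeTo n))

ι≡n/1 : ∀ n → ι n ≡ n/1 n
ι≡n/1 zero    = ℚₚ.toℚᵘ-injective (ℚᵘ.*≡* refl)
ι≡n/1 (suc n) = trans (cong (1ℚ ℚ.+_) (ι≡n/1 n)) (ℚₚ.toℚᵘ-injective
  (ℚᵘₚ.≃-trans (ℚₚ.toℚᵘ-homo-+ 1ℚ (n/1 n))
    (ℚᵘ.*≡* (solve 1 (λ m → (con (ℤ.+ 1) :* con (ℤ.+ 1) :+ m :* con (ℤ.+ 1)) :* con (ℤ.+ 1) :=
                            (con (ℤ.+ 1) :+ m) :* (con (ℤ.+ 1) :* con (ℤ.+ 1))) refl (ℤ.+ n)))))
  where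
  open +-*-Solver

-- The denominator is at least 1, so the absolute value of the numerator is large enough.
archimedean : ∀ p → ∃[ n ] p ℚ.≤ ι n
archimedean p@(ℚ.mkℚ num den-1 _) = ℤ.∣ num ∣ , subst (p ℚ.≤_) (sym (ι≡n/1 ℤ.∣ num ∣)) (ℚ.*≤* (begin
  num ℤ.* (ℤ.+ 1)                     ≡⟨ ℤₚ.*-identityʳ num ⟩
  num                                 ≤⟨ ≤∣∣ num ⟩
  ℤ.+ ℤ.∣ num ∣                       ≤⟨ ℤ.+≤+ (ℕₚ.m≤m*n ℤ.∣ num ∣ (suc den-1)) ⟩
  ℤ.+ (ℤ.∣ num ∣ ℕ.* suc den-1)       ≡⟨ ℤₚ.pos-* ℤ.∣ num ∣ (suc den-1) ⟩
  ℤ.+ ℤ.∣ num ∣ ℤ.* ℤ.+ suc den-1     ∎))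
  where
  open ℤₚ.≤-Reasoning
  ≤∣∣ : ∀ i → i ℤ.≤ ℤ.+ ℤ.∣ i ∣
  ≤∣∣ (ℤ.+ n)      = ℤₚ.≤-refl
  ≤∣∣ (ℤ.-[1+ n ]) = ℤ.-≤+

0≤ι : ∀ n → 0ℚ ℚ.≤ ι n
0≤ι zero    = ℚₚ.≤-refl
0≤ι (suc n) = ℚₚ.+-mono-≤ (ℚₚ.nonNegative⁻¹ 1ℚ) (0≤ι n)

ι-mono : ∀ {m n} → m ℕ.≤ n → ι m ℚ.≤ ι n
ι-mono {n = n} ℕ.z≤n = 0≤ι n
ι-mono (ℕ.s≤s m≤n)   = ℚₚ.+-monoʳ-≤ 1ℚ (ι-mono m≤n)

infixr 8 _^ℚ_

_^ℚ_ : ℚ → ℕ → ℚ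
p ^ℚ zero  = 1ℚ
p ^ℚ suc n = p ℚ.* p ^ℚ n

^ℚ-nonNeg : ∀ {p} → 0ℚ ℚ.≤ p → ∀ n → 0ℚ ℚ.≤ p ^ℚ n
^ℚ-nonNeg 0≤p zero    = ℚₚ.nonNegative⁻¹ 1ℚ
^ℚ-nonNeg 0≤p (suc n) = *-nonNeg 0≤p (^ℚ-nonNeg 0≤p n)

^ℚ-≤1 : ∀ {p} → 0ℚ ℚ.≤ p → p ℚ.≤ 1ℚ → ∀ n → p ^ℚ n ℚ.≤ 1ℚ
^ℚ-≤1 0≤p p≤1 zero    = ℚₚ.≤-refl
^ℚ-≤1 0≤p p≤1 (suc n) = *-mono-≤ 0≤p (ℚₚ.nonNegative⁻¹ 1ℚ) p≤1 (^ℚ-≤1 0≤p p≤1 n)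

^ℚ-mono : ∀ {p r} → 0ℚ ℚ.≤ p → p ℚ.≤ r → ∀ n → p ^ℚ n ℚ.≤ r ^ℚ n
^ℚ-mono 0≤p p≤r zero    = ℚₚ.≤-refl
^ℚ-mono 0≤p p≤r (suc n) = *-mono-≤ 0≤p (^ℚ-nonNeg (ℚₚ.≤-trans 0≤p p≤r) n) p≤r (^ℚ-mono 0≤p p≤r n)

^ℚ-* : ∀ p r n → (p ℚ.* r) ^ℚ n ≡ p ^ℚ n ℚ.* r ^ℚ n
^ℚ-* p r zero    = refl
^ℚ-* p r (suc n) = trans (cong (p ℚ.* r ℚ.*_) (^ℚ-* p r n))
  (solve 4 (λ p r u v → p :* r :* (u :* v) := p :* u :* (r :* v)) refl p r (p ^ℚ n) (r ^ℚ n))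
  where open ℚ-Solver.+-*-Solver

^ℚ-+ : ∀ p m n → p ^ℚ (m ℕ.+ n) ≡ p ^ℚ m ℚ.* p ^ℚ n
^ℚ-+ p zero    n = sym (ℚₚ.*-identityˡ (p ^ℚ n))
^ℚ-+ p (suc m) n = trans (cong (p ℚ.*_) (^ℚ-+ p m n)) (sym (ℚₚ.*-assoc p (p ^ℚ m) (p ^ℚ n)))

module _ {r : ℚ} (0≤r : 0ℚ ℚ.≤ r) (r<1 : r ℚ.< 1ℚ) where

  private
    d   = 1ℚ ℚ.- r
    0<d = p<r⇒0<r-p r<1

  -- A division-free form of Bernoulli's inequality. With d = 1 - r the induction step is (1 - d)(1
  -- + (n+1)d) + (n+1)d² = 1 + nd.
  bernoulli : ∀ n → r ^ℚ n ℚ.* (1ℚ ℚ.+ ι n ℚ.* d) ℚ.≤ 1ℚ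
  bernoulli zero    = ℚₚ.≤-reflexive (solve 1 (λ d → con 1ℚ :* (con 1ℚ :+ con 0ℚ :* d) := con 1ℚ) refl d)
    where open ℚ-Solver.+-*-Solver
  bernoulli (suc n) = begin
    r ℚ.* u ℚ.* (1ℚ ℚ.+ (1ℚ ℚ.+ ι n) ℚ.* d)
      ≤⟨ p+r≤p′ ℚₚ.≤-refl (*-nonNeg (*-nonNeg (^ℚ-nonNeg 0≤r n) (0≤ι (suc n))) (0≤p*p d)) ⟩
    r ℚ.* u ℚ.* (1ℚ ℚ.+ (1ℚ ℚ.+ ι n) ℚ.* d) ℚ.+ u ℚ.* ι (suc n) ℚ.* (d ℚ.* d)
      ≡⟨ solve 3 (λ r u m → let d = con 1ℚ :- r in
           r :* u :* (con 1ℚ :+ (con 1ℚ :+ m) :* d) :+ u :* (con 1ℚ :+ m) :* (d :* d) :=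
           u :* (con 1ℚ :+ m :* d)) refl r u (ι n) ⟩
    u ℚ.* (1ℚ ℚ.+ ι n ℚ.* d)
      ≤⟨ bernoulli n ⟩
    1ℚ ∎
    where
    open ℚₚ.≤-Reasoning
    open ℚ-Solver.+-*-Solver
    u = r ^ℚ n

  ι*r^n≤ : ∀ n → ι n ℚ.* r ^ℚ n ℚ.≤ recip d
  ι*r^n≤ n = begin
    ι n ℚ.* u                          ≡⟨ ℚₚ.*-identityʳ _ ⟨
    ι n ℚ.* u ℚ.* 1ℚ                   ≡⟨ cong (ι n ℚ.* u ℚ.*_) (recip-inverse 0<d) ⟨
    ι n ℚ.* u ℚ.* (recip d ℚ.* d)      ≡⟨ solve 4 (λ m u e d → m :* u :* (e :* d) := e :* (u :* (m :* d)))
                                            refl (ι n) u (recip d) d ⟩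
    recip d ℚ.* (u ℚ.* (ι n ℚ.* d))    ≤⟨ ℚₚ.*-monoˡ-≤-nonNeg (recip d) {{nonNeg 0≤e}}
      (ℚₚ.≤-trans (ℚₚ.*-monoˡ-≤-nonNeg u {{nonNeg (^ℚ-nonNeg 0≤r n)}}
         (ℚₚ.≤-trans (p+r≤p′ ℚₚ.≤-refl (ℚₚ.nonNegative⁻¹ 1ℚ)) (ℚₚ.≤-reflexive (ℚₚ.+-comm (ι n ℚ.* d) 1ℚ))))
       (bernoulli n)) ⟩
    recip d ℚ.* 1ℚ                     ≡⟨ ℚₚ.*-identityʳ (recip d) ⟩
    recip d                            ∎
    where
    open ℚₚ.≤-Reasoning
    open ℚ-Solver.+-*-Solver
    u = r ^ℚ n
    0≤e = ℚₚ.<⇒≤ (recip-pos 0<d)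

  -- Bernoulli yields only rⁿ ≤ 1/(dn) with d = 1 - r, which is enough once n exceeds C/(dε).
  C*r^n≤ε : ∀ C ε → 0ℚ ℚ.≤ C → 0ℚ ℚ.< ε → ∃[ N ] ∀ n → N ℕ.≤ n → C ℚ.* r ^ℚ n ℚ.≤ ε
  -- The threshold is `suc N` so that n is positive and `ι n` can be inverted.
  C*r^n≤ε C ε 0≤C 0<ε with N , C/dε≤N ← archimedean (C ℚ.* recip d ℚ.* recip ε) = suc N , bound
    where
    open ℚₚ.≤-Reasoning
    open ℚ-Solver.+-*-Solver
    bound : ∀ n → suc N ℕ.≤ n → C ℚ.* r ^ℚ n ℚ.≤ ε
    bound n@(suc k) (ℕ.s≤s N≤k) = begin
      C ℚ.* u                               ≡⟨ ℚₚ.*-identityʳ (C ℚ.* u) ⟨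
      C ℚ.* u ℚ.* 1ℚ                        ≡⟨ cong (C ℚ.* u ℚ.*_) (recip-inverse 0<m) ⟨
      C ℚ.* u ℚ.* (f ℚ.* m)                 ≡⟨ solve 4 (λ C u f m → C :* u :* (f :* m) := f :* (C :* (m :* u))) refl
          C u f m ⟩
      f ℚ.* (C ℚ.* (m ℚ.* u))               ≤⟨ ℚₚ.*-monoˡ-≤-nonNeg f {{nonNeg 0≤f}}
                                                 (ℚₚ.*-monoˡ-≤-nonNeg C {{nonNeg 0≤C}} (ι*r^n≤ n)) ⟩
      f ℚ.* D                               ≡⟨ cong (f ℚ.*_) (ℚₚ.*-identityʳ D) ⟨
      f ℚ.* (D ℚ.* 1ℚ)                      ≡⟨ cong (λ e → f ℚ.* (D ℚ.* e)) (recip-inverse 0<ε) ⟨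
      f ℚ.* (D ℚ.* (recip ε ℚ.* ε))         ≡⟨ cong (f ℚ.*_) (ℚₚ.*-assoc D (recip ε) ε) ⟨
      f ℚ.* (D ℚ.* recip ε ℚ.* ε)           ≤⟨ ℚₚ.*-monoˡ-≤-nonNeg f {{nonNeg 0≤f}}
                                                 (ℚₚ.*-monoʳ-≤-nonNeg ε {{nonNeg (ℚₚ.<⇒≤ 0<ε)}}
                                                   (ℚₚ.≤-trans C/dε≤N (ι-mono (ℕₚ.m≤n⇒m≤1+n N≤k)))) ⟩
      f ℚ.* (m ℚ.* ε)                       ≡⟨ ℚₚ.*-assoc f m ε ⟨
      f ℚ.* m ℚ.* ε                         ≡⟨ cong (ℚ._* ε) (recip-inverse 0<m) ⟩
      1ℚ ℚ.* ε                              ≡⟨ ℚₚ.*-identityˡ ε ⟩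
      ε                                     ∎
      where
      m = ι n
      u = r ^ℚ n
      f = recip m
      D = C ℚ.* recip d
      0<m : 0ℚ ℚ.< m
      0<m = ℚₚ.+-mono-<-≤ (ℚₚ.positive⁻¹ 1ℚ) (0≤ι k)
      0≤f = ℚₚ.<⇒≤ (recip-pos 0<m)

-- With ρ = (1+r)/2 one has r ≤ ρ² (AM–GM), so n rⁿ ≤ (n ρⁿ) ρⁿ.
C*n*r^n≤ε : ∀ {r} → 0ℚ ℚ.≤ r → r ℚ.< 1ℚ → ∀ C ε → 0ℚ ℚ.≤ C → 0ℚ ℚ.< ε →
            ∃[ N ] ∀ n → N ℕ.≤ n → C ℚ.* (ι n ℚ.* r ^ℚ n) ℚ.≤ ε
C*n*r^n≤ε {r} 0≤r r<1 C ε 0≤C 0<ε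
  = proj₁ small , λ n N≤n → begin
    C ℚ.* (ι n ℚ.* r ^ℚ n)
      ≤⟨ ℚₚ.*-monoˡ-≤-nonNeg C {{nonNeg 0≤C}} (ℚₚ.*-monoˡ-≤-nonNeg (ι n) {{nonNeg (0≤ι n)}}
           (ℚₚ.≤-trans (^ℚ-mono 0≤r r≤ρρ n) (ℚₚ.≤-reflexive (^ℚ-* ρ ρ n)))) ⟩
    C ℚ.* (ι n ℚ.* (ρ ^ℚ n ℚ.* ρ ^ℚ n))
      ≡⟨ solve 3 (λ C m u → C :* (m :* (u :* u)) := C :* ((m :* u) :* u)) refl C (ι n) (ρ ^ℚ n) ⟩
    C ℚ.* (ι n ℚ.* ρ ^ℚ n ℚ.* ρ ^ℚ n)
      ≤⟨ ℚₚ.*-monoˡ-≤-nonNeg C {{nonNeg 0≤C}} (ℚₚ.*-monoʳ-≤-nonNeg (ρ ^ℚ n)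
          {{nonNeg (^ℚ-nonNeg 0≤ρ n)}} (ι*r^n≤ 0≤ρ ρ<1 n)) ⟩
    C ℚ.* (recip (1ℚ ℚ.- ρ) ℚ.* ρ ^ℚ n)
      ≡⟨ ℚₚ.*-assoc C _ _ ⟨
    C ℚ.* recip (1ℚ ℚ.- ρ) ℚ.* ρ ^ℚ n
      ≤⟨ proj₂ small n N≤n ⟩
    ε ∎
  where
  open ℚₚ.≤-Reasoning
  open ℚ-Solver.+-*-Solver
  ρ = ½ ℚ.* (1ℚ ℚ.+ r)
  0≤ρ : 0ℚ ℚ.≤ ρ
  0≤ρ = *-nonNeg (ℚₚ.nonNegative⁻¹ ½) (ℚₚ.+-mono-≤ (ℚₚ.nonNegative⁻¹ 1ℚ) 0≤r)
  ρ<1 : ρ ℚ.< 1ℚ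
  ρ<1 = ℚₚ.*-monoʳ-<-pos ½ (ℚₚ.+-monoʳ-< 1ℚ r<1)
  small = C*r^n≤ε 0≤ρ ρ<1 (C ℚ.* recip (1ℚ ℚ.- ρ)) ε
    (*-nonNeg 0≤C (ℚₚ.<⇒≤ (recip-pos (p<r⇒0<r-p ρ<1)))) 0<ε
  e = ½ ℚ.* (1ℚ ℚ.- r)
  r≤ρρ : r ℚ.≤ ρ ℚ.* ρ
  r≤ρρ = ℚₚ.≤-trans (p+r≤p′ ℚₚ.≤-refl (0≤p*p e)) (ℚₚ.≤-reflexive
    (solve 1 (λ r → r :+ (con ½ :* (con 1ℚ :- r)) :* (con ½ :* (con 1ℚ :- r)) :=
                    (con ½ :* (con 1ℚ :+ r)) :* (con ½ :* (con 1ℚ :+ r))) refl r))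

p≤1+p : ∀ p → p ℚ.≤ 1ℚ ℚ.+ p
p≤1+p p = ℚₚ.≤-trans (p+r≤p′ ℚₚ.≤-refl (ℚₚ.nonNegative⁻¹ 1ℚ)) (ℚₚ.≤-reflexive (ℚₚ.+-comm p 1ℚ))

-- Here 1 + p² - p = (p - 1/2)² + 3/4. It serves to replace a bound C by the positive bound 1 + C².
p≤1+pp : ∀ p → p ℚ.≤ 1ℚ ℚ.+ p ℚ.* p
p≤1+pp p = ℚₚ.≤-trans
  (p+r≤p′ ℚₚ.≤-refl (ℚₚ.+-mono-≤ (0≤p*p (p ℚ.- ½)) (ℚₚ.nonNegative⁻¹ (½ ℚ.+ ½ ℚ.* ½))))
  (ℚₚ.≤-reflexive (solve 1
    (λ c → c :+ ((c :- con ½) :* (c :- con ½) :+ (con ½ :+ con ½ :* con ½)) := con 1ℚ :+ c :* c) refl p))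
  where open ℚ-Solver.+-*-Solver

-- Finite sums and Cauchy products

∑ᴳ ∏ᴳ : ℕ → (ℕ → ℚ[i]) → ℚ[i]
∑ᴳ zero    f = 𝟘
∑ᴳ (suc n) f = ∑ᴳ n f ⊕ f n
∏ᴳ zero    f = 𝟙
∏ᴳ (suc n) f = ∏ᴳ n f ⊗ f n

∑-cong : ∀ {f g} n → (∀ k → k ℕ.< n → f k ≡ g k) → ∑ᴳ n f ≡ ∑ᴳ n g
∑-cong zero    f≗g = refl
∑-cong (suc n) f≗g = cong₂ _⊕_ (∑-cong n λ k k<n → f≗g k (ℕₚ.m≤n⇒m≤1+n k<n)) (f≗g n ℕₚ.≤-refl)

∏-cong : ∀ {f g} n → (∀ k → f k ≡ g k) → ∏ᴳ n f ≡ ∏ᴳ n g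
∏-cong zero    f≗g = refl
∏-cong (suc n) f≗g = cong₂ _⊗_ (∏-cong n f≗g) (f≗g n)

∑-⊕ : ∀ n f g → ∑ᴳ n (λ k → f k ⊕ g k) ≡ ∑ᴳ n f ⊕ ∑ᴳ n g
∑-⊕ zero    f g = refl
∑-⊕ (suc n) f g = trans (cong (_⊕ (f n ⊕ g n)) (∑-⊕ n f g))
  (solve 4 (λ a b c d → (a :+ b) :+ (c :+ d) := (a :+ c) :+ (b :+ d)) refl (∑ᴳ n f) (∑ᴳ n g) (f n) (g n))
  where open ℚ[i]-Solver

∑-⊗ˡ : ∀ n c f → ∑ᴳ n (λ k → c ⊗ f k) ≡ c ⊗ ∑ᴳ n f
∑-⊗ˡ zero    c f = solve 1 (λ c → con 𝟘 := c :* con 𝟘) refl c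
  where open ℚ[i]-Solver
∑-⊗ˡ (suc n) c f = trans (cong (_⊕ c ⊗ f n) (∑-⊗ˡ n c f)) (sym (⊗-distribˡ-⊕ c (∑ᴳ n f) (f n)))

∑-first : ∀ n f → ∑ᴳ (suc n) f ≡ f 0 ⊕ ∑ᴳ n (λ k → f (suc k))
∑-first zero    f = solve 1 (λ a → con 𝟘 :+ a := a :+ con 𝟘) refl (f 0)
  where open ℚ[i]-Solver
∑-first (suc n) f = trans (cong (_⊕ f (suc n)) (∑-first n f))
  (solve 3 (λ a b c → (a :+ b) :+ c := a :+ (b :+ c)) refl (f 0) (∑ᴳ n (λ k → f (suc k))) (f (suc n)))
  where open ℚ[i]-Solver

∑-swap : ∀ m n (f : ℕ → ℕ → ℚ[i]) → ∑ᴳ m (λ j → ∑ᴳ n (f j)) ≡ ∑ᴳ n (λ k → ∑ᴳ m (λ j → f j k))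
∑-swap zero    n f = sym (∑-zero n)
  where
  ∑-zero : ∀ n → ∑ᴳ n (λ _ → 𝟘) ≡ 𝟘
  ∑-zero zero    = refl
  ∑-zero (suc n) = cong (_⊕ 𝟘) (∑-zero n)
∑-swap (suc m) n f = trans (cong (_⊕ ∑ᴳ n (f m)) (∑-swap m n f))
  (sym (∑-⊕ n (λ k → ∑ᴳ m (λ j → f j k)) (f m)))

∑-⊑ : ∀ {c} n f → (∀ k → k ℕ.< n → f k ⊑ c) → ∑ᴳ n f ⊑ ι n ℚ.* c
∑-⊑ {c} zero    f f⊑c = subst (𝟘 ⊑_) (sym (ℚₚ.*-zeroˡ c)) 𝟘⊑0
∑-⊑ {c} (suc n) f f⊑c = subst (∑ᴳ (suc n) f ⊑_)
  (solve 2 (λ m c → m :* c :+ c := (con 1ℚ :+ m) :* c) refl (ι n) c)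
  (⊑-⊕ (∑-⊑ n f λ k k<n → f⊑c k (ℕₚ.m≤n⇒m≤1+n k<n)) (f⊑c n ℕₚ.≤-refl))
  where open ℚ-Solver.+-*-Solver

conv : (u v : ℕ → ℚ[i]) → ℕ → ℚ[i]
conv u v n = ∑ᴳ (suc n) λ k → u k ⊗ v (n ∸ k)

-- Both sides sum `u k ⊗ v l` over the triangle k + l < N, by antidiagonals on the left and by rows
-- on the right.
∑-conv : ∀ u v N → ∑ᴳ N (conv u v) ≡ ∑ᴳ N (λ k → u k ⊗ ∑ᴳ (N ∸ k) v)
∑-conv u v zero    = refl
∑-conv u v (suc N) = begin
  ∑ᴳ N (conv u v) ⊕ conv u v N
    ≡⟨ cong (_⊕ conv u v N) (trans (∑-conv u v N) (sym extra)) ⟩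
  ∑ᴳ (suc N) (λ k → u k ⊗ ∑ᴳ (N ∸ k) v) ⊕ conv u v N
    ≡⟨ ∑-⊕ (suc N) (λ k → u k ⊗ ∑ᴳ (N ∸ k) v) (λ k → u k ⊗ v (N ∸ k)) ⟨
  ∑ᴳ (suc N) (λ k → u k ⊗ ∑ᴳ (N ∸ k) v ⊕ u k ⊗ v (N ∸ k))
    ≡⟨ ∑-cong (suc N) (λ { k (ℕ.s≤s k≤N) → trans
         (sym (⊗-distribˡ-⊕ (u k) (∑ᴳ (N ∸ k) v) (v (N ∸ k))))
         (cong (λ m → u k ⊗ ∑ᴳ m v) (sym (ℕₚ.+-∸-assoc 1 k≤N))) }) ⟩
  ∑ᴳ (suc N) (λ k → u k ⊗ ∑ᴳ (suc N ∸ k) v) ∎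
  where
  open ≡-Reasoning
  open ℚ[i]-Solver
  f = λ k → u k ⊗ ∑ᴳ (N ∸ k) v
  -- The row k = N of the smaller triangle is empty, so both triangles can be summed over the same
  -- range of k.
  extra : ∑ᴳ (suc N) f ≡ ∑ᴳ N f
  extra = trans (cong (λ m → ∑ᴳ N f ⊕ u N ⊗ ∑ᴳ m v) (ℕₚ.n∸n≡0 N))
    (solve 2 (λ s a → s :+ a :* con 𝟘 := s) refl (∑ᴳ N f) (u N))

-- Uniform estimates

-- Leaving `size` free lets one notion cover three kinds of limit: null families (size n), Cauchy
-- families (size m ⊓ n), and convergence in which truncation and representation index grow together
-- (size n ⊓ k).
Vanishing : {A : Set} (size : A → ℕ) (w : A → ℚ[i]) → Set
Vanishing size w = ∀ ε → 0ℚ ℚ.< ε → ∃[ N ] ∀ a → N ℕ.≤ size a → w a ⊑ ε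

Bounded : {A : Set} (w : A → ℚ[i]) → Set
Bounded w = ∃[ C ] ∀ a → w a ⊑ C

module _ {A : Set} where

  bounded-const : ∀ c → Bounded {A} (λ _ → c)
  bounded-const c = ρ , λ _ → mk⊑ 0≤ρ (begin
    ∥ c ∥²                 ≡⟨ ℚₚ.*-identityˡ ∥ c ∥² ⟨
    1ℚ ℚ.* ∥ c ∥²          ≤⟨ *-mono-≤ {1ℚ} {ρ} {∥ c ∥²} (ℚₚ.nonNegative⁻¹ 1ℚ) 0≤ρ
                               (p+r≤p′ ℚₚ.≤-refl (0≤∥∥² c)) (p≤1+p ∥ c ∥²) ⟩
    ρ ℚ.* ρ                ∎)
    where
    open ℚₚ.≤-Reasoning
    ρ = 1ℚ ℚ.+ ∥ c ∥²
    0≤ρ : 0ℚ ℚ.≤ ρ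
    0≤ρ = ℚₚ.+-mono-≤ (ℚₚ.nonNegative⁻¹ 1ℚ) (0≤∥∥² c)

  positive-bound : {u : A → ℚ[i]} → Bounded u → ∃[ C ] 0ℚ ℚ.< C × ∀ a → u a ⊑ C
  positive-bound (C , u⊑C) = 1ℚ ℚ.+ C ℚ.* C , ℚₚ.+-mono-<-≤ (ℚₚ.positive⁻¹ 1ℚ) (0≤p*p C) ,
    λ a → ⊑-mono (p≤1+pp C) (u⊑C a)

  bounded-cong : {u v : A → ℚ[i]} → (∀ a → v a ≡ u a) → Bounded u → Bounded v
  bounded-cong v≗u (C , u⊑C) = C , λ a → ⊑-cong (v≗u a) (u⊑C a)

  bounded-⊕ : {u v : A → ℚ[i]} → Bounded u → Bounded v → Bounded (λ a → u a ⊕ v a)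
  bounded-⊕ (C , u⊑C) (D , v⊑D) = C ℚ.+ D , λ a → ⊑-⊕ (u⊑C a) (v⊑D a)

  bounded-⊗ : {u v : A → ℚ[i]} → Bounded u → Bounded v → Bounded (λ a → u a ⊗ v a)
  bounded-⊗ (C , u⊑C) (D , v⊑D) = C ℚ.* D , λ a → ⊑-⊗ (u⊑C a) (v⊑D a)

  bounded-∑ : ∀ n {u : ℕ → A → ℚ[i]} → (∀ k → Bounded (u k)) → Bounded (λ a → ∑ᴳ n (λ k → u k a))
  bounded-∑ zero    bu = bounded-const 𝟘
  bounded-∑ (suc n) bu = bounded-⊕ (bounded-∑ n bu) (bu n)

  module _ {size : A → ℕ} where

    vanishing-cong : {u v : A → ℚ[i]} → (∀ a → v a ≡ u a) → Vanishing size u → Vanishing size v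
    vanishing-cong v≗u vu ε 0<ε = let N , u⊑ε = vu ε 0<ε in N , λ a N≤a → ⊑-cong (v≗u a) (u⊑ε a N≤a)

    vanishing-⊕ : {u v : A → ℚ[i]} → Vanishing size u → Vanishing size v → Vanishing size (λ a → u a ⊕ v a)
    vanishing-⊕ {u} {v} vu vv ε 0<ε =
      let M , f = vu (½ ℚ.* ε) (half-pos 0<ε)
          N , g = vv (½ ℚ.* ε) (half-pos 0<ε)
      in M ⊔ N , λ a le → subst (u a ⊕ v a ⊑_) (half+half ε) (⊑-⊕ (f a (⊔-left le)) (g a (⊔-right {M} le)))

    vanishing-⊝ : {u : A → ℚ[i]} → Vanishing size u → Vanishing size (λ a → ⊝ u a)
    vanishing-⊝ vu ε 0<ε = let N , f = vu ε 0<ε in N , λ a le → ⊑-⊝ (f a le)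

    vanishing-⊗ : {b u : A → ℚ[i]} → Bounded b → Vanishing size u → Vanishing size (λ a → b a ⊗ u a)
    vanishing-⊗ {b} {u} bb vu ε 0<ε =
      let D , 0<D , b⊑D = positive-bound bb
          N , small = vu (recip D ℚ.* ε) (*-pos (recip-pos 0<D) 0<ε)
      in N , λ a le → subst (b a ⊗ u a ⊑_)
          (trans (sym (ℚₚ.*-assoc D (recip D) ε)) (trans
            (cong (ℚ._* ε) (trans (ℚₚ.*-comm D (recip D)) (recip-inverse 0<D))) (ℚₚ.*-identityˡ ε)))
          (⊑-⊗ (b⊑D a) (small a le))

    vanishing-∑ : ∀ n {u : ℕ → A → ℚ[i]} → (∀ k → Vanishing size (u k)) → Vanishing size (λ a → ∑ᴳ n (λ k → u k a))
    vanishing-∑ zero    vu ε 0<ε = 0 , λ _ _ → ⊑-mono (ℚₚ.<⇒≤ 0<ε) 𝟘⊑0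
    vanishing-∑ (suc n) vu = vanishing-⊕ (vanishing-∑ n vu) (vu n)

vanishing-∘ : {A B : Set} {size : A → ℕ} {size′ : B → ℕ} {w : A → ℚ[i]} (f : B → A) →
              (∀ b → size′ b ℕ.≤ size (f b)) → Vanishing size w → Vanishing size′ (λ b → w (f b))
vanishing-∘ f le vw ε 0<ε = let N , small = vw ε 0<ε in N , λ b N≤b → small (f b) (ℕₚ.≤-trans N≤b (le b))

module Geometric {I : Set} {r : ℚ} (0≤r : 0ℚ ℚ.≤ r) (r<1 : r ℚ.< 1ℚ) where

  Family : Set
  Family = ℕ → I → ℚ[i]

  -- All constants and thresholds are uniform in `i`. `LinGeo` is the rate n rⁿ of the truncation
  -- errors in Cauchy products and in the iterated functional equation.
  Bdd Geo LinGeo Null Cauchy : Family → Set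
  Bdd u    = Bounded {ℕ × I} λ (n , i) → u n i
  Geo u    = ∃[ C ] 0ℚ ℚ.≤ C × ∀ n i → u n i ⊑ C ℚ.* r ^ℚ n
  LinGeo u = ∃[ C ] 0ℚ ℚ.≤ C × ∀ n i → u n i ⊑ C ℚ.* (ι n ℚ.* r ^ℚ n)
  Null u   = Vanishing {ℕ × I} proj₁ λ (n , i) → u n i
  Cauchy u = Vanishing {ℕ × ℕ × I} (λ (m , n , i) → m ⊓ n) λ (m , n , i) → u m i ⊖ u n i

  private
    r≤1 = ℚₚ.<⇒≤ r<1
    d   = 1ℚ ℚ.- r
    0<d = p<r⇒0<r-p r<1
    0≤r^ = ^ℚ-nonNeg 0≤r

  geo⇒bdd : ∀ {u} → Geo u → Bdd u
  geo⇒bdd (C , 0≤C , u⊑) = C , λ (n , i) → ⊑-mono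
    (ℚₚ.≤-trans (ℚₚ.*-monoˡ-≤-nonNeg C {{nonNeg 0≤C}} (^ℚ-≤1 0≤r r≤1 n)) (ℚₚ.≤-reflexive (ℚₚ.*-identityʳ C))) (u⊑ n i)

  linGeo⇒null : ∀ {u} → LinGeo u → Null u
  linGeo⇒null (C , 0≤C , u⊑) ε 0<ε = let N , small = C*n*r^n≤ε 0≤r r<1 C ε 0≤C 0<ε in
    N , λ (n , i) N≤n → ⊑-mono (small n N≤n) (u⊑ n i)

  bdd-⊗-geo : ∀ {u v} → Bdd u → Geo v → Geo (λ n i → u n i ⊗ v n i)
  bdd-⊗-geo {u} {v} bu (C , 0≤C , v⊑) = let D , 0<D , u⊑D = positive-bound bu in
    D ℚ.* C , *-nonNeg (ℚₚ.<⇒≤ 0<D) 0≤C , λ n i →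
      subst (u n i ⊗ v n i ⊑_) (sym (ℚₚ.*-assoc D C (r ^ℚ n))) (⊑-⊗ (u⊑D (n , i)) (v⊑ n i))

  geo-⊝ : ∀ {u} → Geo u → Geo (λ n i → ⊝ u n i)
  geo-⊝ (C , 0≤C , u⊑) = C , 0≤C , λ n i → ⊑-⊝ (u⊑ n i)

  cauchy-cong : ∀ {u v} → (∀ n i → v n i ≡ u n i) → Cauchy u → Cauchy v
  cauchy-cong {u} {v} v≗u = vanishing-cong
    {u = λ (m , n , i) → u m i ⊖ u n i} {v = λ (m , n , i) → v m i ⊖ v n i} λ (m , n , i) → cong₂ _⊖_ (v≗u m i) (v≗u n i)

  cauchy-const : ∀ (c : I → ℚ[i]) → Cauchy (λ _ → c)
  cauchy-const c ε 0<ε = 0 , λ (m , n , i) _ → ⊑-cong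
    (solve 1 (λ z → z :- z := con 𝟘) refl (c i)) (⊑-mono (ℚₚ.<⇒≤ 0<ε) 𝟘⊑0)
    where open ℚ[i]-Solver

  cauchy-⊗ : ∀ {u v} → Bdd u → Bdd v → Cauchy u → Cauchy v → Cauchy (λ n i → u n i ⊗ v n i)
  cauchy-⊗ {u} {v} (C , u⊑) (D , v⊑) cu cv = vanishing-cong
    {u = λ (m , n , i) → u m i ⊗ (v m i ⊖ v n i) ⊕ v n i ⊗ (u m i ⊖ u n i)}
    {v = λ (m , n , i) → u m i ⊗ v m i ⊖ u n i ⊗ v n i}
    (λ (m , n , i) → solve 4 (λ a b c d → a :* b :- c :* d := a :* (b :- d) :+ d :* (a :- c)) refl
      (u m i) (v m i) (u n i) (v n i))
    (vanishing-⊕ {u = λ (m , n , i) → u m i ⊗ (v m i ⊖ v n i)} {v = λ (m , n , i) → v n i ⊗ (u m i ⊖ u n i)}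
      (vanishing-⊗ {b = λ (m , n , i) → u m i} {u = λ (m , n , i) → v m i ⊖ v n i} (C , λ (m , n , i) → u⊑ (m , i)) cv)
      (vanishing-⊗ {b = λ (m , n , i) → v n i} {u = λ (m , n , i) → u m i ⊖ u n i} (D , λ (m , n , i) → v⊑ (n , i)) cu))
    where open ℚ[i]-Solver

  -- The bound keeps the term r^(e+m) so that it telescopes: with K = C/(1 - r) one has C rⁿ = K (rⁿ
  -- - rⁿ⁺¹).
  geometric-tail : ∀ {u : Family} {C} → (∀ n i → u (suc n) i ⊖ u n i ⊑ C ℚ.* r ^ℚ n) →
                   ∀ m e i → u (e ℕ.+ m) i ⊖ u m i ⊑ C ℚ.* recip d ℚ.* (r ^ℚ m ℚ.- r ^ℚ (e ℕ.+ m))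
  geometric-tail {u} {C} step m zero i = subst₂ _⊑_
    (solve 1 (λ z → con 𝟘 := z :- z) refl (u m i))
    (S.solve 2 (λ K R → S.con 0ℚ S.:= K S.:* (R S.:- R)) refl (C ℚ.* recip d) (r ^ℚ m)) 𝟘⊑0
    where
    open ℚ[i]-Solver
    module S = ℚ-Solver.+-*-Solver
  geometric-tail {u} {C} step m (suc e) i = subst₂ _⊑_
    (solve 3 (λ a b c → (b :- c) :+ (a :- b) := a :- c) refl (u (suc e ℕ.+ m) i) (u (e ℕ.+ m) i) (u m i))
    (begin
      K ℚ.* (r ^ℚ m ℚ.- R) ℚ.+ C ℚ.* R
        ≡⟨ cong (λ c → K ℚ.* (r ^ℚ m ℚ.- R) ℚ.+ c ℚ.* R) (trans (sym (ℚₚ.*-identityʳ C)) (trans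
             (cong (C ℚ.*_) (sym (recip-inverse 0<d))) (sym (ℚₚ.*-assoc C (recip d) d)))) ⟩
      K ℚ.* (r ^ℚ m ℚ.- R) ℚ.+ K ℚ.* d ℚ.* R
        ≡⟨ S.solve 4 (λ K M R r → K S.:* (M S.:- R) S.:+ K S.:* (S.con 1ℚ S.:- r) S.:* R S.:=
             K S.:* (M S.:- r S.:* R)) refl K (r ^ℚ m) R r ⟩
      K ℚ.* (r ^ℚ m ℚ.- r ℚ.* R) ∎)
    (⊑-⊕ (geometric-tail {u} {C} step m e i) (step (e ℕ.+ m) i))
    where
    open ≡-Reasoning
    open ℚ[i]-Solver
    module S = ℚ-Solver.+-*-Solver
    K = C ℚ.* recip d
    R = r ^ℚ (e ℕ.+ m)

  module _ {u : Family} (step : Geo (λ n i → u (suc n) i ⊖ u n i)) where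

    tail-bound : ∃[ K ] 0ℚ ℚ.≤ K × ∀ m n i → m ℕ.≤ n → u n i ⊖ u m i ⊑ K ℚ.* r ^ℚ m
    tail-bound = K , 0≤K , λ m n i m≤n → subst (λ k → u k i ⊖ u m i ⊑ K ℚ.* r ^ℚ m) (ℕₚ.m∸n+n≡m m≤n)
      (⊑-mono (ℚₚ.*-monoˡ-≤-nonNeg K {{nonNeg 0≤K}} (ℚₚ.≤-trans
          (ℚₚ.+-monoʳ-≤ (r ^ℚ m) (ℚₚ.neg-antimono-≤ (0≤r^ ((n ∸ m) ℕ.+ m))))
          (ℚₚ.≤-reflexive (ℚₚ.+-identityʳ (r ^ℚ m)))))
        (geometric-tail {u} {proj₁ step} (proj₂ (proj₂ step)) m (n ∸ m) i))
      where
      K = proj₁ step ℚ.* recip d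
      0≤K = *-nonNeg (proj₁ (proj₂ step)) (ℚₚ.<⇒≤ (recip-pos 0<d))

    geo-step⇒cauchy : Cauchy u
    geo-step⇒cauchy ε 0<ε =
      let K , 0≤K , tail = tail-bound
          N , small = C*r^n≤ε 0≤r r<1 K (½ ℚ.* ε) 0≤K (half-pos 0<ε)
      in N , λ (m , n , i) N≤ → subst₂ _⊑_
        (solve 3 (λ a b c → (a :- c) :- (b :- c) := a :- b) refl (u m i) (u n i) (u N i)) (half+half ε)
        (⊑-⊖ (⊑-mono (small N ℕₚ.≤-refl) (tail N m i (ℕₚ.≤-trans N≤ (ℕₚ.m⊓n≤m m n))))
             (⊑-mono (small N ℕₚ.≤-refl) (tail N n i (ℕₚ.≤-trans N≤ (ℕₚ.m⊓n≤n m n)))))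
      where open ℚ[i]-Solver

    geo-step⇒bdd : Bounded (u 0) → Bdd u
    geo-step⇒bdd (C , u₀⊑) = let K , 0≤K , tail = tail-bound in
      C ℚ.+ K ℚ.* 1ℚ , λ (n , i) → ⊑-cong
          (solve 2 (λ a b → a := b :+ (a :- b)) refl (u n i) (u 0 i)) (⊑-⊕ (u₀⊑ i) (tail 0 n i ℕ.z≤n))
      where open ℚ[i]-Solver

  partialSum : Family → Family
  partialSum f n i = ∑ᴳ n λ k → f k i

  partialSum-step : ∀ {f} → Geo f → Geo (λ n i → partialSum f (suc n) i ⊖ partialSum f n i)
  partialSum-step {f} (C , 0≤C , f⊑) = C , 0≤C , λ n i → ⊑-cong
    (solve 2 (λ s a → (s :+ a) :- s := a) refl (partialSum f n i) (f n i)) (f⊑ n i)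
    where open ℚ[i]-Solver

  partialSum-cauchy : ∀ {f} → Geo f → Cauchy (partialSum f)
  partialSum-cauchy {f} gf = geo-step⇒cauchy {partialSum f} (partialSum-step {f} gf)

  partialSum-bdd : ∀ {f} → Geo f → Bdd (partialSum f)
  partialSum-bdd {f} gf = geo-step⇒bdd {partialSum f} (partialSum-step {f} gf) (bounded-const 𝟘)

  -- By `∑-conv` the difference is the sum over k < n of f k (G n - G (n - k)), where G denotes the
  -- partial sums of g. Each summand is at most C rᵏ times K rⁿ⁻ᵏ, and there are n of them.
  cauchy-product : ∀ {f g} → Geo f → Geo g →
    Null (λ n i → partialSum f n i ⊗ partialSum g n i ⊖ ∑ᴳ n (conv (λ k → f k i) (λ k → g k i)))
  cauchy-product {f} {g} (C , 0≤C , f⊑) gg = let K , 0≤K , tail = tail-bound {partialSum g} (partialSum-step {g} gg) in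
    linGeo⇒null (C ℚ.* K , *-nonNeg 0≤C 0≤K , λ n i →
      let F = λ k → f k i ; G = λ m → partialSum g m i in subst₂ _⊑_
        (begin
          ∑ᴳ n (λ k → F k ⊗ (G n ⊖ G (n ∸ k)))
            ≡⟨ ∑-cong n (λ k _ → solve 3 (λ a b c → a :* (b :- c) := b :* a :+ con (⊝ 𝟙) :* (a :* c)) refl
                 (F k) (G n) (G (n ∸ k))) ⟩
          ∑ᴳ n (λ k → G n ⊗ F k ⊕ (⊝ 𝟙) ⊗ (F k ⊗ G (n ∸ k)))
            ≡⟨ trans (∑-⊕ n (λ k → G n ⊗ F k) (λ k → (⊝ 𝟙) ⊗ (F k ⊗ G (n ∸ k))))
                 (cong₂ _⊕_ (∑-⊗ˡ n (G n) F) (∑-⊗ˡ n (⊝ 𝟙) (λ k → F k ⊗ G (n ∸ k)))) ⟩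
          G n ⊗ ∑ᴳ n F ⊕ (⊝ 𝟙) ⊗ ∑ᴳ n (λ k → F k ⊗ G (n ∸ k))
            ≡⟨ cong (λ z → G n ⊗ ∑ᴳ n F ⊕ (⊝ 𝟙) ⊗ z) (∑-conv F (λ k → g k i) n) ⟨
          G n ⊗ ∑ᴳ n F ⊕ (⊝ 𝟙) ⊗ ∑ᴳ n (conv F (λ k → g k i))
            ≡⟨ solve 3 (λ a b c → b :* a :+ con (⊝ 𝟙) :* c := a :* b :- c) refl (∑ᴳ n F) (G n)
                (∑ᴳ n (conv F (λ k → g k i))) ⟩
          ∑ᴳ n F ⊗ G n ⊖ ∑ᴳ n (conv F (λ k → g k i)) ∎)
        (S.solve 4 (λ m c k R → m S.:* (c S.:* k S.:* R) S.:= c S.:* k S.:* (m S.:* R)) refl (ι n) C K (r ^ℚ n))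
        (∑-⊑ n (λ k → F k ⊗ (G n ⊖ G (n ∸ k))) λ k k<n → subst (F k ⊗ (G n ⊖ G (n ∸ k)) ⊑_)
          (trans (S.solve 4 (λ c k u v → c S.:* u S.:* (k S.:* v) S.:= c S.:* k S.:* (u S.:* v)) refl
              C K (r ^ℚ k) (r ^ℚ (n ∸ k)))
            (cong (C ℚ.* K ℚ.*_) (trans (sym (^ℚ-+ r k (n ∸ k))) (cong (r ^ℚ_) (ℕₚ.m+[n∸m]≡n (ℕₚ.<⇒≤ k<n))))))
          (⊑-⊗ (f⊑ k i) (tail (n ∸ k) n i (ℕₚ.m∸n≤m n k)))))
    where
    open ≡-Reasoning
    open ℚ[i]-Solver
    module S = ℚ-Solver.+-*-Solver

-- Infinite products

2ℚ : ℚ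
2ℚ = 1ℚ ℚ.+ 1ℚ

1^ℚ : ∀ n → 1ℚ ^ℚ n ≡ 1ℚ
1^ℚ zero    = refl
1^ℚ (suc n) = trans (ℚₚ.*-identityˡ (1ℚ ^ℚ n)) (1^ℚ n)

module GeometricProduct {I : Set} {r : ℚ} (0<r : 0ℚ ℚ.< r) (r<1 : r ℚ.< 1ℚ) where

  0≤r = ℚₚ.<⇒≤ 0<r
  open Geometric {I} {r} 0≤r r<1 public

  private
    c₀   = ½ ℚ.* (1ℚ ℚ.- r)
    0<c₀ = half-pos (p<r⇒0<r-p r<1)
    r≤1  = ℚₚ.<⇒≤ r<1
    0≤1  = ℚₚ.nonNegative⁻¹ 1ℚ

    0≤2-u : ∀ {u} → u ℚ.≤ 1ℚ → 0ℚ ℚ.≤ 2ℚ ℚ.- u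
    0≤2-u u≤1 = ℚₚ.≤-trans 0≤1 (ℚₚ.+-monoʳ-≤ 2ℚ (ℚₚ.neg-antimono-≤ u≤1))

  -- The telescoping majorant: with u = rⁿ, the ratio of consecutive values of (2 - rⁿ)ᵖ
  -- dominates 1 + p c₀ rⁿ, so (2 - rⁿ)ᵖ ≤ 2ᵖ bounds every product ∏ (1 + C rᵏ) with C ≤ p c₀.
  majorant-step : ∀ p u → 0ℚ ℚ.≤ u → u ℚ.≤ 1ℚ →
                  (2ℚ ℚ.- u) ^ℚ p ℚ.* (1ℚ ℚ.+ ι p ℚ.* c₀ ℚ.* u) ℚ.≤ (2ℚ ℚ.- r ℚ.* u) ^ℚ p
  majorant-step zero u _ _ = ℚₚ.≤-reflexive
    (solve 2 (λ c u → con 1ℚ :* (con 1ℚ :+ con 0ℚ :* c :* u) := con 1ℚ) refl c₀ u)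
    where open ℚ-Solver.+-*-Solver
  majorant-step (suc p) u 0≤u u≤1 = begin
    v ℚ.* V ℚ.* (1ℚ ℚ.+ (1ℚ ℚ.+ m) ℚ.* c₀ ℚ.* u)
      ≤⟨ p+r≤p′ ℚₚ.≤-refl (*-nonNeg (*-nonNeg 0≤v 0≤V) (*-nonNeg (0≤ι p) (0≤p*p (c₀ ℚ.* u)))) ⟩
    v ℚ.* V ℚ.* (1ℚ ℚ.+ (1ℚ ℚ.+ m) ℚ.* c₀ ℚ.* u) ℚ.+ v ℚ.* V ℚ.* (m ℚ.* (c₀ ℚ.* u ℚ.* (c₀ ℚ.* u)))
      ≡⟨ solve 5 (λ v V m c u →
           v :* V :* (con 1ℚ :+ (con 1ℚ :+ m) :* c :* u) :+ v :* V :* (m :* (c :* u :* (c :* u))) :=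
           (v :* (con 1ℚ :+ c :* u)) :* (V :* (con 1ℚ :+ m :* c :* u))) refl v V m c₀ u ⟩
    (v ℚ.* (1ℚ ℚ.+ c₀ ℚ.* u)) ℚ.* (V ℚ.* (1ℚ ℚ.+ m ℚ.* c₀ ℚ.* u))
      ≤⟨ *-mono-≤ (*-nonNeg 0≤v (ℚₚ.+-mono-≤ 0≤1 (*-nonNeg 0≤c₀ 0≤u)))
           (^ℚ-nonNeg (0≤2-u ru≤1) p) factor (majorant-step p u 0≤u u≤1) ⟩
    (2ℚ ℚ.- r ℚ.* u) ℚ.* (2ℚ ℚ.- r ℚ.* u) ^ℚ p ∎
    where
    open ℚₚ.≤-Reasoning
    open ℚ-Solver.+-*-Solver
    m = ι p
    v = 2ℚ ℚ.- u
    V = v ^ℚ p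
    0≤c₀ = ℚₚ.<⇒≤ 0<c₀
    0≤v  = 0≤2-u u≤1
    0≤V  = ^ℚ-nonNeg 0≤v p
    ru≤1 : r ℚ.* u ℚ.≤ 1ℚ
    ru≤1 = *-mono-≤ 0≤r 0≤1 r≤1 u≤1
    factor : v ℚ.* (1ℚ ℚ.+ c₀ ℚ.* u) ℚ.≤ 2ℚ ℚ.- r ℚ.* u
    factor = ℚₚ.≤-trans (p+r≤p′ ℚₚ.≤-refl (*-nonNeg 0≤c₀ (0≤p*p u))) (ℚₚ.≤-reflexive
      (solve 2 (λ r u → let c = con ½ :* (con 1ℚ :- r) in
        (con 2ℚ :- u) :* (con 1ℚ :+ c :* u) :+ c :* (u :* u) := con 2ℚ :- r :* u) refl r u))

  -- The exponent `p` satisfies C ≤ p c₀, and the majorant (2 - rⁿ)ᵖ starts at 1 when n = 0. The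
  -- factor `ρ` is split off so that one statement gives boundedness of products (ρ = 1) and
  -- geometric decay of the q-binomial coefficients (ρ = r).
  product-bound : ∀ {f : Family} {ρ C} → 0ℚ ℚ.≤ ρ → (∀ k i → f k i ⊑ ρ ℚ.* (1ℚ ℚ.+ C ℚ.* r ^ℚ k)) →
                  ∃[ E ] 0ℚ ℚ.≤ E × ∀ n i → ∏ᴳ n (λ k → f k i) ⊑ E ℚ.* ρ ^ℚ n
  product-bound {f} {ρ} {C} 0≤ρ f⊑ = 2ℚ ^ℚ p , 0≤2^p , λ n i → ⊑-mono
    (ℚₚ.*-monoʳ-≤-nonNeg (ρ ^ℚ n) {{nonNeg (^ℚ-nonNeg 0≤ρ n)}} (^ℚ-mono (0≤2-u (r^≤1 n)) (2-r^≤2 n) p))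
    (go n i)
    where
    open ℚ-Solver.+-*-Solver
    p = proj₁ (archimedean (C ℚ.* recip c₀))
    0≤r^ = ^ℚ-nonNeg 0≤r
    r^≤1 = ^ℚ-≤1 0≤r r≤1
    0≤2^p : 0ℚ ℚ.≤ 2ℚ ^ℚ p
    0≤2^p = ^ℚ-nonNeg (ℚₚ.nonNegative⁻¹ 2ℚ) p
    2-r^≤2 : ∀ n → 2ℚ ℚ.- r ^ℚ n ℚ.≤ 2ℚ
    2-r^≤2 n = ℚₚ.≤-trans (ℚₚ.+-monoʳ-≤ 2ℚ (ℚₚ.neg-antimono-≤ (0≤r^ n))) (ℚₚ.≤-reflexive (ℚₚ.+-identityʳ 2ℚ))
    C≤ : C ℚ.≤ ι p ℚ.* c₀
    C≤ = ℚₚ.≤-trans (ℚₚ.≤-reflexive (trans (sym (ℚₚ.*-identityʳ C))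
           (trans (cong (C ℚ.*_) (sym (recip-inverse 0<c₀))) (sym (ℚₚ.*-assoc C (recip c₀) c₀)))))
         (ℚₚ.*-monoʳ-≤-nonNeg c₀ {{nonNeg (ℚₚ.<⇒≤ 0<c₀)}} (proj₂ (archimedean (C ℚ.* recip c₀))))
    go : ∀ n i → ∏ᴳ n (λ k → f k i) ⊑ (2ℚ ℚ.- r ^ℚ n) ^ℚ p ℚ.* ρ ^ℚ n
    go zero    i = ⊑-mono (ℚₚ.≤-reflexive (sym (trans (ℚₚ.*-identityʳ _) (1^ℚ p)))) 𝟙⊑1
    go (suc n) i = ⊑-mono
      (ℚₚ.≤-trans (ℚₚ.≤-reflexive (solve 4 (λ V R ρ e → V :* R :* (ρ :* e) := (V :* e) :* (ρ :* R)) refl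
          V (ρ ^ℚ n) ρ (1ℚ ℚ.+ C ℚ.* u)))
        (ℚₚ.*-monoʳ-≤-nonNeg (ρ ^ℚ suc n) {{nonNeg (^ℚ-nonNeg 0≤ρ (suc n))}}
          (ℚₚ.≤-trans
            (ℚₚ.*-monoˡ-≤-nonNeg V {{nonNeg (^ℚ-nonNeg (0≤2-u (r^≤1 n)) p)}}
              (ℚₚ.+-monoʳ-≤ 1ℚ (ℚₚ.*-monoʳ-≤-nonNeg u {{nonNeg (0≤r^ n)}} C≤)))
            (majorant-step p u (0≤r^ n) (r^≤1 n)))))
      (⊑-⊗ (go n i) (f⊑ n i))
      where
      u = r ^ℚ n
      V = (2ℚ ℚ.- u) ^ℚ p

  module _ {w : Family} (gw : Geo w) where

    private
      prod : Family
      prod n i = ∏ᴳ n λ k → 𝟙 ⊕ w k i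

    geo⇒product-bdd : Bdd prod
    geo⇒product-bdd =
      let C , 0≤C , w⊑ = gw
          E , 0≤E , bd = product-bound {λ k i → 𝟙 ⊕ w k i} {1ℚ} {C} 0≤1
            (λ k i → subst (𝟙 ⊕ w k i ⊑_) (sym (ℚₚ.*-identityˡ _)) (⊑-⊕ 𝟙⊑1 (w⊑ k i)))
      in E , λ (n , i) → subst (prod n i ⊑_) (trans (cong (E ℚ.*_) (1^ℚ n)) (ℚₚ.*-identityʳ E)) (bd n i)

    geo⇒product-cauchy : Cauchy prod
    geo⇒product-cauchy = geo-step⇒cauchy {prod}
      (let C , 0≤C , pw⊑ = bdd-⊗-geo {prod} {w} geo⇒product-bdd gw in
        C , 0≤C , λ n i → ⊑-cong (solve 2 (λ p w → p :* (con 𝟙 :+ w) :- p := p :* w) refl (prod n i) (w n i)) (pw⊑ n i))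
      where open ℚ[i]-Solver

↑-⊑ : ∀ {z ρ} n → z ⊑ ρ → z ↑ n ⊑ ρ ^ℚ n
↑-⊑ zero    z⊑ρ = 𝟙⊑1
↑-⊑ (suc n) z⊑ρ = ⊑-⊗ z⊑ρ (↑-⊑ n z⊑ρ)

-- `ipochᴳ` is the product of the inverses and not the inverse of the product: in this form it is
-- again a product of factors near 1, to which the same convergence estimates apply.
pochᴳ ipochᴳ : (a q : ℚ[i]) → ℕ → ℚ[i]
pochᴳ  a q n = ∏ᴳ n λ k → 𝟙 ⊖ a ⊗ q ↑ k
ipochᴳ a q n = ∏ᴳ n λ k → inv (𝟙 ⊖ a ⊗ q ↑ k)

module Pochhammer {I : Set} {r : ℚ} (0<r : 0ℚ ℚ.< r) (r<1 : r ℚ.< 1ℚ)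
                  (q : I → ℚ[i]) (q⊑r : ∀ i → q i ⊑ r) where

  open GeometricProduct {I} {r} 0<r r<1 public

  private
    r≤1  = ℚₚ.<⇒≤ r<1

  -- One bound `D` has to serve for all factors and all indices at once.
  Regular : (I → ℚ[i]) → Set
  Regular a = ∃[ D ] ∀ k i → 𝟙 ⊖ a i ⊗ q i ↑ k ⁻¹⊑ D

  pochᶠ ipochᶠ : (I → ℚ[i]) → Family
  pochᶠ  a n i = pochᴳ (a i) (q i) n
  ipochᶠ a n i = ipochᴳ (a i) (q i) n

  aqᵏ-geo : ∀ {a} → Bounded a → Geo (λ k i → a i ⊗ q i ↑ k)
  aqᵏ-geo ba = let D , 0<D , a⊑ = positive-bound ba in D , ℚₚ.<⇒≤ 0<D , λ k i → ⊑-⊗ (a⊑ i) (↑-⊑ k (q⊑r i))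

  ⊑r⇒regular : ∀ {a} → (∀ i → a i ⊑ r) → Regular a
  ⊑r⇒regular a⊑r = recip (1ℚ ℚ.- r) , λ k i → 1-z⁻¹⊑ r<1 (⊑-mono
    (ℚₚ.≤-trans (ℚₚ.*-monoˡ-≤-nonNeg r {{nonNeg 0≤r}} (^ℚ-≤1 0≤r r≤1 k)) (ℚₚ.≤-reflexive (ℚₚ.*-identityʳ r)))
    (⊑-⊗ (a⊑r i) (↑-⊑ k (q⊑r i))))

  module _ {a : I → ℚ[i]} (ba : Bounded a) where

    private
      w : Family
      w k i = ⊝ (a i ⊗ q i ↑ k)
      gw : Geo w
      gw = geo-⊝ {λ k i → a i ⊗ q i ↑ k} (aqᵏ-geo ba)

    poch-bdd : Bdd (pochᶠ a)
    poch-bdd = geo⇒product-bdd {w} gw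

    poch-cauchy : Cauchy (pochᶠ a)
    poch-cauchy = geo⇒product-cauchy {w} gw

  module _ {a : I → ℚ[i]} (ba : Bounded a) (reg : Regular a) where

    private
      w : Family
      w k i = inv (𝟙 ⊖ a i ⊗ q i ↑ k) ⊗ (a i ⊗ q i ↑ k)
      gw : Geo w
      gw = bdd-⊗-geo {λ k i → inv (𝟙 ⊖ a i ⊗ q i ↑ k)} {λ k i → a i ⊗ q i ↑ k}
        (proj₁ reg , λ (k , i) → inv⊑ (proj₂ reg k i)) (aqᵏ-geo ba)

      -- From 1/(1 - z) = 1 + z/(1 - z), whose second term is geometric in k for z = aqᵏ because the
      -- inverses are bounded.
      ipoch≡ : ∀ n i → ipochᶠ a n i ≡ ∏ᴳ n (λ k → 𝟙 ⊕ w k i)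
      ipoch≡ n i = ∏-cong n λ k → let z = a i ⊗ q i ↑ k in trans
        (solve 2 (λ z v → v := (con 𝟙 :- z) :* v :+ v :* z) refl z (inv (𝟙 ⊖ z)))
        (cong (_⊕ inv (𝟙 ⊖ z) ⊗ z) (inverseʳ (proj₂ reg k i)))
        where open ℚ[i]-Solver

    ipoch-bdd : Bdd (ipochᶠ a)
    ipoch-bdd = bounded-cong (λ (n , i) → ipoch≡ n i) (geo⇒product-bdd {w} gw)

    ipoch-cauchy : Cauchy (ipochᶠ a)
    ipoch-cauchy = cauchy-cong {λ n i → ∏ᴳ n (λ k → 𝟙 ⊕ w k i)} {ipochᶠ a} ipoch≡ (geo⇒product-cauchy {w} gw)

  poch⊗ipoch : ∀ {a} → Regular a → ∀ n i → pochᶠ a n i ⊗ ipochᶠ a n i ≡ 𝟙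
  poch⊗ipoch reg zero    i = ⊗-identityˡ 𝟙
  poch⊗ipoch {a} reg (suc n) i = begin
    A ⊗ z ⊗ (B ⊗ inv z)     ≡⟨ solve 4 (λ A z B v → A :* z :* (B :* v) := (A :* B) :* (z :* v)) refl A z B (inv z) ⟩
    A ⊗ B ⊗ (z ⊗ inv z)     ≡⟨ cong₂ _⊗_ (poch⊗ipoch {a} reg n i) (inverseʳ (proj₂ reg n i)) ⟩
    𝟙 ⊗ 𝟙                   ≡⟨ ⊗-identityˡ 𝟙 ⟩
    𝟙                       ∎
    where
    open ≡-Reasoning
    open ℚ[i]-Solver
    A = pochᶠ a n i
    B = ipochᶠ a n i
    z = 𝟙 ⊖ a i ⊗ q i ↑ n

-- The q-binomial theorem

↑-⊗ : ∀ z w n → (z ⊗ w) ↑ n ≡ z ↑ n ⊗ w ↑ n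
↑-⊗ z w zero    = sym (⊗-identityˡ 𝟙)
↑-⊗ z w (suc n) = trans (cong (z ⊗ w ⊗_) (↑-⊗ z w n))
  (solve 4 (λ z w a b → z :* w :* (a :* b) := z :* a :* (w :* b)) refl z w (z ↑ n) (w ↑ n))
  where open ℚ[i]-Solver

𝟙↑ : ∀ n → 𝟙 ↑ n ≡ 𝟙
𝟙↑ zero    = refl
𝟙↑ (suc n) = trans (⊗-identityˡ (𝟙 ↑ n)) (𝟙↑ n)

-- The functional equation (1 - a z) F(z) = (1 - b z) F(q z) of the q-binomial
-- series, with the error caused by truncating it.
functional-equation : ∀ a b q (c : ℕ → ℚ[i]) →
  (∀ n → c (suc n) ⊗ (𝟙 ⊖ q ↑ suc n) ≡ c n ⊗ (a ⊖ q ↑ n ⊗ b)) → ∀ z M →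
  (𝟙 ⊖ a ⊗ z) ⊗ ∑ᴳ M (λ j → c j ⊗ z ↑ j) ≡
  (𝟙 ⊖ b ⊗ z) ⊗ ∑ᴳ M (λ j → c j ⊗ (q ⊗ z) ↑ j) ⊖ c M ⊗ (𝟙 ⊖ q ↑ M) ⊗ z ↑ M
functional-equation a b q c step z zero =
  solve 4 (λ a b z c → (con 𝟙 :- a :* z) :* con 𝟘 := (con 𝟙 :- b :* z) :* con 𝟘 :- c :* (con 𝟙 :- con 𝟙) :* con 𝟙)
    refl a b z (c 0)
  where open ℚ[i]-Solver
functional-equation a b q c step z (suc M) = begin
  (𝟙 ⊖ a ⊗ z) ⊗ (F ⊕ C ⊗ Z)
    ≡⟨ ⊗-distribˡ-⊕ (𝟙 ⊖ a ⊗ z) F (C ⊗ Z) ⟩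
  (𝟙 ⊖ a ⊗ z) ⊗ F ⊕ (𝟙 ⊖ a ⊗ z) ⊗ (C ⊗ Z)
    ≡⟨ cong (_⊕ (𝟙 ⊖ a ⊗ z) ⊗ (C ⊗ Z)) (functional-equation a b q c step z M) ⟩
  ((𝟙 ⊖ b ⊗ z) ⊗ F′ ⊖ C ⊗ (𝟙 ⊖ Q) ⊗ Z) ⊕ (𝟙 ⊖ a ⊗ z) ⊗ (C ⊗ Z)
    ≡⟨ solve 7 (λ a b z F′ C Q Z →
         ((con 𝟙 :- b :* z) :* F′ :- C :* (con 𝟙 :- Q) :* Z) :+ (con 𝟙 :- a :* z) :* (C :* Z) :=
         (con 𝟙 :- b :* z) :* (F′ :+ C :* (Q :* Z)) :- C :* (a :- Q :* b) :* (z :* Z)) refl a b z F′ C Q Z ⟩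
  (𝟙 ⊖ b ⊗ z) ⊗ (F′ ⊕ C ⊗ (Q ⊗ Z)) ⊖ C ⊗ (a ⊖ Q ⊗ b) ⊗ (z ⊗ Z)
    ≡⟨ cong₂ (λ u v → (𝟙 ⊖ b ⊗ z) ⊗ (F′ ⊕ C ⊗ u) ⊖ v ⊗ (z ⊗ Z)) (sym (↑-⊗ q z M)) (sym (step M)) ⟩
  (𝟙 ⊖ b ⊗ z) ⊗ (F′ ⊕ C ⊗ (q ⊗ z) ↑ M) ⊖ c (suc M) ⊗ (𝟙 ⊖ q ↑ suc M) ⊗ (z ⊗ Z) ∎
  where
  open ≡-Reasoning
  open ℚ[i]-Solver
  F  = ∑ᴳ M (λ j → c j ⊗ z ↑ j)
  F′ = ∑ᴳ M (λ j → c j ⊗ (q ⊗ z) ↑ j)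
  C  = c M
  Q  = q ↑ M
  Z  = z ↑ M

module QBinomial {I : Set} {r : ℚ} (0<r : 0ℚ ℚ.< r) (r<1 : r ℚ.< 1ℚ)
                 (q : I → ℚ[i]) (q⊑r : ∀ i → q i ⊑ r) where

  open Pochhammer {I} {r} 0<r r<1 q q⊑r public

  private
    r≤1 = ℚₚ.<⇒≤ r<1

  infix 4 _∼_

  _∼_ : Family → Family → Set
  u ∼ v = Null λ n i → u n i ⊖ v n i

  ∼-cong : ∀ {u u′ v v′ : Family} → (∀ n i → u′ n i ≡ u n i) → (∀ n i → v′ n i ≡ v n i) → u ∼ v → u′ ∼ v′
  ∼-cong {u} {u′} {v} {v′} u′≗u v′≗v = vanishing-cong
    {u = λ (n , i) → u n i ⊖ v n i} {v = λ (n , i) → u′ n i ⊖ v′ n i} λ (n , i) → cong₂ _⊖_ (u′≗u n i) (v′≗v n i)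

  ∼-refl : ∀ u → u ∼ u
  ∼-refl u ε 0<ε = 0 , λ (n , i) _ → ⊑-cong
    (solve 1 (λ z → z :- z := con 𝟘) refl (u n i)) (⊑-mono (ℚₚ.<⇒≤ 0<ε) 𝟘⊑0)
    where open ℚ[i]-Solver

  ∼-trans : ∀ {u v w} → u ∼ v → v ∼ w → u ∼ w
  ∼-trans {u} {v} {w} u∼v v∼w = vanishing-cong
    {u = λ (n , i) → (u n i ⊖ v n i) ⊕ (v n i ⊖ w n i)} {v = λ (n , i) → u n i ⊖ w n i}
    (λ (n , i) → solve 3 (λ a b c → a :- c := (a :- b) :+ (b :- c)) refl (u n i) (v n i) (w n i))
    (vanishing-⊕ {u = λ (n , i) → u n i ⊖ v n i} {v = λ (n , i) → v n i ⊖ w n i} u∼v v∼w)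
    where open ℚ[i]-Solver

  ∼-sym : ∀ {u v} → u ∼ v → v ∼ u
  ∼-sym {u} {v} u∼v = vanishing-cong {u = λ (n , i) → ⊝ (u n i ⊖ v n i)} {v = λ (n , i) → v n i ⊖ u n i}
    (λ (n , i) → solve 2 (λ a b → b :- a := :- (a :- b)) refl (u n i) (v n i))
    (vanishing-⊝ {u = λ (n , i) → u n i ⊖ v n i} u∼v)
    where open ℚ[i]-Solver

  ∼-⊗ : ∀ {u u′ v v′} → Bdd u′ → Bdd v → u ∼ u′ → v ∼ v′ → (λ n i → u n i ⊗ v n i) ∼ (λ n i → u′ n i ⊗ v′ n i)
  ∼-⊗ {u} {u′} {v} {v′} bu′ bv u∼u′ v∼v′ = vanishing-cong
    {u = λ (n , i) → v n i ⊗ (u n i ⊖ u′ n i) ⊕ u′ n i ⊗ (v n i ⊖ v′ n i)}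
    {v = λ (n , i) → u n i ⊗ v n i ⊖ u′ n i ⊗ v′ n i}
    (λ (n , i) → solve 4 (λ a a′ b b′ → a :* b :- a′ :* b′ := b :* (a :- a′) :+ a′ :* (b :- b′)) refl
      (u n i) (u′ n i) (v n i) (v′ n i))
    (vanishing-⊕ {u = λ (n , i) → v n i ⊗ (u n i ⊖ u′ n i)} {v = λ (n , i) → u′ n i ⊗ (v n i ⊖ v′ n i)}
      (vanishing-⊗ {b = λ (n , i) → v n i} {u = λ (n , i) → u n i ⊖ u′ n i} bv u∼u′)
      (vanishing-⊗ {b = λ (n , i) → u′ n i} {u = λ (n , i) → v n i ⊖ v′ n i} bu′ v∼v′))
    where open ℚ[i]-Solver

  geo⇒null : ∀ {u} → Geo u → Null u
  geo⇒null (C , 0≤C , u⊑) ε 0<ε = let N , small = C*r^n≤ε 0≤r r<1 C ε 0≤C 0<ε in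
    N , λ (n , i) N≤n → ⊑-mono (small n N≤n) (u⊑ n i)

  null-unshift : ∀ {u : Family} → Null (λ n i → u (suc n) i) → Null u
  null-unshift {u} nu ε 0<ε = let N , small = nu ε 0<ε in suc N , λ { (suc n , i) (ℕ.s≤s N≤n) → small (n , i) N≤n }

  q-regular : Regular q
  q-regular = ⊑r⇒regular q⊑r

  -- P_n(a, b)/(q;q)_n. For a ≠ 0 this is aⁿ (b/a;q)_n/(q;q)_n, the coefficient in the q-binomial
  -- theorem; the present form also admits a = 0.
  coef : (a b : I → ℚ[i]) → Family
  coef a b n i = ∏ᴳ n (λ k → a i ⊖ q i ↑ k ⊗ b i) ⊗ ipochᶠ q n i

  coef-step : ∀ a b n i → coef a b (suc n) i ⊗ (𝟙 ⊖ q i ↑ suc n) ≡ coef a b n i ⊗ (a i ⊖ q i ↑ n ⊗ b i)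
  coef-step a b n i = trans
    (solve 5 (λ p f v j z → p :* f :* (j :* v) :* z := p :* j :* f :* (z :* v)) refl
      (∏ᴳ n (λ k → a i ⊖ q i ↑ k ⊗ b i)) (a i ⊖ q i ↑ n ⊗ b i) (inv z) (ipochᶠ q n i) z)
    (trans (cong (coef a b n i ⊗ (a i ⊖ q i ↑ n ⊗ b i) ⊗_) (inverseʳ (proj₂ q-regular n i)))
           (solve 1 (λ u → u :* con 𝟙 := u) refl (coef a b n i ⊗ (a i ⊖ q i ↑ n ⊗ b i))))
    where
    open ℚ[i]-Solver
    z = 𝟙 ⊖ q i ↑ suc n

  const-bdd : ∀ {a : I → ℚ[i]} → Bounded a → Bdd (λ _ → a)
  const-bdd (C , a⊑) = C , λ (n , i) → a⊑ i

  ⊑r⇒bounded : ∀ {a : I → ℚ[i]} → (∀ i → a i ⊑ r) → Bounded a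
  ⊑r⇒bounded a⊑r = r , a⊑r

  iQ-bdd : Bdd (ipochᶠ q)
  iQ-bdd = ipoch-bdd (⊑r⇒bounded q⊑r) q-regular

  module _ {a b : I → ℚ[i]} (a⊑r : ∀ i → a i ⊑ r) (bb : Bounded b) where

    -- With B bounding b, the factor a - qᵏb is at most r + rᵏB = r (1 + (B/r) rᵏ), which fits
    -- `product-bound` with ρ = r and C = B/r.
    coef-geo : Geo (coef a b)
    coef-geo =
      let B , 0<B , b⊑ = positive-bound bb
          E , 0≤E , bd = product-bound {λ k i → a i ⊖ q i ↑ k ⊗ b i} {r} {recip r ℚ.* B} 0≤r λ k i →
            subst (a i ⊖ q i ↑ k ⊗ b i ⊑_)
              (trans (cong (λ e → r ℚ.+ r ^ℚ k ℚ.* e) (trans (sym (ℚₚ.*-identityˡ B)) (cong (ℚ._* B)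
                  (sym (recip-inverse 0<r)))))
                (S.solve 4 (λ r R e B → r S.:+ R S.:* (e S.:* r S.:* B) S.:= r S.:* (S.con 1ℚ S.:+ e S.:* B S.:* R)) refl
                  r (r ^ℚ k) (recip r) B))
              (⊑-⊖ (a⊑r i) (⊑-⊗ (↑-⊑ k (q⊑r i)) (b⊑ i)))
          C , 0≤C , c⊑ = bdd-⊗-geo {ipochᶠ q} {λ n i → ∏ᴳ n (λ k → a i ⊖ q i ↑ k ⊗ b i)} iQ-bdd (E , 0≤E , bd)
      in C , 0≤C , λ n i → ⊑-cong (⊗-comm (∏ᴳ n (λ k → a i ⊖ q i ↑ k ⊗ b i)) (ipochᶠ q n i)) (c⊑ n i)
      where module S = ℚ-Solver.+-*-Solver

    F : ℕ → ℕ → I → ℚ[i]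
    F M l i = ∑ᴳ M λ j → coef a b j i ⊗ (q i ↑ l) ↑ j

    -- The truncated functional equation is applied at z = 1, q, q², and so on, L times in all. Each
    -- application multiplies by (1 - bz)/(1 - az) and leaves an error of order r^M, since the
    -- coefficient of index M is that small.
    iterated : ∃[ C ] 0ℚ ℚ.≤ C × ∀ L M i → F M 0 i ⊖ pochᶠ b L i ⊗ ipochᶠ a L i ⊗ F M L i ⊑ ι L ℚ.* (C ℚ.* r ^ℚ M)
    iterated = K , 0≤K , go
      where
      open ℚ[i]-Solver
      module S = ℚ-Solver.+-*-Solver
      reg = ⊑r⇒regular a⊑r
      B = positive-bound (poch-bdd bb)
      A = positive-bound (ipoch-bdd (⊑r⇒bounded a⊑r) reg)
      C = proj₁ coef-geo
      0≤C = proj₁ (proj₂ coef-geo)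
      -- The factor 2 bounds 1 - q^M; the remaining power of q in the error is at most 1.
      K = proj₁ B ℚ.* proj₁ A ℚ.* (C ℚ.* 2ℚ)
      0≤K : 0ℚ ℚ.≤ K
      0≤K = *-nonNeg (*-nonNeg (ℚₚ.<⇒≤ (proj₁ (proj₂ B))) (ℚₚ.<⇒≤ (proj₁ (proj₂ A)))) (*-nonNeg 0≤C (ℚₚ.nonNegative⁻¹ 2ℚ))
      err : ℕ → ℕ → I → ℚ[i]
      err L M i = pochᶠ b L i ⊗ ipochᶠ a (suc L) i ⊗ (coef a b M i ⊗ (𝟙 ⊖ q i ↑ M) ⊗ (q i ↑ L) ↑ M)
      ↑⊑1 : ∀ {z} n → z ⊑ 1ℚ → z ↑ n ⊑ 1ℚ
      ↑⊑1 n z⊑1 = ⊑-mono (ℚₚ.≤-reflexive (1^ℚ n)) (↑-⊑ n z⊑1)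
      q⊑1 : ∀ i → q i ⊑ 1ℚ
      q⊑1 i = ⊑-mono r≤1 (q⊑r i)
      err⊑ : ∀ L M i → err L M i ⊑ K ℚ.* r ^ℚ M
      err⊑ L M i = subst (err L M i ⊑_)
        (S.solve 4 (λ b a c R → b S.:* a S.:* (c S.:* R S.:* S.con 2ℚ S.:* S.con 1ℚ) S.:=
            b S.:* a S.:* (c S.:* S.con 2ℚ) S.:* R) refl
          (proj₁ B) (proj₁ A) C (r ^ℚ M))
        (⊑-⊗ (⊑-⊗ (proj₂ (proj₂ B) (L , i)) (proj₂ (proj₂ A) (suc L , i)))
          (⊑-⊗ (⊑-⊗ (proj₂ (proj₂ coef-geo) M i) (⊑-⊖ 𝟙⊑1 (↑⊑1 M (q⊑1 i)))) (↑⊑1 M (↑⊑1 L (q⊑1 i)))))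
      go : ∀ L M i → F M 0 i ⊖ pochᶠ b L i ⊗ ipochᶠ a L i ⊗ F M L i ⊑ ι L ℚ.* (K ℚ.* r ^ℚ M)
      go zero M i = subst₂ _⊑_
        (solve 1 (λ f → con 𝟘 := f :- con 𝟙 :* con 𝟙 :* f) refl (F M 0 i)) (sym (ℚₚ.*-zeroˡ (K ℚ.* r ^ℚ M))) 𝟘⊑0
      go (suc L) M i = subst₂ _⊑_ split
        (S.solve 2 (λ m c → m S.:* c S.:+ c S.:= (S.con 1ℚ S.:+ m) S.:* c) refl (ι L) (K ℚ.* r ^ℚ M))
        (⊑-⊖ (go L M i) (err⊑ L M i))
        where
        β = pochᶠ b L i
        α = ipochᶠ a L i
        z = q i ↑ L
        v = inv (𝟙 ⊖ a i ⊗ z)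
        e = coef a b M i ⊗ (𝟙 ⊖ q i ↑ M) ⊗ z ↑ M
        one : (𝟙 ⊖ a i ⊗ z) ⊗ v ≡ 𝟙
        one = inverseʳ (proj₂ reg L i)
        -- The unit (1 - az)v is inserted in front of `F M L` so that the functional equation at z =
        -- qᴸ can replace it by the sum at qᴸ⁺¹; its error `e` is exactly the one estimated by
        -- `err⊑`.
        split : (F M 0 i ⊖ β ⊗ α ⊗ F M L i) ⊖ β ⊗ (α ⊗ v) ⊗ e ≡
                F M 0 i ⊖ β ⊗ (𝟙 ⊖ b i ⊗ z) ⊗ (α ⊗ v) ⊗ F M (suc L) i
        split = ≡-Reasoning.begin
          (F M 0 i ⊖ β ⊗ α ⊗ F M L i) ⊖ β ⊗ (α ⊗ v) ⊗ e
            ≡-Reasoning.≡⟨ solve 6 (λ f β α g v e → (f :- β :* α :* g) :- β :* (α :* v) :* e :=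
                  (f :- β :* α :* (con 𝟙 :* g)) :- β :* (α :* v) :* e) refl (F M 0 i) β α (F M L i) v e ⟩
          (F M 0 i ⊖ β ⊗ α ⊗ (𝟙 ⊗ F M L i)) ⊖ β ⊗ (α ⊗ v) ⊗ e
            ≡-Reasoning.≡⟨ cong (λ o → (F M 0 i ⊖ β ⊗ α ⊗ (o ⊗ F M L i)) ⊖ β ⊗ (α ⊗ v) ⊗ e) (sym one) ⟩
          (F M 0 i ⊖ β ⊗ α ⊗ ((𝟙 ⊖ a i ⊗ z) ⊗ v ⊗ F M L i)) ⊖ β ⊗ (α ⊗ v) ⊗ e
            ≡-Reasoning.≡⟨ solve 7 (λ f β α w v g e → (f :- β :* α :* (w :* v :* g)) :- β :* (α :* v) :* e :=
                  f :- β :* (α :* v) :* (w :* g :+ e)) refl (F M 0 i) β α (𝟙 ⊖ a i ⊗ z) v (F M L i) e ⟩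
          F M 0 i ⊖ β ⊗ (α ⊗ v) ⊗ ((𝟙 ⊖ a i ⊗ z) ⊗ F M L i ⊕ e)
            ≡-Reasoning.≡⟨ cong (λ o → F M 0 i ⊖ β ⊗ (α ⊗ v) ⊗ (o ⊕ e))
                 (functional-equation (a i) (b i) (q i) (λ n → coef a b n i) (λ n → coef-step a b n i) z M) ⟩
          F M 0 i ⊖ β ⊗ (α ⊗ v) ⊗ (((𝟙 ⊖ b i ⊗ z) ⊗ F M (suc L) i ⊖ e) ⊕ e)
            ≡-Reasoning.≡⟨ solve 6 (λ f β α w g e → f :- β :* α :* ((w :* g :- e) :+ e) := f :- β :* w :* α :* g) refl
                  (F M 0 i) β (α ⊗ v) (𝟙 ⊖ b i ⊗ z) (F M (suc L) i) e ⟩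
          F M 0 i ⊖ β ⊗ (𝟙 ⊖ b i ⊗ z) ⊗ (α ⊗ v) ⊗ F M (suc L) i ≡-Reasoning.∎

    -- Only the constant term 1 survives: every other term contains a positive power of q^M.
    F-at-qᴹ : Null (λ M i → F M M i ⊖ 𝟙)
    -- The estimate starts at M = m + 1, because the empty sum at M = 0 lacks the constant term.
    F-at-qᴹ = null-unshift {λ M i → F M M i ⊖ 𝟙} (linGeo⇒null (C , 0≤C , λ m i → let z = q i ↑ suc m in subst₂ _⊑_
        (sym (trans (cong (_⊖ 𝟙) (trans (∑-first m (λ j → coef a b j i ⊗ z ↑ j))
            (cong (_⊕ ∑ᴳ m (λ j → coef a b (suc j) i ⊗ z ↑ suc j)) 𝟙𝟙𝟙)))
          (solve 1 (λ s → (con 𝟙 :+ s) :- con 𝟙 := s) refl (∑ᴳ m (λ j → coef a b (suc j) i ⊗ z ↑ suc j)))))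
        (S.solve 3 (λ m C R → m S.:* (C S.:* R) S.:= C S.:* (m S.:* R)) refl (ι m) C (r ^ℚ m))
        (∑-⊑ m (λ j → coef a b (suc j) i ⊗ z ↑ suc j) λ j _ → ⊑-⊗ (c⊑C (suc j) i) (tail⊑ m j i))))
      where
      open ℚ[i]-Solver
      module S = ℚ-Solver.+-*-Solver
      C = proj₁ coef-geo
      0≤C = proj₁ (proj₂ coef-geo)
      𝟙𝟙𝟙 : 𝟙 ⊗ 𝟙 ⊗ 𝟙 ≡ 𝟙
      𝟙𝟙𝟙 = refl
      c⊑C : ∀ n i → coef a b n i ⊑ C
      c⊑C n i = proj₂ (geo⇒bdd coef-geo) (n , i)
      tail⊑ : ∀ m j i → (q i ↑ suc m) ↑ suc j ⊑ r ^ℚ m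
      tail⊑ m j i = ⊑-mono (ℚₚ.≤-trans
          (*-mono-≤ (^ℚ-nonNeg 0≤r (suc m)) (ℚₚ.nonNegative⁻¹ 1ℚ) (ℚₚ.≤-refl {r ^ℚ suc m})
            (^ℚ-≤1 (^ℚ-nonNeg 0≤r (suc m)) (^ℚ-≤1 0≤r r≤1 (suc m)) j))
          (ℚₚ.≤-trans (ℚₚ.≤-reflexive (ℚₚ.*-identityʳ (r ^ℚ suc m)))
            (ℚₚ.≤-trans (ℚₚ.*-monoʳ-≤-nonNeg (r ^ℚ m) {{nonNeg (^ℚ-nonNeg 0≤r m)}} r≤1) (ℚₚ.≤-reflexive
                (ℚₚ.*-identityˡ (r ^ℚ m))))))
        (↑-⊑ (suc j) (↑-⊑ (suc m) (q⊑r i)))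

    -- `iterated` is used with L = M, so that the argument q^M tends to 0 while the truncation
    -- grows. The accumulated error is of order M r^M and still vanishes.
    q-binomial : (λ M i → F M 0 i) ∼ (λ M i → pochᶠ b M i ⊗ ipochᶠ a M i)
    q-binomial = vanishing-cong
      {u = λ (M , i) → (F M 0 i ⊖ pochᶠ b M i ⊗ ipochᶠ a M i ⊗ F M M i) ⊕ pochᶠ b M i ⊗ ipochᶠ a M i ⊗ (F M M i ⊖ 𝟙)}
      {v = λ (M , i) → F M 0 i ⊖ pochᶠ b M i ⊗ ipochᶠ a M i}
      (λ (M , i) → solve 3 (λ f p g → f :- p := (f :- p :* g) :+ p :* (g :- con 𝟙)) refl
        (F M 0 i) (pochᶠ b M i ⊗ ipochᶠ a M i) (F M M i))
      (vanishing-⊕ {u = λ (M , i) → F M 0 i ⊖ pochᶠ b M i ⊗ ipochᶠ a M i ⊗ F M M i}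
                   {v = λ (M , i) → pochᶠ b M i ⊗ ipochᶠ a M i ⊗ (F M M i ⊖ 𝟙)}
        (linGeo⇒null {λ M i → F M 0 i ⊖ pochᶠ b M i ⊗ ipochᶠ a M i ⊗ F M M i}
          (let C , 0≤C , bd = iterated in C , 0≤C , λ M i → subst (F M 0 i ⊖ pochᶠ b M i ⊗ ipochᶠ a M i ⊗ F M M i ⊑_)
            (S.solve 3 (λ m C R → m S.:* (C S.:* R) S.:= C S.:* (m S.:* R)) refl (ι M) C (r ^ℚ M)) (bd M M i)))
        (vanishing-⊗ {b = λ (M , i) → pochᶠ b M i ⊗ ipochᶠ a M i} {u = λ (M , i) → F M M i ⊖ 𝟙}
          (bounded-⊗ {u = λ (M , i) → pochᶠ b M i} {v = λ (M , i) → ipochᶠ a M i}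
            (poch-bdd bb) (ipoch-bdd (⊑r⇒bounded a⊑r) (⊑r⇒regular a⊑r)))
          F-at-qᴹ))
      where
      open ℚ[i]-Solver
      module S = ℚ-Solver.+-*-Solver

    -- `iterated` at the fixed level L = j, solved for the sum at qʲ. With a = xs and b = ys this is
    -- the origin of the ratio (xs;q)_j/(ys;q)_j in the ₂φ₁ series.
    F-shift : Regular b → ∀ j → (λ M i → F M j i) ∼ (λ M i → pochᶠ a j i ⊗ ipochᶠ b j i ⊗ F M 0 i)
    F-shift reg-b j = vanishing-cong
      {u = λ (M , i) → (pochᶠ a j i ⊗ ipochᶠ b j i) ⊗ (⊝ (F M 0 i ⊖ pochᶠ b j i ⊗ ipochᶠ a j i ⊗ F M j i))}
      {v = λ (M , i) → F M j i ⊖ pochᶠ a j i ⊗ ipochᶠ b j i ⊗ F M 0 i}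
      (λ (M , i) → sym (begin
        pochᶠ a j i ⊗ ipochᶠ b j i ⊗ (⊝ (F M 0 i ⊖ pochᶠ b j i ⊗ ipochᶠ a j i ⊗ F M j i))
          ≡⟨ solve 6 (λ A B′ B A′ f g → A :* B′ :* (:- (f :- B :* A′ :* g)) :=
              (A :* A′) :* (B :* B′) :* g :- A :* B′ :* f) refl
               (pochᶠ a j i) (ipochᶠ b j i) (pochᶠ b j i) (ipochᶠ a j i) (F M 0 i) (F M j i) ⟩
        (pochᶠ a j i ⊗ ipochᶠ a j i) ⊗ (pochᶠ b j i ⊗ ipochᶠ b j i) ⊗ F M j i ⊖ pochᶠ a j i ⊗ ipochᶠ b j i ⊗ F M 0 i
          ≡⟨ cong₂ (λ u v → u ⊗ v ⊗ F M j i ⊖ pochᶠ a j i ⊗ ipochᶠ b j i ⊗ F M 0 i)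
               (poch⊗ipoch {a} (⊑r⇒regular a⊑r) j i) (poch⊗ipoch {b} reg-b j i) ⟩
        𝟙 ⊗ 𝟙 ⊗ F M j i ⊖ pochᶠ a j i ⊗ ipochᶠ b j i ⊗ F M 0 i
          ≡⟨ solve 2 (λ g h → con 𝟙 :* con 𝟙 :* g :- h := g :- h) refl (F M j i) (pochᶠ a j i ⊗ ipochᶠ b j i ⊗ F M 0 i) ⟩
        F M j i ⊖ pochᶠ a j i ⊗ ipochᶠ b j i ⊗ F M 0 i ∎))
      (vanishing-⊗ {b = λ (M , i) → pochᶠ a j i ⊗ ipochᶠ b j i}
                   {u = λ (M , i) → ⊝ (F M 0 i ⊖ pochᶠ b j i ⊗ ipochᶠ a j i ⊗ F M j i)}
        (bounded-⊗ {u = λ (M , i) → pochᶠ a j i} {v = λ (M , i) → ipochᶠ b j i}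
          (let C , bd = poch-bdd {a} (⊑r⇒bounded a⊑r) in C , λ (M , i) → bd (j , i))
          (let C , bd = ipoch-bdd {b} bb reg-b in C , λ (M , i) → bd (j , i)))
        (vanishing-⊝ {u = λ (M , i) → F M 0 i ⊖ pochᶠ b j i ⊗ ipochᶠ a j i ⊗ F M j i}
          (geo⇒null {λ M i → F M 0 i ⊖ pochᶠ b j i ⊗ ipochᶠ a j i ⊗ F M j i}
            (let C , 0≤C , bd = iterated in ι j ℚ.* C , *-nonNeg (0≤ι j) 0≤C , λ M i →
              subst (F M 0 i ⊖ pochᶠ b j i ⊗ ipochᶠ a j i ⊗ F M j i ⊑_) (sym (ℚₚ.*-assoc (ι j) C (r ^ℚ M))) (bd j M i)))))
      where
      open ≡-Reasoning
      open ℚ[i]-Solver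

conv-cong : ∀ {f f′ g g′} n → (∀ k → f k ≡ f′ k) → (∀ k → g k ≡ g′ k) → conv f g n ≡ conv f′ g′ n
conv-cong n f≗ g≗ = ∑-cong (suc n) λ k _ → cong₂ _⊗_ (f≗ k) (g≗ (n ∸ k))

↑-+ : ∀ z m n → z ↑ (m ℕ.+ n) ≡ z ↑ m ⊗ z ↑ n
↑-+ z zero    n = sym (⊗-identityˡ (z ↑ n))
↑-+ z (suc m) n = trans (cong (z ⊗_) (↑-+ z m n)) (sym (⊗-assoc z (z ↑ m) (z ↑ n)))

↑-split : ∀ z {k n} → k ℕ.≤ n → z ↑ n ≡ z ↑ k ⊗ z ↑ (n ∸ k)
↑-split z {k} {n} k≤n = trans (cong (z ↑_) (sym (ℕₚ.m+[n∸m]≡n k≤n))) (↑-+ z k (n ∸ k))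

conv-⊗-↑ : ∀ f g z n → conv f g n ⊗ z ↑ n ≡ conv (λ k → f k ⊗ z ↑ k) (λ k → g k ⊗ z ↑ k) n
conv-⊗-↑ f g z n = trans (⊗-comm (conv f g n) (z ↑ n)) (trans (sym (∑-⊗ˡ (suc n) (z ↑ n) (λ k → f k ⊗ g (n ∸ k))))
  (∑-cong (suc n) λ { k (ℕ.s≤s k≤n) → trans (cong (_⊗ (f k ⊗ g (n ∸ k))) (↑-split z k≤n))
    (solve 4 (λ a b f g → a :* b :* (f :* g) := f :* a :* (g :* b)) refl (z ↑ k) (z ↑ (n ∸ k)) (f k) (g (n ∸ k))) }))
  where open ℚ[i]-Solver

-- The polynomials hₙ

-- The q-Pascal rule for Cauchy products, from 1 - qⁿ⁺¹ = qᵏ (1 - qⁿ⁺¹⁻ᵏ) + (1 - qᵏ).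
conv-suc : ∀ q u v n → (𝟙 ⊖ q ↑ suc n) ⊗ conv u v (suc n) ≡
  conv (λ k → q ↑ k ⊗ u k) (λ j → (𝟙 ⊖ q ↑ suc j) ⊗ v (suc j)) n ⊕
  conv (λ k → (𝟙 ⊖ q ↑ suc k) ⊗ u (suc k)) v n
conv-suc q u v n = begin
  (𝟙 ⊖ q ↑ suc n) ⊗ conv u v (suc n)
    ≡⟨ ∑-⊗ˡ (suc (suc n)) (𝟙 ⊖ q ↑ suc n) (λ k → u k ⊗ v (suc n ∸ k)) ⟨
  ∑ᴳ (suc (suc n)) (λ k → (𝟙 ⊖ q ↑ suc n) ⊗ (u k ⊗ v (suc n ∸ k)))
    ≡⟨ ∑-cong (suc (suc n)) (λ { k (ℕ.s≤s k≤1+n) → trans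
         (cong (λ z → (𝟙 ⊖ z) ⊗ (u k ⊗ v (suc n ∸ k))) (↑-split q k≤1+n))
         (solve 4 (λ a b u v → (con 𝟙 :- a :* b) :* (u :* v) := a :* u :* ((con 𝟙 :- b) :* v) :+ (con 𝟙 :- a) :* u :* v) refl
           (q ↑ k) (q ↑ (suc n ∸ k)) (u k) (v (suc n ∸ k))) }) ⟩
  ∑ᴳ (suc (suc n)) (λ k → f k ⊕ g k)
    ≡⟨ ∑-⊕ (suc (suc n)) f g ⟩
  ∑ᴳ (suc (suc n)) f ⊕ ∑ᴳ (suc (suc n)) g
    ≡⟨ cong₂ _⊕_ last first ⟩
  conv (λ k → q ↑ k ⊗ u k) (λ j → (𝟙 ⊖ q ↑ suc j) ⊗ v (suc j)) n ⊕
  conv (λ k → (𝟙 ⊖ q ↑ suc k) ⊗ u (suc k)) v n ∎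
  where
  open ≡-Reasoning
  open ℚ[i]-Solver
  f g : ℕ → ℚ[i]
  f k = q ↑ k ⊗ u k ⊗ ((𝟙 ⊖ q ↑ (suc n ∸ k)) ⊗ v (suc n ∸ k))
  g k = (𝟙 ⊖ q ↑ k) ⊗ u k ⊗ v (suc n ∸ k)
  last : ∑ᴳ (suc (suc n)) f ≡ conv (λ k → q ↑ k ⊗ u k) (λ j → (𝟙 ⊖ q ↑ suc j) ⊗ v (suc j)) n
  last = trans
    (cong₂ _⊕_
      (∑-cong (suc n) λ { k (ℕ.s≤s k≤n) → cong (λ m → q ↑ k ⊗ u k ⊗ ((𝟙 ⊖ q ↑ m) ⊗ v m)) (ℕₚ.+-∸-assoc 1 k≤n) })
      (trans (cong (λ m → q ↑ suc n ⊗ u (suc n) ⊗ ((𝟙 ⊖ q ↑ m) ⊗ v m)) (ℕₚ.n∸n≡0 n))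
        (solve 2 (λ a v → a :* ((con 𝟙 :- con 𝟙) :* v) := con 𝟘) refl (q ↑ suc n ⊗ u (suc n)) (v 0))))
    (solve 1 (λ s → s :+ con 𝟘 := s) refl (conv (λ k → q ↑ k ⊗ u k) (λ j → (𝟙 ⊖ q ↑ suc j) ⊗ v (suc j)) n))
  first : ∑ᴳ (suc (suc n)) g ≡ conv (λ k → (𝟙 ⊖ q ↑ suc k) ⊗ u (suc k)) v n
  first = trans (∑-first (suc n) g)
    (solve 3 (λ a v s → (con 𝟙 :- con 𝟙) :* a :* v :+ s := s) refl
        (u 0) (v (suc n)) (conv (λ k → (𝟙 ⊖ q ↑ suc k) ⊗ u (suc k)) v n))

-- Both sums produced by `conv-suc` run over the same pairs (k, n - k), so a recurrence for Cauchy
-- products reduces to an identity between single terms.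
conv-suc-≡ : ∀ q u v F G n →
  (∀ k l → q ↑ k ⊗ u k ⊗ ((𝟙 ⊖ q ↑ suc l) ⊗ v (suc l)) ⊕ (𝟙 ⊖ q ↑ suc k) ⊗ u (suc k) ⊗ v l ≡ F k ⊗ G l) →
  (𝟙 ⊖ q ↑ suc n) ⊗ conv u v (suc n) ≡ conv F G n
conv-suc-≡ q u v F G n termwise = trans (conv-suc q u v n) (trans
  (sym (∑-⊕ (suc n) (λ k → q ↑ k ⊗ u k ⊗ ((𝟙 ⊖ q ↑ suc (n ∸ k)) ⊗ v (suc (n ∸ k))))
                    (λ k → (𝟙 ⊖ q ↑ suc k) ⊗ u (suc k) ⊗ v (n ∸ k))))
  (∑-cong (suc n) λ k _ → termwise k (n ∸ k)))

module Generating {I : Set} {r : ℚ} (0<r : 0ℚ ℚ.< r) (r<1 : r ℚ.< 1ℚ)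
                  (q x y : I → ℚ[i]) (q⊑r : ∀ i → q i ⊑ r) where

  open QBinomial {I} {r} 0<r r<1 q q⊑r public

  Q iQ : Family
  Q  = pochᶠ q
  iQ = ipochᶠ q

  -- H j m = hₘ(qʲx, qʲy | q)
  H : ℕ → ℕ → I → ℚ[i]
  H j m i = Q m i ⊗ conv (λ k → coef x y k i ⊗ (q i ↑ j) ↑ k) (λ k → iQ k i) m

  iQ-step : ∀ n i → (𝟙 ⊖ q i ↑ suc n) ⊗ iQ (suc n) i ≡ iQ n i
  iQ-step n i = trans (solve 3 (λ z j v → z :* (j :* v) := j :* (z :* v)) refl
      (𝟙 ⊖ q i ↑ suc n) (iQ n i) (inv (𝟙 ⊖ q i ↑ suc n)))
    (trans (cong (iQ n i ⊗_) (inverseʳ (proj₂ q-regular n i))) (solve 1 (λ j → j :* con 𝟙 := j) refl (iQ n i)))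
    where open ℚ[i]-Solver

  -- Termwise this is qᵏ + z(x - qᵏy) = zx + (1 - yz)qᵏ with z = qʲ. The factor qᵏ turns zᵏ into
  -- (qz)ᵏ, which raises j by one.
  H-suc : ∀ j m i → H j (suc m) i ≡ q i ↑ j ⊗ x i ⊗ H j m i ⊕ (𝟙 ⊖ y i ⊗ q i ↑ j) ⊗ H (suc j) m i
  H-suc j m i = begin
    Q m i ⊗ (𝟙 ⊖ q i ↑ suc m) ⊗ conv f g (suc m)
      ≡⟨ ⊗-assoc (Q m i) (𝟙 ⊖ q i ↑ suc m) (conv f g (suc m)) ⟩
    Q m i ⊗ ((𝟙 ⊖ q i ↑ suc m) ⊗ conv f g (suc m))
      ≡⟨ cong (Q m i ⊗_) (conv-suc-≡ (q i) f g (λ k → z ⊗ x i ⊗ f k ⊕ (𝟙 ⊖ y i ⊗ z) ⊗ f′ k) g m termwise) ⟩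
    Q m i ⊗ conv (λ k → z ⊗ x i ⊗ f k ⊕ (𝟙 ⊖ y i ⊗ z) ⊗ f′ k) g m
      ≡⟨ cong (Q m i ⊗_) (trans (∑-cong (suc m) λ k _ → solve 5 (λ a b f f′ g → (a :* f :+ b :* f′) :* g :=
          a :* (f :* g) :+ b :* (f′ :* g)) refl
             (z ⊗ x i) (𝟙 ⊖ y i ⊗ z) (f k) (f′ k) (g (m ∸ k)))
           (trans (∑-⊕ (suc m) (λ k → z ⊗ x i ⊗ (f k ⊗ g (m ∸ k))) (λ k → (𝟙 ⊖ y i ⊗ z) ⊗ (f′ k ⊗ g (m ∸ k))))
             (cong₂ _⊕_ (∑-⊗ˡ (suc m) (z ⊗ x i) (λ k → f k ⊗ g (m ∸ k))) (∑-⊗ˡ (suc m) (𝟙 ⊖ y i ⊗ z) (λ k → f′ k ⊗ g (m ∸ k)))))) ⟩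
    Q m i ⊗ (z ⊗ x i ⊗ conv f g m ⊕ (𝟙 ⊖ y i ⊗ z) ⊗ conv f′ g m)
      ≡⟨ solve 5 (λ Q a b c d → Q :* (a :* c :+ b :* d) := a :* (Q :* c) :+ b :* (Q :* d)) refl
           (Q m i) (z ⊗ x i) (𝟙 ⊖ y i ⊗ z) (conv f g m) (conv f′ g m) ⟩
    z ⊗ x i ⊗ H j m i ⊕ (𝟙 ⊖ y i ⊗ z) ⊗ H (suc j) m i ∎
    where
    open ≡-Reasoning
    open ℚ[i]-Solver
    z = q i ↑ j
    f f′ g : ℕ → ℚ[i]
    f k  = coef x y k i ⊗ z ↑ k
    f′ k = coef x y k i ⊗ (q i ⊗ z) ↑ k
    g k  = iQ k i
    termwise : ∀ k l → q i ↑ k ⊗ f k ⊗ ((𝟙 ⊖ q i ↑ suc l) ⊗ g (suc l)) ⊕ (𝟙 ⊖ q i ↑ suc k) ⊗ f (suc k) ⊗ g l ≡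
               (z ⊗ x i ⊗ f k ⊕ (𝟙 ⊖ y i ⊗ z) ⊗ f′ k) ⊗ g l
    termwise k l = begin
      q i ↑ k ⊗ f k ⊗ ((𝟙 ⊖ q i ↑ suc l) ⊗ g (suc l)) ⊕ (𝟙 ⊖ q i ↑ suc k) ⊗ f (suc k) ⊗ g l
        ≡⟨ cong₂ (λ a b → q i ↑ k ⊗ f k ⊗ a ⊕ b ⊗ g l) (iQ-step l i)
             (solve 3 (λ w c Z → w :* (c :* Z) := c :* w :* Z) refl (𝟙 ⊖ q i ↑ suc k) (coef x y (suc k) i) (z ↑ suc k)) ⟩
      q i ↑ k ⊗ f k ⊗ g l ⊕ coef x y (suc k) i ⊗ (𝟙 ⊖ q i ↑ suc k) ⊗ z ↑ suc k ⊗ g l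
        ≡⟨ cong (λ c → q i ↑ k ⊗ f k ⊗ g l ⊕ c ⊗ z ↑ suc k ⊗ g l) (coef-step x y k i) ⟩
      q i ↑ k ⊗ f k ⊗ g l ⊕ coef x y k i ⊗ (x i ⊖ q i ↑ k ⊗ y i) ⊗ z ↑ suc k ⊗ g l
        ≡⟨ solve 7 (λ R c Z g z x y → R :* (c :* Z) :* g :+ c :* (x :- R :* y) :* (z :* Z) :* g :=
             (z :* x :* (c :* Z) :+ (con 𝟙 :- y :* z) :* (c :* (R :* Z))) :* g) refl
             (q i ↑ k) (coef x y k i) (z ↑ k) (g l) z (x i) (y i) ⟩
      (z ⊗ x i ⊗ f k ⊕ (𝟙 ⊖ y i ⊗ z) ⊗ (coef x y k i ⊗ (q i ↑ k ⊗ z ↑ k))) ⊗ g l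
        ≡⟨ cong (λ w → (z ⊗ x i ⊗ f k ⊕ (𝟙 ⊖ y i ⊗ z) ⊗ (coef x y k i ⊗ w)) ⊗ g l) (sym (↑-⊗ (q i) z k)) ⟩
      (z ⊗ x i ⊗ f k ⊕ (𝟙 ⊖ y i ⊗ z) ⊗ f′ k) ⊗ g l ∎

  -- Together with the prefactor (q;q)_n, the product of `α k` and `β (n ∸ k)` is [n k] (y;q)_k
  -- xⁿ⁻ᵏ. Splitting it this way makes the expansion of h_{n+m} a Cauchy product.
  α β : Family
  α k i = pochᶠ y k i ⊗ iQ k i
  β k i = x i ↑ k ⊗ iQ k i

  -- In the induction on n the added unit is moved to m, which stays arbitrary. Then `H-suc` opens
  -- each inner term, and the q-Pascal rule, read backwards, regroups the result as the expansion
  -- for n + 1.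
  H-+ : ∀ n m i → H 0 (n ℕ.+ m) i ≡ Q n i ⊗ conv (λ k → α k i ⊗ H k m i) (λ k → β k i) n
  H-+ zero m i = solve 1 (λ h → h := con 𝟙 :* (con 𝟘 :+ con 𝟙 :* con 𝟙 :* h :* (con 𝟙 :* con 𝟙))) refl (H 0 m i)
    where open ℚ[i]-Solver
  H-+ (suc n) m i = begin
    H 0 (suc n ℕ.+ m) i
      ≡⟨ cong (λ l → H 0 l i) (sym (ℕₚ.+-suc n m)) ⟩
    H 0 (n ℕ.+ suc m) i
      ≡⟨ H-+ n (suc m) i ⟩
    Q n i ⊗ conv (λ k → α k i ⊗ H k (suc m) i) (λ k → β k i) n
      ≡⟨ cong (Q n i ⊗_) (sym (conv-suc-≡ (q i) f g (λ k → α k i ⊗ H k (suc m) i) g n termwise)) ⟩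
    Q n i ⊗ ((𝟙 ⊖ q i ↑ suc n) ⊗ conv f g (suc n))
      ≡⟨ ⊗-assoc (Q n i) (𝟙 ⊖ q i ↑ suc n) (conv f g (suc n)) ⟨
    Q (suc n) i ⊗ conv f g (suc n) ∎
    where
    open ≡-Reasoning
    open ℚ[i]-Solver
    f g : ℕ → ℚ[i]
    f k = α k i ⊗ H k m i
    g k = β k i
    Δα : ∀ k → (𝟙 ⊖ q i ↑ suc k) ⊗ α (suc k) i ≡ α k i ⊗ (𝟙 ⊖ y i ⊗ q i ↑ k)
    Δα k = trans
      (solve 4 (λ w Y v j → w :* (Y :* v :* j) := Y :* v :* (w :* j)) refl
          (𝟙 ⊖ q i ↑ suc k) (pochᶠ y k i) (𝟙 ⊖ y i ⊗ q i ↑ k) (iQ (suc k) i))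
      (trans (cong (pochᶠ y (suc k) i ⊗_) (iQ-step k i))
        (solve 3 (λ Y v j → Y :* v :* j := Y :* j :* v) refl (pochᶠ y k i) (𝟙 ⊖ y i ⊗ q i ↑ k) (iQ k i)))
    Δβ : ∀ l → (𝟙 ⊖ q i ↑ suc l) ⊗ β (suc l) i ≡ x i ⊗ β l i
    Δβ l = trans
      (solve 4 (λ w x X j → w :* (x :* X :* j) := x :* X :* (w :* j)) refl (𝟙 ⊖ q i ↑ suc l) (x i) (x i ↑ l) (iQ (suc l) i))
      (trans (cong (x i ⊗ x i ↑ l ⊗_) (iQ-step l i)) (⊗-assoc (x i) (x i ↑ l) (iQ l i)))
    termwise : ∀ k l → q i ↑ k ⊗ f k ⊗ ((𝟙 ⊖ q i ↑ suc l) ⊗ g (suc l)) ⊕ (𝟙 ⊖ q i ↑ suc k) ⊗ f (suc k) ⊗ g l ≡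
               α k i ⊗ H k (suc m) i ⊗ g l
    termwise k l = begin
      q i ↑ k ⊗ f k ⊗ ((𝟙 ⊖ q i ↑ suc l) ⊗ g (suc l)) ⊕ (𝟙 ⊖ q i ↑ suc k) ⊗ f (suc k) ⊗ g l
        ≡⟨ cong₂ (λ a b → q i ↑ k ⊗ f k ⊗ a ⊕ b ⊗ g l) (Δβ l)
             (trans (sym (⊗-assoc (𝟙 ⊖ q i ↑ suc k) (α (suc k) i) (H (suc k) m i))) (cong (_⊗ H (suc k) m i) (Δα k))) ⟩
      q i ↑ k ⊗ f k ⊗ (x i ⊗ g l) ⊕ α k i ⊗ (𝟙 ⊖ y i ⊗ q i ↑ k) ⊗ H (suc k) m i ⊗ g l
        ≡⟨ solve 7 (λ R a h x g w h′ → R :* (a :* h) :* (x :* g) :+ a :* w :* h′ :* g :=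
            a :* (R :* x :* h :+ w :* h′) :* g) refl
             (q i ↑ k) (α k i) (H k m i) (x i) (g l) (𝟙 ⊖ y i ⊗ q i ↑ k) (H (suc k) m i) ⟩
      α k i ⊗ (q i ↑ k ⊗ x i ⊗ H k m i ⊕ (𝟙 ⊖ y i ⊗ q i ↑ k) ⊗ H (suc k) m i) ⊗ g l
        ≡⟨ cong (λ h → α k i ⊗ h ⊗ g l) (sym (H-suc k m i)) ⟩
      α k i ⊗ H k (suc m) i ⊗ g l ∎

-- Asymptotics of the inner and the outer sum

module Asymptotics {I : Set} {r : ℚ} (0<r : 0ℚ ℚ.< r) (r<1 : r ℚ.< 1ℚ)
  (q x y s t : I → ℚ[i]) (q⊑r : ∀ i → q i ⊑ r) (s⊑r : ∀ i → s i ⊑ r) (t⊑r : ∀ i → t i ⊑ r)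
  (xt⊑r : ∀ i → x i ⊗ t i ⊑ r) (xs⊑r : ∀ i → x i ⊗ s i ⊑ r) (bx : Bounded x) (by : Bounded y) where

  open Generating {I} {r} 0<r r<1 q x y q⊑r public

  A B T : I → ℚ[i]
  A i = x i ⊗ s i
  B i = y i ⊗ s i
  T i = x i ⊗ t i

  B-bounded : Bounded B
  B-bounded = bounded-⊗ by (⊑r⇒bounded s⊑r)

  E : (I → ℚ[i]) → Family
  E a n i = a i ↑ n ⊗ iQ n i

  ↑-geo : ∀ {a : I → ℚ[i]} → (∀ i → a i ⊑ r) → Geo (λ n i → a i ↑ n)
  ↑-geo {a} a⊑r = 1ℚ , ℚₚ.nonNegative⁻¹ 1ℚ , λ n i → subst (a i ↑ n ⊑_) (sym (ℚₚ.*-identityˡ (r ^ℚ n))) (↑-⊑ n (a⊑r i))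

  E-geo : ∀ {a : I → ℚ[i]} → (∀ i → a i ⊑ r) → Geo (E a)
  E-geo {a} a⊑r = let C , 0≤C , bd = bdd-⊗-geo {iQ} {λ n i → a i ↑ n} iQ-bdd (↑-geo {a} a⊑r) in
    C , 0≤C , λ n i → ⊑-cong (⊗-comm (a i ↑ n) (iQ n i)) (bd n i)

  scaled-product : ∀ a (b : ℕ → ℚ[i]) c n → ∏ᴳ n (λ k → a ⊗ c ⊖ b k ⊗ c) ≡ ∏ᴳ n (λ k → a ⊖ b k) ⊗ c ↑ n
  scaled-product a b c zero    = sym (⊗-identityˡ 𝟙)
  scaled-product a b c (suc n) = trans (cong (_⊗ (a ⊗ c ⊖ b n ⊗ c)) (scaled-product a b c n))
    (solve 5 (λ P C a b c → P :* C :* (a :* c :- b :* c) := P :* (a :- b) :* (c :* C)) refl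
      (∏ᴳ n (λ k → a ⊖ b k)) (c ↑ n) a (b n) c)
    where open ℚ[i]-Solver

  -- P_k is homogeneous of degree k. Only in the scaled form does `coef-geo` apply, since xs is
  -- bounded by `r` while x need not be.
  coef-scale : ∀ k i → coef x y k i ⊗ s i ↑ k ≡ coef A B k i
  coef-scale k i = trans
    (solve 3 (λ P j S → P :* j :* S := P :* S :* j) refl (∏ᴳ k (λ l → x i ⊖ q i ↑ l ⊗ y i)) (iQ k i) (s i ↑ k))
    (cong (_⊗ iQ k i) (trans (sym (scaled-product (x i) (λ l → q i ↑ l ⊗ y i) (s i) k))
      (∏-cong k λ l → cong (A i ⊖_) (⊗-assoc (q i ↑ l) (y i) (s i)))))
    where open ℚ[i]-Solver

  coef-𝟘 : ∀ a n i → E a n i ≡ coef a (λ _ → 𝟘) n i ⊗ (q i ↑ 0) ↑ n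
  coef-𝟘 a n i = trans (cong (_⊗ iQ n i) (go n)) (trans
    (solve 1 (λ u → u := u :* con 𝟙) refl (coef a (λ _ → 𝟘) n i))
    (cong (coef a (λ _ → 𝟘) n i ⊗_) (sym (𝟙↑ n))))
    where
    open ℚ[i]-Solver
    go : ∀ n → a i ↑ n ≡ ∏ᴳ n (λ k → a i ⊖ q i ↑ k ⊗ 𝟘)
    go zero    = refl
    go (suc n) = trans (cong (a i ⊗_) (go n))
      (solve 3 (λ a P z → a :* P := P :* (a :- z :* con 𝟘)) refl (a i) (∏ᴳ n (λ k → a i ⊖ q i ↑ k ⊗ 𝟘)) (q i ↑ n))

  poch-𝟘 : ∀ n i → pochᶠ (λ _ → 𝟘) n i ≡ 𝟙
  poch-𝟘 zero    i = refl
  poch-𝟘 (suc n) i = trans (cong (_⊗ (𝟙 ⊖ 𝟘 ⊗ q i ↑ n)) (poch-𝟘 n i))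
    (solve 1 (λ z → con 𝟙 :* (con 𝟙 :- con 𝟘 :* z) := con 𝟙) refl (q i ↑ n))
    where open ℚ[i]-Solver

  -- The case b = 0 of the q-binomial theorem: P_n(a, 0) = aⁿ and (0;q)_n = 1.
  euler : ∀ {a} → (∀ i → a i ⊑ r) → partialSum (E a) ∼ ipochᶠ a
  euler {a} a⊑r = ∼-cong {λ M i → F a⊑r 𝟘-bounded M 0 i} {partialSum (E a)} {λ M i → pochᶠ (λ _ → 𝟘) M i ⊗ ipochᶠ a M i} {ipochᶠ a}
    (λ M i → ∑-cong M λ k _ → coef-𝟘 a k i)
    (λ M i → sym (trans (cong (_⊗ ipochᶠ a M i) (poch-𝟘 M i)) (⊗-identityˡ (ipochᶠ a M i))))
    (q-binomial a⊑r 𝟘-bounded)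
    where
    𝟘-bounded : Bounded {I} (λ _ → 𝟘)
    𝟘-bounded = bounded-const 𝟘

  ⊑r⇒ipoch-bdd : ∀ {a} → (∀ i → a i ⊑ r) → Bdd (ipochᶠ a)
  ⊑r⇒ipoch-bdd a⊑r = ipoch-bdd (⊑r⇒bounded a⊑r) (⊑r⇒regular a⊑r)

  -- Truncation of (ys;q)_∞/((s, xs;q)_∞), the factor common to the inner sums for all n.
  V : Family
  V M i = pochᶠ B M i ⊗ (ipochᶠ s M i ⊗ ipochᶠ A M i)

  is⊗iA-bdd : Bdd (λ M i → ipochᶠ s M i ⊗ ipochᶠ A M i)
  is⊗iA-bdd = bounded-⊗ {u = λ (M , i) → ipochᶠ s M i} {v = λ (M , i) → ipochᶠ A M i} (⊑r⇒ipoch-bdd s⊑r) (⊑r⇒ipoch-bdd xs⊑r)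

  V-bdd : Bdd V
  V-bdd = bounded-⊗ {u = λ (M , i) → pochᶠ B M i}
      {v = λ (M , i) → ipochᶠ s M i ⊗ ipochᶠ A M i} (poch-bdd B-bounded) is⊗iA-bdd

  V-cauchy : Cauchy V
  V-cauchy = cauchy-⊗ {pochᶠ B} {λ M i → ipochᶠ s M i ⊗ ipochᶠ A M i} (poch-bdd B-bounded) is⊗iA-bdd
    (poch-cauchy B-bounded)
    (cauchy-⊗ {ipochᶠ s} {ipochᶠ A} (⊑r⇒ipoch-bdd s⊑r) (⊑r⇒ipoch-bdd xs⊑r)
      (ipoch-cauchy (⊑r⇒bounded s⊑r) (⊑r⇒regular s⊑r)) (ipoch-cauchy (⊑r⇒bounded xs⊑r) (⊑r⇒regular xs⊑r)))

  shifted : ℕ → Family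
  shifted j k i = coef A B k i ⊗ (q i ↑ j) ↑ k

  shifted-geo : ∀ j → Geo (shifted j)
  shifted-geo j = let C , 0≤C , c⊑ = coef-geo xs⊑r B-bounded in C , 0≤C , λ k i →
    subst (shifted j k i ⊑_) (ℚₚ.*-identityʳ (C ℚ.* r ^ℚ k)) (⊑-⊗ (c⊑ k i)
      (⊑-mono (^ℚ-≤1 (^ℚ-nonNeg 0≤r j) (^ℚ-≤1 0≤r (ℚₚ.<⇒≤ r<1) j) k) (↑-⊑ k (↑-⊑ j (q⊑r i)))))

  -- The prefactor (q;q)_m of `H` cancels the denominator of the exponential term, which leaves a
  -- Cauchy product of a q-binomial series and an Euler series.
  H-term : ∀ j m i → H j m i ⊗ E s m i ≡ conv (λ k → shifted j k i) (λ k → E s k i) m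
  H-term j m i = begin
    Q m i ⊗ conv f g m ⊗ (s i ↑ m ⊗ iQ m i)
      ≡⟨ solve 4 (λ Q c S v → Q :* c :* (S :* v) := (Q :* v) :* (c :* S)) refl (Q m i) (conv f g m) (s i ↑ m) (iQ m i) ⟩
    (Q m i ⊗ iQ m i) ⊗ (conv f g m ⊗ s i ↑ m)
      ≡⟨ cong₂ _⊗_ (poch⊗ipoch {q} q-regular m i) (conv-⊗-↑ f g (s i) m) ⟩
    𝟙 ⊗ conv (λ k → f k ⊗ s i ↑ k) (λ k → g k ⊗ s i ↑ k) m
      ≡⟨ ⊗-identityˡ (conv (λ k → f k ⊗ s i ↑ k) (λ k → g k ⊗ s i ↑ k) m) ⟩
    conv (λ k → f k ⊗ s i ↑ k) (λ k → g k ⊗ s i ↑ k) m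
      ≡⟨ conv-cong m
           (λ k → trans (solve 3 (λ c z S → c :* z :* S := c :* S :* z) refl (coef x y k i) ((q i ↑ j) ↑ k) (s i ↑ k))
                        (cong (_⊗ (q i ↑ j) ↑ k) (coef-scale k i)))
           (λ k → ⊗-comm (iQ k i) (s i ↑ k)) ⟩
    conv (λ k → shifted j k i) (λ k → E s k i) m ∎
    where
    open ≡-Reasoning
    open ℚ[i]-Solver
    f g : ℕ → ℚ[i]
    f k = coef x y k i ⊗ (q i ↑ j) ↑ k
    g k = iQ k i

  -- The summands of the ₂φ₁ series and of the Euler series for 1/(xt;q)_∞.
  φ ψ : Family
  φ k i = (pochᶠ y k i ⊗ pochᶠ A k i) ⊗ (iQ k i ⊗ ipochᶠ B k i) ⊗ t i ↑ k
  ψ = E T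

  ψ-geo : Geo ψ
  ψ-geo = E-geo {T} xt⊑r

  module _ (reg : Regular B) where

    ratio : ℕ → Family
    ratio j M i = pochᶠ A j i ⊗ ipochᶠ B j i

    ratio-bdd : ∀ j → Bdd (ratio j)
    ratio-bdd j = bounded-⊗ {u = λ (M , i) → pochᶠ A j i} {v = λ (M , i) → ipochᶠ B j i}
      (let C , bd = poch-bdd {A} (⊑r⇒bounded xs⊑r) in C , λ (M , i) → bd (j , i))
      (let C , bd = ipoch-bdd {B} B-bounded reg in C , λ (M , i) → bd (j , i))

    BiA-bdd : Bdd (λ M i → pochᶠ B M i ⊗ ipochᶠ A M i)
    BiA-bdd = bounded-⊗ {u = λ (M , i) → pochᶠ B M i} {v = λ (M , i) → ipochᶠ A M i} (poch-bdd B-bounded) (⊑r⇒ipoch-bdd xs⊑r)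

    σ : ℕ → Family
    σ j M i = ∑ᴳ M λ m → H j m i ⊗ E s m i

    -- The Cauchy product is replaced by the product of its partial sums. One factor tends to
    -- 1/(s;q)_∞ by `euler`; for the other, `F-shift` moves the dependence on j into `ratio` before
    -- `q-binomial` is applied, so that `V` is the same for every j.
    σ-∼ : ∀ j → σ j ∼ (λ M i → ratio j M i ⊗ V M i)
    σ-∼ j = ∼-trans {σ j} {λ M i → partialSum (shifted j) M i ⊗ partialSum (E s) M i} {λ M i → ratio j M i ⊗ V M i}
      (∼-cong {convs} {σ j} {λ M i → partialSum (shifted j) M i ⊗ partialSum (E s) M i} {λ M i → partialSum (shifted j) M i ⊗ partialSum (E s) M i}
        (λ M i → ∑-cong M λ m _ → H-term j m i) (λ M i → refl)
        (∼-sym {λ M i → partialSum (shifted j) M i ⊗ partialSum (E s) M i} {convs} (cauchy-product (shifted-geo j) (E-geo {s} s⊑r))))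
      (∼-cong {λ M i → partialSum (shifted j) M i ⊗ partialSum (E s) M i} {λ M i → partialSum (shifted j) M i ⊗ partialSum (E s) M i}
              {λ M i → ratio j M i ⊗ (pochᶠ B M i ⊗ ipochᶠ A M i) ⊗ ipochᶠ s M i} {λ M i → ratio j M i ⊗ V M i}
        (λ M i → refl)
        (λ M i → solve 4 (λ c b s a → c :* (b :* (s :* a)) := c :* (b :* a) :* s) refl
            (ratio j M i) (pochᶠ B M i) (ipochᶠ s M i) (ipochᶠ A M i))
        (∼-⊗ {partialSum (shifted j)} {λ M i → ratio j M i ⊗ (pochᶠ B M i ⊗ ipochᶠ A M i)} {partialSum (E s)} {ipochᶠ s}
          (bounded-⊗ {u = λ (M , i) → ratio j M i} {v = λ (M , i) → pochᶠ B M i ⊗ ipochᶠ A M i} (ratio-bdd j) BiA-bdd)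
          (partialSum-bdd {E s} (E-geo {s} s⊑r))
          (∼-trans {partialSum (shifted j)} {λ M i → ratio j M i ⊗ partialSum (shifted 0) M i} {λ M i → ratio j M i ⊗ (pochᶠ B M i ⊗ ipochᶠ A M i)}
            (F-shift xs⊑r B-bounded reg j)
            (∼-⊗ {ratio j} {ratio j} {partialSum (shifted 0)} {λ M i → pochᶠ B M i ⊗ ipochᶠ A M i}
              (ratio-bdd j) (partialSum-bdd {shifted 0} (shifted-geo 0)) (∼-refl (ratio j)) (q-binomial xs⊑r B-bounded)))
          (euler {s} s⊑r)))
      where
      open ℚ[i]-Solver
      convs : Family
      convs M i = ∑ᴳ M (conv (λ k → shifted j k i) (λ k → E s k i))

    φ-geo : Geo φ
    φ-geo = bdd-⊗-geo {λ k i → (pochᶠ y k i ⊗ pochᶠ A k i) ⊗ (iQ k i ⊗ ipochᶠ B k i)} {λ k i → t i ↑ k}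
      (bounded-⊗ {u = λ (k , i) → pochᶠ y k i ⊗ pochᶠ A k i} {v = λ (k , i) → iQ k i ⊗ ipochᶠ B k i}
        (bounded-⊗ {u = λ (k , i) → pochᶠ y k i} {v = λ (k , i) → pochᶠ A k i} (poch-bdd by) (poch-bdd (⊑r⇒bounded xs⊑r)))
        (bounded-⊗ {u = λ (k , i) → iQ k i} {v = λ (k , i) → ipochᶠ B k i} iQ-bdd (ipoch-bdd B-bounded reg)))
      (↑-geo {t} t⊑r)

    weight : ℕ → ℕ → I → ℚ[i]
    weight n k i = α k i ⊗ β (n ∸ k) i ⊗ t i ↑ n

    weight-bdd : ∀ n k → Bdd (λ M → weight n k)
    weight-bdd n k = const-bdd {weight n k} (bounded-⊗ {u = λ i → α k i ⊗ β (n ∸ k) i} {v = λ i → t i ↑ n}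
      (bounded-⊗ {u = α k} {v = β (n ∸ k)}
        (bounded-⊗ {u = pochᶠ y k} {v = iQ k}
          (let C , bd = poch-bdd {y} by in C , λ i → bd (k , i)) (let C , bd = iQ-bdd in C , λ i → bd (k , i)))
        (bounded-⊗ {u = λ i → x i ↑ (n ∸ k)} {v = iQ (n ∸ k)}
          (let C , x⊑ = bx in C ^ℚ (n ∸ k) , λ i → ↑-⊑ (n ∸ k) (x⊑ i)) (let C , bd = iQ-bdd in C , λ i → bd (n ∸ k , i))))
      (r ^ℚ n , λ i → ↑-⊑ n (t⊑r i)))

    inner : ℕ → Family
    inner n M i = ∑ᴳ M λ m → H 0 (n ℕ.+ m) i ⊗ E t n i ⊗ E s m i

    G : ℕ → I → ℚ[i]
    G n i = conv (λ k → φ k i) (λ k → ψ k i) n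

    -- Only finite sums are interchanged: the sum over m is truncated at M, and the expansion of
    -- h_{n+m} has n + 1 terms.
    inner≡ : ∀ n M i → inner n M i ≡ ∑ᴳ (suc n) (λ k → weight n k i ⊗ σ k M i)
    inner≡ n M i = begin
      ∑ᴳ M (λ m → H 0 (n ℕ.+ m) i ⊗ E t n i ⊗ E s m i)
        ≡⟨ ∑-cong M (λ m _ → term m) ⟩
      ∑ᴳ M (λ m → ∑ᴳ (suc n) (λ k → weight n k i ⊗ (H k m i ⊗ E s m i)))
        ≡⟨ ∑-swap M (suc n) (λ m k → weight n k i ⊗ (H k m i ⊗ E s m i)) ⟩
      ∑ᴳ (suc n) (λ k → ∑ᴳ M (λ m → weight n k i ⊗ (H k m i ⊗ E s m i)))
        ≡⟨ ∑-cong (suc n) (λ k _ → ∑-⊗ˡ M (weight n k i) (λ m → H k m i ⊗ E s m i)) ⟩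
      ∑ᴳ (suc n) (λ k → weight n k i ⊗ σ k M i) ∎
      where
      open ≡-Reasoning
      open ℚ[i]-Solver
      term : ∀ m → H 0 (n ℕ.+ m) i ⊗ E t n i ⊗ E s m i ≡ ∑ᴳ (suc n) (λ k → weight n k i ⊗ (H k m i ⊗ E s m i))
      term m = begin
        H 0 (n ℕ.+ m) i ⊗ E t n i ⊗ E s m i
          ≡⟨ cong (λ h → h ⊗ E t n i ⊗ E s m i) (H-+ n m i) ⟩
        Q n i ⊗ D ⊗ (t i ↑ n ⊗ iQ n i) ⊗ E s m i
          ≡⟨ solve 5 (λ Q D T v e → Q :* D :* (T :* v) :* e := (Q :* v) :* (T :* e :* D)) refl
              (Q n i) D (t i ↑ n) (iQ n i) (E s m i) ⟩
        (Q n i ⊗ iQ n i) ⊗ (t i ↑ n ⊗ E s m i ⊗ D)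
          ≡⟨ trans (cong (_⊗ (t i ↑ n ⊗ E s m i ⊗ D)) (poch⊗ipoch {q} q-regular n i)) (⊗-identityˡ (t i ↑ n ⊗ E s m i ⊗ D)) ⟩
        t i ↑ n ⊗ E s m i ⊗ D
          ≡⟨ ∑-⊗ˡ (suc n) (t i ↑ n ⊗ E s m i) (λ k → α k i ⊗ H k m i ⊗ β (n ∸ k) i) ⟨
        ∑ᴳ (suc n) (λ k → t i ↑ n ⊗ E s m i ⊗ (α k i ⊗ H k m i ⊗ β (n ∸ k) i))
          ≡⟨ ∑-cong (suc n) (λ k _ → solve 5 (λ T e a h b → T :* e :* (a :* h :* b) := a :* b :* T :* (h :* e)) refl
               (t i ↑ n) (E s m i) (α k i) (H k m i) (β (n ∸ k) i)) ⟩
        ∑ᴳ (suc n) (λ k → weight n k i ⊗ (H k m i ⊗ E s m i)) ∎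
        where
        D = conv (λ k → α k i ⊗ H k m i) (λ k → β k i) n

    V⊗G≡ : ∀ n M i → V M i ⊗ G n i ≡ ∑ᴳ (suc n) (λ k → weight n k i ⊗ (ratio k M i ⊗ V M i))
    V⊗G≡ n M i = trans (sym (∑-⊗ˡ (suc n) (V M i) (λ k → φ k i ⊗ ψ (n ∸ k) i)))
      (∑-cong (suc n) λ { k (ℕ.s≤s k≤n) → trans
        (cong (λ z → V M i ⊗ (φ k i ⊗ (z ⊗ iQ (n ∸ k) i))) (↑-⊗ (x i) (t i) (n ∸ k)))
        (trans
          (solve 9 (λ V Y A j b T X T′ j′ → V :* ((Y :* A) :* (j :* b) :* T :* (X :* T′ :* j′)) :=
                      ((Y :* j) :* (X :* j′) :* (T :* T′)) :* (A :* b :* V)) refl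
            (V M i) (pochᶠ y k i) (pochᶠ A k i) (iQ k i) (ipochᶠ B k i) (t i ↑ k) (x i ↑ (n ∸ k)) (t i ↑ (n ∸ k)) (iQ (n ∸ k) i))
          (cong (λ z → (α k i ⊗ β (n ∸ k) i ⊗ z) ⊗ (ratio k M i ⊗ V M i)) (sym (↑-split (t i) k≤n)))) })
      where open ℚ[i]-Solver

    -- For each fixed n this combines n + 1 instances of `σ-∼`. The bound for the weights contains a
    -- power of a bound for x and may grow with n, which an iterated sum allows.
    inner-∼ : ∀ n → inner n ∼ (λ M i → V M i ⊗ G n i)
    inner-∼ n = vanishing-cong
      {u = λ (M , i) → ∑ᴳ (suc n) (λ k → weight n k i ⊗ (σ k M i ⊖ ratio k M i ⊗ V M i))}
      {v = λ (M , i) → inner n M i ⊖ V M i ⊗ G n i}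
      (λ (M , i) → trans (cong₂ _⊖_ (inner≡ n M i) (V⊗G≡ n M i)) (sym (begin
        ∑ᴳ (suc n) (λ k → weight n k i ⊗ (σ k M i ⊖ ratio k M i ⊗ V M i))
          ≡⟨ ∑-cong (suc n) (λ k _ → solve 3 (λ c a b → c :* (a :- b) := c :* a :+ con (⊝ 𝟙) :* (c :* b)) refl
               (weight n k i) (σ k M i) (ratio k M i ⊗ V M i)) ⟩
        ∑ᴳ (suc n) (λ k → weight n k i ⊗ σ k M i ⊕ (⊝ 𝟙) ⊗ (weight n k i ⊗ (ratio k M i ⊗ V M i)))
          ≡⟨ ∑-⊕ (suc n) (λ k → weight n k i ⊗ σ k M i) (λ k → (⊝ 𝟙) ⊗ (weight n k i ⊗ (ratio k M i ⊗ V M i))) ⟩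
        S₁ M i ⊕ ∑ᴳ (suc n) (λ k → (⊝ 𝟙) ⊗ (weight n k i ⊗ (ratio k M i ⊗ V M i)))
          ≡⟨ cong (S₁ M i ⊕_) (∑-⊗ˡ (suc n) (⊝ 𝟙) (λ k → weight n k i ⊗ (ratio k M i ⊗ V M i))) ⟩
        S₁ M i ⊕ (⊝ 𝟙) ⊗ S₂ M i
          ≡⟨ solve 2 (λ a b → a :+ con (⊝ 𝟙) :* b := a :- b) refl (S₁ M i) (S₂ M i) ⟩
        S₁ M i ⊖ S₂ M i ∎)))
      (vanishing-∑ (suc n) {λ k (M , i) → weight n k i ⊗ (σ k M i ⊖ ratio k M i ⊗ V M i)} λ k →
        vanishing-⊗ {b = λ (M , i) → weight n k i} {u = λ (M , i) → σ k M i ⊖ ratio k M i ⊗ V M i} (weight-bdd n k) (σ-∼ k))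
      where
      open ≡-Reasoning
      open ℚ[i]-Solver
      S₁ S₂ : Family
      S₁ M i = ∑ᴳ (suc n) (λ k → weight n k i ⊗ σ k M i)
      S₂ M i = ∑ᴳ (suc n) (λ k → weight n k i ⊗ (ratio k M i ⊗ V M i))

    ΦiT : Family
    ΦiT N i = partialSum φ N i ⊗ ipochᶠ T N i

    ΦiT-cauchy : Cauchy ΦiT
    ΦiT-cauchy = cauchy-⊗ {partialSum φ} {ipochᶠ T} (partialSum-bdd {φ} φ-geo) (⊑r⇒ipoch-bdd xt⊑r)
      (partialSum-cauchy {φ} φ-geo) (ipoch-cauchy (⊑r⇒bounded xt⊑r) (⊑r⇒regular xt⊑r))

    outer-∼ : partialSum G ∼ ΦiT
    outer-∼ = ∼-trans {partialSum G} {λ N i → partialSum φ N i ⊗ partialSum ψ N i} {ΦiT}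
      (∼-sym {λ N i → partialSum φ N i ⊗ partialSum ψ N i} {partialSum G} (cauchy-product φ-geo ψ-geo))
      (∼-⊗ {partialSum φ} {partialSum φ} {partialSum ψ} {ipochᶠ T}
        (partialSum-bdd {φ} φ-geo) (partialSum-bdd {ψ} ψ-geo) (∼-refl (partialSum φ)) (euler {T} xt⊑r))

-- Complex numbers as sequences in ℚ[i]

at : ℂ → ℕ → ℚ[i]
at z k = seq (re z) k ,ᵢ seq (im z) k

at-^ : ∀ z n k → at (z ^ n) k ≡ at z k ↑ n
at-^ z zero    k = refl
at-^ z (suc n) k = cong (at z k ⊗_) (at-^ z n k)

at-∑ : ∀ n f k → at (∑< n f) k ≡ ∑ᴳ n (λ j → at (f j) k)
at-∑ zero    f k = refl
at-∑ (suc n) f k = cong (_⊕ at (f n) k) (at-∑ n f k)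

at-∏ : ∀ n f k → at (∏< n f) k ≡ ∏ᴳ n (λ j → at (f j) k)
at-∏ zero    f k = refl
at-∏ (suc n) f k = cong (_⊗ at (f n) k) (at-∏ n f k)

Eventually : (ℕ → Set) → Set
Eventually P = ∃[ K ] ∀ k → K ℕ.≤ k → P k

eventually-× : ∀ {P R : ℕ → Set} → Eventually P → Eventually R → Eventually (λ k → P k × R k)
eventually-× (K , p) (L , r) = K ⊔ L , λ k le → p k (⊔-left le) , r k (⊔-right {K} le)

eventually-map : ∀ {P R : ℕ → Set} → (∀ k → P k → R k) → Eventually P → Eventually R
eventually-map f (K , p) = K , λ k le → f k (p k le)

radius : ∀ {z} → ∣ z ∣< 1ℚ → ∃[ ρ ] 0ℚ ℚ.< ρ × ρ ℚ.< 1ℚ × Eventually (λ k → at z k ⊑ ρ)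
radius {z} (mk< ε 0<ε N below) = ρ , 0<ρ , ρ<1 , N , λ k le → mk⊑ (ℚₚ.<⇒≤ 0<ρ) (begin
    ∥ at z k ∥²                ≡⟨ solve 2 (λ a e → a := (a :+ e) :- e) refl ∥ at z k ∥² ε ⟩
    (∥ at z k ∥² ℚ.+ ε) ℚ.- ε  ≤⟨ ℚₚ.+-monoˡ-≤ (ℚ.- ε) (below k le) ⟩
    1ℚ ℚ.- ε                   ≤⟨ p+r≤p′ ℚₚ.≤-refl (0≤p*p (½ ℚ.* ε)) ⟩
    (1ℚ ℚ.- ε) ℚ.+ ½ ℚ.* ε ℚ.* (½ ℚ.* ε)
                               ≡⟨ solve 1 (λ e → (con 1ℚ :- e) :+ con ½ :* e :* (con ½ :* e) :=
                                    (con 1ℚ :- con ½ :* e) :* (con 1ℚ :- con ½ :* e)) refl ε ⟩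
    ρ ℚ.* ρ                    ∎)
  where
  open ℚₚ.≤-Reasoning
  open ℚ-Solver.+-*-Solver
  -- The gap ε concerns the squared modulus, and 1 - ε ≤ (1 - ε/2)². That ε is at most 1, because
  -- squared moduli are nonnegative, keeps ρ at least 1/2.
  ρ = 1ℚ ℚ.- ½ ℚ.* ε
  ε≤1 : ε ℚ.≤ 1ℚ
  ε≤1 = ℚₚ.≤-trans (p+r≤p′ ℚₚ.≤-refl (0≤∥∥² (at z N)))
    (ℚₚ.≤-trans (ℚₚ.≤-reflexive (ℚₚ.+-comm ε ∥ at z N ∥²)) (below N ℕₚ.≤-refl))
  0<ρ : 0ℚ ℚ.< ρ
  0<ρ = ℚₚ.<-≤-trans (ℚₚ.positive⁻¹ ½) (ℚₚ.+-monoʳ-≤ 1ℚ (ℚₚ.neg-antimono-≤ (ℚₚ.*-monoˡ-≤-nonNeg ½ ε≤1)))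
  ρ<1 : ρ ℚ.< 1ℚ
  ρ<1 = ℚₚ.<-≤-trans (ℚₚ.+-monoʳ-< 1ℚ (ℚₚ.neg-antimono-< (half-pos 0<ε))) (ℚₚ.≤-reflexive (ℚₚ.+-identityʳ 1ℚ))

⊔<1 : ∀ {ρ σ} → ρ ℚ.< 1ℚ → σ ℚ.< 1ℚ → ρ ℚ.⊔ σ ℚ.< 1ℚ
⊔<1 {ρ} {σ} ρ<1 σ<1 with ℚₚ.⊔-sel ρ σ
... | inj₁ eq = subst (ℚ._< 1ℚ) (sym eq) ρ<1
... | inj₂ eq = subst (ℚ._< 1ℚ) (sym eq) σ<1

∣p∣≤ : ∀ {p r} → p ℚ.≤ r → ℚ.- p ℚ.≤ r → ℚ.∣ p ∣ ℚ.≤ r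
∣p∣≤ {p} {r} p≤r -p≤r with ℚₚ.∣p∣≡p∨∣p∣≡-p p
... | inj₁ eq = subst (ℚ._≤ r) (sym eq) p≤r
... | inj₂ eq = subst (ℚ._≤ r) (sym eq) -p≤r

∣p∣∣p∣≡pp : ∀ p → ℚ.∣ p ∣ ℚ.* ℚ.∣ p ∣ ≡ p ℚ.* p
∣p∣∣p∣≡pp p = trans (sym (ℚₚ.∣p*q∣≡∣p∣*∣q∣ p p)) (ℚₚ.0≤p⇒∣p∣≡p (0≤p*p p))

at-bounded : ∀ z → ∃[ C ] Eventually (λ k → at z k ⊑ C)
at-bounded z = let B , 0<B , re≤ = eventuallyBounded (re z)
                   C , 0<C , im≤ = eventuallyBounded (im z)
  in B ℚ.+ C , eventually-map (λ k (a≤B , b≤C) → bound (ℚₚ.<⇒≤ 0<B) (ℚₚ.<⇒≤ 0<C) a≤B b≤C) (eventually-× re≤ im≤)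
  where
  bound : ∀ {a b B C} → 0ℚ ℚ.≤ B → 0ℚ ℚ.≤ C → ℚ.∣ a ∣ ℚ.≤ B → ℚ.∣ b ∣ ℚ.≤ C → a ,ᵢ b ⊑ B ℚ.+ C
  bound {a} {b} {B} {C} 0≤B 0≤C a≤B b≤C = mk⊑ (ℚₚ.+-mono-≤ 0≤B 0≤C) (begin
    a ℚ.* a ℚ.+ b ℚ.* b             ≤⟨ ℚₚ.+-mono-≤ (sq≤ 0≤B a≤B) (sq≤ 0≤C b≤C) ⟩
    B ℚ.* B ℚ.+ C ℚ.* C             ≤⟨ p+r≤p′ ℚₚ.≤-refl (ℚₚ.+-mono-≤ (*-nonNeg 0≤B 0≤C) (*-nonNeg 0≤B 0≤C)) ⟩
    (B ℚ.* B ℚ.+ C ℚ.* C) ℚ.+ (B ℚ.* C ℚ.+ B ℚ.* C)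
                                    ≡⟨ solve 2 (λ b c → (b :* b :+ c :* c) :+ (b :* c :+ b :* c) :=
                                        (b :+ c) :* (b :+ c)) refl B C ⟩
    (B ℚ.+ C) ℚ.* (B ℚ.+ C)         ∎)
    where
    open ℚₚ.≤-Reasoning
    open ℚ-Solver.+-*-Solver
    sq≤ : ∀ {a B} → 0ℚ ℚ.≤ B → ℚ.∣ a ∣ ℚ.≤ B → a ℚ.* a ℚ.≤ B ℚ.* B
    sq≤ {a} 0≤B a≤B = ℚₚ.≤-trans (ℚₚ.≤-reflexive (sym (∣p∣∣p∣≡pp a))) (*-mono-≤ (ℚₚ.0≤∣p∣ a) 0≤B a≤B a≤B)

⁻¹⊑-mono : ∀ {z ρ σ} → ρ ℚ.≤ σ → z ⁻¹⊑ ρ → z ⁻¹⊑ σ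
⁻¹⊑-mono ρ≤σ (mk⁻¹⊑ eq z⊑ρ) = mk⁻¹⊑ eq (⊑-mono ρ≤σ z⊑ρ)

#0⇒⁻¹⊑ : ∀ {z} → z #0 → ∃[ D ] 0ℚ ℚ.≤ D × Eventually (λ k → at z k ⁻¹⊑ D)
#0⇒⁻¹⊑ {z} (mk< c 0<c N above) = D , 0≤D , N , λ k le →
  ⁻¹⊑-lower {at z k} {c} {D} 0<c (ℚₚ.≤-trans (ℚₚ.≤-reflexive (sym (ℚₚ.+-identityˡ c))) (above k le)) 0≤D (begin
    recip c            ≤⟨ p≤1+p (recip c) ⟩
    D                  ≡⟨ ℚₚ.*-identityʳ D ⟨
    D ℚ.* 1ℚ           ≤⟨ ℚₚ.*-monoˡ-≤-nonNeg D {{nonNeg 0≤D}} (p+r≤p′ ℚₚ.≤-refl (ℚₚ.<⇒≤ (recip-pos 0<c))) ⟩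
    D ℚ.* D            ∎)
  where
  open ℚₚ.≤-Reasoning
  -- A square root of 1/c is avoided: since D ≥ 1, one has 1/c ≤ D ≤ D².
  D = 1ℚ ℚ.+ recip c
  0≤D : 0ℚ ℚ.≤ D
  0≤D = ℚₚ.+-mono-≤ (ℚₚ.nonNegative⁻¹ 1ℚ) (ℚₚ.<⇒≤ (recip-pos 0<c))

-- From 1 = ∣z∣²∣w∣² ≤ C²∣z∣² the gap 1/C² results. Applied with the bounded inverse products as
-- `w`, it shows that the infinite products in the denominator are apart from 0.
bounded-inverse⇒#0 : ∀ z {C} → 0ℚ ℚ.< C → Eventually (λ k → ∃[ w ] at z k ⊗ w ≡ 𝟙 × w ⊑ C) → z #0
bounded-inverse⇒#0 z {C} 0<C (N , inverse) = mk< c 0<c N λ k le → let w , zw≡1 , w⊑C = inverse k le in begin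
  0ℚ ℚ.+ c                                 ≡⟨ ℚₚ.+-identityˡ c ⟩
  c                                        ≡⟨ ℚₚ.*-identityʳ c ⟨
  c ℚ.* ∥ 𝟙 ∥²                             ≡⟨ cong (λ u → c ℚ.* ∥ u ∥²) zw≡1 ⟨
  c ℚ.* ∥ at z k ⊗ w ∥²                    ≡⟨ cong (c ℚ.*_) (∥∥²-⊗ (at z k) w) ⟩
  c ℚ.* (∥ at z k ∥² ℚ.* ∥ w ∥²)           ≤⟨ ℚₚ.*-monoˡ-≤-nonNeg c {{nonNeg (ℚₚ.<⇒≤ 0<c)}}
                                                (ℚₚ.*-monoˡ-≤-nonNeg ∥ at z k ∥² {{nonNeg (0≤∥∥² (at z k))}} (∥∥²≤ w⊑C)) ⟩
  c ℚ.* (∥ at z k ∥² ℚ.* (C ℚ.* C))        ≡⟨ solve 3 (λ c z d → c :* (z :* d) := (c :* d) :* z) refl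
      c ∥ at z k ∥² (C ℚ.* C) ⟩
  c ℚ.* (C ℚ.* C) ℚ.* ∥ at z k ∥²          ≡⟨ cong (ℚ._* ∥ at z k ∥²) (recip-inverse 0<CC) ⟩
  1ℚ ℚ.* ∥ at z k ∥²                       ≡⟨ ℚₚ.*-identityˡ ∥ at z k ∥² ⟩
  ∥ at z k ∥²                              ∎
  where
  open ℚₚ.≤-Reasoning
  open ℚ-Solver.+-*-Solver
  0<CC = *-pos 0<C 0<C
  c = recip (C ℚ.* C)
  0<c = recip-pos 0<CC

-- Diagonal limits

From : ℕ → Set
From K = Σ[ k ∈ ℕ ] K ℕ.≤ k

module Diagonal (K : ℕ) where

  -- At index k a diagonal limit is only the k-th approximation, so closeness can be expected only
  -- when n and k are both large.
  Joint : (ℕ → From K → ℚ[i]) → Set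
  Joint w = Vanishing {ℕ × From K} (λ (n , k , _) → n ⊓ k) λ (n , i) → w n i

  UniformlyCauchy : (ℕ → From K → ℚ[i]) → Set
  UniformlyCauchy u = Vanishing {ℕ × ℕ × From K} (λ (m , n , i) → m ⊓ n) λ (m , n , i) → u m i ⊖ u n i

  joint⇒⟶ : ∀ {z l} → Joint (λ n (k , _) → at (z n) k ⊖ at l k) → z ⟶ l
  joint⇒⟶ {z} {l} vanishes ε 0<ε = let N , small = vanishes (½ ℚ.* ε) (half-pos 0<ε) in N , λ n N≤n →
    mk< δ 0<δ (N ⊔ K) λ k le → begin
      ∥ at (z n) k ⊖ at l k ∥² ℚ.+ δ   ≤⟨ ℚₚ.+-monoˡ-≤ δ (∥∥²≤ (small (n , k , ⊔-right {N} le) (ℕₚ.⊓-glb N≤n (⊔-left le)))) ⟩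
      δ ℚ.+ δ                          ≤⟨ p+r≤p′ ℚₚ.≤-refl (ℚₚ.<⇒≤ (ℚₚ.+-mono-< 0<δ 0<δ)) ⟩
      (δ ℚ.+ δ) ℚ.+ (δ ℚ.+ δ)          ≡⟨ solve 1 (λ e → let d = con ½ :* e :* (con ½ :* e) in (d :+ d) :+ (d :+ d) :=
          e :* e) refl ε ⟩
      ε ℚ.* ε                          ∎
    where
    open ℚₚ.≤-Reasoning
    open ℚ-Solver.+-*-Solver
    -- Here ε² = 4δ: one δ covers the squared distance and another is the gap that strict inequality
    -- of reals demands.
    δ = ½ ℚ.* ε ℚ.* (½ ℚ.* ε)
    0<δ = *-pos (half-pos 0<ε) (half-pos 0<ε)

  -- The intermediate point is `v n i`: it is near `u n i` for large n, and near the diagonal value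
  -- `v k i` for large n and k by uniform Cauchyness.
  joint : ∀ {u v : ℕ → From K → ℚ[i]} → Vanishing {ℕ × From K} proj₁ (λ (n , i) → u n i ⊖ v n i) →
          UniformlyCauchy v → Joint (λ n i → u n i ⊖ v (proj₁ i) i)
  joint {u} {v} u∼v cv = vanishing-cong
    {u = λ (n , i) → (u n i ⊖ v n i) ⊕ (v n i ⊖ v (proj₁ i) i)} {v = λ (n , i) → u n i ⊖ v (proj₁ i) i}
    (λ (n , i) → solve 3 (λ a b c → a :- c := (a :- b) :+ (b :- c)) refl (u n i) (v n i) (v (proj₁ i) i))
    (vanishing-⊕ {u = λ (n , i) → u n i ⊖ v n i} {v = λ (n , i) → v n i ⊖ v (proj₁ i) i}
      (vanishing-∘ {size = proj₁} {w = λ (n , i) → u n i ⊖ v n i} (λ a → a) (λ (n , k , _) → ℕₚ.m⊓n≤m n k) u∼v)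
      (vanishing-∘ {size = λ (m , n , i) → m ⊓ n} {w = λ (m , n , i) → v m i ⊖ v n i}
        (λ (n , i) → n , proj₁ i , i) (λ _ → ℕₚ.≤-refl) cv))
    where open ℚ[i]-Solver

  -- The values of f m at m and of f n at n are compared through the fixed real f N. Uniform
  -- closeness to f N costs ε/4 at either end, and the Cauchy property of f N itself costs ε/2.
  diagonal-cauchy : (f : ℕ → ℝ) →
    (∀ ε → 0ℚ ℚ.< ε → ∃[ N ] ∀ m n (i : From K) → N ℕ.≤ m ⊓ n → ℚ.∣ seq (f m) (proj₁ i) ℚ.- seq (f n) (proj₁ i) ∣ ℚ.≤ ε) →
    IsCauchy (λ k → seq (f k) k)
  diagonal-cauchy f uniform ε 0<ε =
    let δ = ½ ℚ.* (½ ℚ.* ε)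
        N , near = uniform δ (half-pos (half-pos 0<ε))
        M , close = cauchy (f N) (½ ℚ.* ε) (half-pos 0<ε)
    in (N ⊔ K) ⊔ M , λ m n p p′ →
      let a = seq (f m) m ; b = seq (f N) m ; c = seq (f N) n ; d = seq (f n) n
          i = m , ⊔-right {N} {K} (⊔-left {N ⊔ K} {M} p)
          j = n , ⊔-right {N} {K} (⊔-left {N ⊔ K} {M} p′)
          N≤m = ⊔-left {N} {K} (⊔-left {N ⊔ K} {M} p)
          N≤n = ⊔-left {N} {K} (⊔-left {N ⊔ K} {M} p′)
      in begin-strict
        ℚ.∣ a ℚ.- d ∣
          ≡⟨ cong ℚ.∣_∣ (solve 4 (λ a b c d → a :- d := ((a :- b) :+ (c :- d)) :+ (b :- c)) refl a b c d) ⟩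
        ℚ.∣ ((a ℚ.- b) ℚ.+ (c ℚ.- d)) ℚ.+ (b ℚ.- c) ∣
          ≤⟨ ℚₚ.≤-trans (ℚₚ.∣p+q∣≤∣p∣+∣q∣ ((a ℚ.- b) ℚ.+ (c ℚ.- d)) (b ℚ.- c))
               (ℚₚ.+-monoˡ-≤ ℚ.∣ b ℚ.- c ∣ (ℚₚ.∣p+q∣≤∣p∣+∣q∣ (a ℚ.- b) (c ℚ.- d))) ⟩
        (ℚ.∣ a ℚ.- b ∣ ℚ.+ ℚ.∣ c ℚ.- d ∣) ℚ.+ ℚ.∣ b ℚ.- c ∣
          <⟨ ℚₚ.+-mono-≤-<
               (ℚₚ.+-mono-≤ (near m N i (ℕₚ.⊓-glb N≤m ℕₚ.≤-refl)) (near N n j (ℕₚ.⊓-glb ℕₚ.≤-refl N≤n)))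
               (close m n (⊔-right {N ⊔ K} {M} p) (⊔-right {N ⊔ K} {M} p′)) ⟩
        (½ ℚ.* (½ ℚ.* ε) ℚ.+ ½ ℚ.* (½ ℚ.* ε)) ℚ.+ ½ ℚ.* ε
          ≡⟨ solve 1 (λ e → (con ½ :* (con ½ :* e) :+ con ½ :* (con ½ :* e)) :+ con ½ :* e := e) refl ε ⟩
        ε ∎
    where
    open ℚₚ.≤-Reasoning
    open ℚ-Solver.+-*-Solver

  diagonal : (z : ℕ → ℂ) → UniformlyCauchy (λ n (k , _) → at (z n) k) → ℂ
  re (diagonal z cz) = mkℝ (λ k → seq (re (z k)) k) (diagonal-cauchy (λ n → re (z n)) λ ε 0<ε →
    let N , small = cz ε 0<ε in N , λ m n i le →
      ∣p∣≤ (Re≤ (small (m , n , i) le)) (Re≤ (⊑-⊝ (small (m , n , i) le))))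
  im (diagonal z cz) = mkℝ (λ k → seq (im (z k)) k) (diagonal-cauchy (λ n → im (z n)) λ ε 0<ε →
    let N , small = cz ε 0<ε in N , λ m n i le →
      ∣p∣≤ (Im≤ (small (m , n , i) le)) (Im≤ (⊑-⊝ (small (m , n , i) le))))

-- Inverses of Pochhammer symbols and regularity of denominators

inv-poch : ∀ a q n → inv (pochᴳ a q n) ≡ ipochᴳ a q n
inv-poch a q zero    = refl
inv-poch a q (suc n) = trans (inv-⊗ (pochᴳ a q n) (𝟙 ⊖ a ⊗ q ↑ n)) (cong (_⊗ inv (𝟙 ⊖ a ⊗ q ↑ n)) (inv-poch a q n))

at-poch : ∀ a q n k → at (poch a q n) k ≡ pochᴳ (at a k) (at q k) n
at-poch a q n k = trans (at-∏ n (λ j → 1ℂ - a * q ^ j) k) (∏-cong n λ j → cong (λ z → 𝟙 ⊖ at a k ⊗ z) (at-^ q j k))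

module _ (b q : ℂ) {r : ℚ} (0≤r : 0ℚ ℚ.≤ r) (r<1 : r ℚ.< 1ℚ)
         (q⊑r : Eventually λ k → at q k ⊑ r) (nv : NonVanishing b q) where

  private
    Inverse : ℚ → ℕ → ℕ → Set
    Inverse D j k = 𝟙 ⊖ at b k ⊗ at q k ↑ j ⁻¹⊑ D

    each : ∀ j → ∃[ D ] 0ℚ ℚ.≤ D × Eventually (Inverse D j)
    each j = let D , 0≤D , ev = #0⇒⁻¹⊑ {1ℂ - b * q ^ j} (nv j) in
      D , 0≤D , eventually-map (λ k → subst (λ z → 𝟙 ⊖ at b k ⊗ z ⁻¹⊑ D) (at-^ q j k)) ev

    initial : ∀ J → ∃[ D ] 0ℚ ℚ.≤ D × Eventually (λ k → ∀ j → j ℕ.< J → Inverse D j k)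
    initial zero    = 0ℚ , ℚₚ.≤-refl , 0 , λ _ _ _ ()
    initial (suc J) =
      let D , 0≤D , ev = initial J
          C , 0≤C , ev′ = each J
          D≤ = p+r≤p′ {D} ℚₚ.≤-refl 0≤C
          C≤ = ℚₚ.≤-trans (p+r≤p′ {C} ℚₚ.≤-refl 0≤D) (ℚₚ.≤-reflexive (ℚₚ.+-comm C D))
      in D ℚ.+ C , ℚₚ.+-mono-≤ 0≤D 0≤C , eventually-map
        (λ k (below , last) j j<1+J → pick below last D≤ C≤ j (ℕₚ.m≤n⇒m<n∨m≡n (ℕₚ.≤-pred j<1+J))) (eventually-× ev ev′)
      where
      pick : ∀ {k C D E} → (∀ j → j ℕ.< J → Inverse D j k) → Inverse C J k → D ℚ.≤ E → C ℚ.≤ E →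
             ∀ j → j ℕ.< J ⊎ j ≡ J → Inverse E j k
      pick below last D≤ C≤ j (inj₁ j<J)  = ⁻¹⊑-mono D≤ (below j j<J)
      pick below last D≤ C≤ j (inj₂ refl) = ⁻¹⊑-mono C≤ last

  -- For large j the factor 1 - b qʲ is near 1; the finitely many others are bounded away from 0 one by one.
  eventually-regular : ∃[ D ] Eventually (λ k → ∀ j → Inverse D j k)
  eventually-regular =
    let B , b⊑ = at-bounded b
        B≤ = p≤1+pp B
        B′ = 1ℚ ℚ.+ B ℚ.* B
        0≤B′ = ℚₚ.+-mono-≤ (ℚₚ.nonNegative⁻¹ 1ℚ) (0≤p*p B)
        J , small = C*r^n≤ε 0≤r r<1 B′ ½ 0≤B′ (ℚₚ.positive⁻¹ ½)
        D , 0≤D , ev = initial J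
        2⁻ = recip (1ℚ ℚ.- ½)
        0≤2 = ℚₚ.nonNegative⁻¹ 2⁻
        D≤ = p+r≤p′ {D} ℚₚ.≤-refl 0≤2
        2≤ = ℚₚ.≤-trans (p+r≤p′ {2⁻} ℚₚ.≤-refl 0≤D) (ℚₚ.≤-reflexive (ℚₚ.+-comm 2⁻ D))
    in D ℚ.+ 2⁻ , eventually-map
      (λ k (below , b⊑B , q⊑) j → split small below (⊑-mono B≤ b⊑B) q⊑ D≤ 2≤ j (ℕₚ.<-≤-connex j J))
      (eventually-× ev (eventually-× b⊑ q⊑r))
    where
    split : ∀ {J k B D E} → (∀ n → J ℕ.≤ n → B ℚ.* r ^ℚ n ℚ.≤ ½) → (∀ j → j ℕ.< J → Inverse D j k) →
            at b k ⊑ B → at q k ⊑ r → D ℚ.≤ E → recip (1ℚ ℚ.- ½) ℚ.≤ E →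
            ∀ j → j ℕ.< J ⊎ J ℕ.≤ j → Inverse E j k
    split small below b⊑B q⊑ D≤ 2≤ j (inj₁ j<J) = ⁻¹⊑-mono D≤ (below j j<J)
    split small below b⊑B q⊑ D≤ 2≤ j (inj₂ J≤j) = ⁻¹⊑-mono 2≤
      (1-z⁻¹⊑ (ℚ.*<* (ℤ.+<+ (ℕ.s≤s (ℕ.s≤s ℕ.z≤n)))) (⊑-mono (small j J≤j) (⊑-⊗ b⊑B (↑-⊑ j q⊑))))

-- Common bounds from a common index on

record UniformBounds (q x y s t : ℂ) : Set where
  field
    {r} : ℚ
    0<r : 0ℚ ℚ.< r
    r<1 : r ℚ.< 1ℚ
    K   : ℕ
    q⊑r  : ∀ (i : From K) → at q (proj₁ i) ⊑ r
    s⊑r  : ∀ (i : From K) → at s (proj₁ i) ⊑ r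
    t⊑r  : ∀ (i : From K) → at t (proj₁ i) ⊑ r
    xt⊑r : ∀ (i : From K) → at (x * t) (proj₁ i) ⊑ r
    xs⊑r : ∀ (i : From K) → at (x * s) (proj₁ i) ⊑ r
    bx   : Bounded {From K} λ i → at x (proj₁ i)
    by   : Bounded {From K} λ i → at y (proj₁ i)
    reg  : ∃[ D ] ∀ j (i : From K) → 𝟙 ⊖ at (y * s) (proj₁ i) ⊗ at q (proj₁ i) ↑ j ⁻¹⊑ D

uniform-bounds : ∀ q x y s t → ∣ q ∣< 1ℚ → ∣ t ∣< 1ℚ → ∣ s ∣< 1ℚ → ∣ x * t ∣< 1ℚ → ∣ x * s ∣< 1ℚ →
                 NonVanishing (y * s) q → UniformBounds q x y s t
uniform-bounds q x y s t q<1 t<1 s<1 xt<1 xs<1 ys≠q⁻ᵏ =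
  let ρ₁ , 0<ρ₁ , ρ₁<1 , q⊑ = radius {q} q<1
      ρ₂ , _ , ρ₂<1 , s⊑ = radius {s} s<1
      ρ₃ , _ , ρ₃<1 , t⊑ = radius {t} t<1
      ρ₄ , _ , ρ₄<1 , xt⊑ = radius {x * t} xt<1
      ρ₅ , _ , ρ₅<1 , xs⊑ = radius {x * s} xs<1
      r₄ = ρ₄ ℚ.⊔ ρ₅ ; r₃ = ρ₃ ℚ.⊔ r₄ ; r₂ = ρ₂ ℚ.⊔ r₃ ; r = ρ₁ ℚ.⊔ r₂
      ≤r₂ = ℚₚ.p≤q⊔p ρ₁ r₂
      ≤r₃ = ℚₚ.≤-trans (ℚₚ.p≤q⊔p ρ₂ r₃) ≤r₂
      ≤r₄ = ℚₚ.≤-trans (ℚₚ.p≤q⊔p ρ₃ r₄) ≤r₃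
      -- Strict positivity matters because `coef-geo` divides by `r`.
      0<r = ℚₚ.<-≤-trans 0<ρ₁ (ℚₚ.p≤p⊔q ρ₁ r₂)
      r<1 = ⊔<1 ρ₁<1 (⊔<1 ρ₂<1 (⊔<1 ρ₃<1 (⊔<1 ρ₄<1 ρ₅<1)))
      q⊑r = eventually-map (λ k → ⊑-mono (ℚₚ.p≤p⊔q ρ₁ r₂)) q⊑
      X , x⊑ = at-bounded x
      Y , y⊑ = at-bounded y
      D , ys⊑ = eventually-regular (y * s) q (ℚₚ.<⇒≤ 0<r) r<1 q⊑r ys≠q⁻ᵏ
      K , bounds = eventually-× q⊑r (eventually-× s⊑ (eventually-× t⊑ (eventually-× xt⊑
                     (eventually-× xs⊑ (eventually-× x⊑ (eventually-× y⊑ ys⊑))))))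
  in record
    { 0<r = 0<r ; r<1 = r<1 ; K = K
    ; q⊑r  = λ (k , le) → let b , _ = bounds k le in b
    ; s⊑r  = λ (k , le) → let _ , b , _ = bounds k le in ⊑-mono (ℚₚ.≤-trans (ℚₚ.p≤p⊔q ρ₂ r₃) ≤r₂) b
    ; t⊑r  = λ (k , le) → let _ , _ , b , _ = bounds k le in ⊑-mono (ℚₚ.≤-trans (ℚₚ.p≤p⊔q ρ₃ r₄) ≤r₃) b
    ; xt⊑r = λ (k , le) → let _ , _ , _ , b , _ = bounds k le in ⊑-mono (ℚₚ.≤-trans (ℚₚ.p≤p⊔q ρ₄ ρ₅) ≤r₄) b
    ; xs⊑r = λ (k , le) → let _ , _ , _ , _ , b , _ = bounds k le in ⊑-mono (ℚₚ.≤-trans (ℚₚ.p≤q⊔p ρ₄ ρ₅) ≤r₄) b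
    ; bx   = X , λ (k , le) → let _ , _ , _ , _ , _ , b , _ = bounds k le in b
    ; by   = Y , λ (k , le) → let _ , _ , _ , _ , _ , _ , b , _ = bounds k le in b
    ; reg  = D , λ j (k , le) → let _ , _ , _ , _ , _ , _ , _ , b = bounds k le in b j
    }

-- Transfer of the estimates to complex limits

module Conclusion (q x y s t : ℂ) (q<1 : ∣ q ∣< 1ℚ) (nv : NonVanishing (y * s) q)
                  (bounds : UniformBounds q x y s t) where

  open UniformBounds bounds

  _′ : ℂ → From K → ℚ[i]
  (z ′) i = at z (proj₁ i)

  open Asymptotics {From K} {r} 0<r r<1 (q ′) (x ′) (y ′) (s ′) (t ′) q⊑r s⊑r t⊑r xt⊑r xs⊑r bx by
  open Diagonal K

  poch-limit : ∀ a → Bounded (a ′) → ℂ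
  poch-limit a ba = diagonal (poch a q)
    (cauchy-cong {pochᶠ (a ′)} {λ n i → at (poch a q n) (proj₁ i)} (λ n i → at-poch a q n (proj₁ i)) (poch-cauchy ba))

  poch-limit-at : ∀ a ba i → at (poch-limit a ba) (proj₁ i) ≡ pochᶠ (a ′) (proj₁ i) i
  poch-limit-at a ba (k , _) = at-poch a q k k

  poch-limit-⟶ : ∀ a ba → IsPoch∞ a q (poch-limit a ba)
  poch-limit-⟶ a ba = joint⇒⟶ {poch a q} {poch-limit a ba} (vanishing-cong
    {u = λ (n , i) → pochᶠ (a ′) n i ⊖ pochᶠ (a ′) (proj₁ i) i}
    {v = λ (n , i) → at (poch a q n) (proj₁ i) ⊖ at (poch-limit a ba) (proj₁ i)}
    (λ (n , i) → cong₂ _⊖_ (at-poch a q n (proj₁ i)) (poch-limit-at a ba i))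
    (joint {pochᶠ (a ′)} {pochᶠ (a ′)} (∼-refl (pochᶠ (a ′))) (poch-cauchy ba)))

  YS S XS XT : ℂ
  YS = poch-limit (y * s) B-bounded
  S  = poch-limit s (⊑r⇒bounded s⊑r)
  XS = poch-limit (x * s) (⊑r⇒bounded xs⊑r)
  XT = poch-limit (x * t) (⊑r⇒bounded xt⊑r)

  YS-limit : IsPoch∞ (y * s) q YS
  YS-limit = poch-limit-⟶ (y * s) B-bounded

  S-limit : IsPoch∞ s q S
  S-limit = poch-limit-⟶ s (⊑r⇒bounded s⊑r)

  XS-limit : IsPoch∞ (x * s) q XS
  XS-limit = poch-limit-⟶ (x * s) (⊑r⇒bounded xs⊑r)

  XT-limit : IsPoch∞ (x * t) q XT
  XT-limit = poch-limit-⟶ (x * t) (⊑r⇒bounded xt⊑r)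

  at-Q : ∀ n (i : From K) → at (poch q q n) (proj₁ i) ≡ Q n i
  at-Q n i = at-poch q q n (proj₁ i)

  inv-at-poch : ∀ a n (i : From K) → inv (at (poch a q n) (proj₁ i)) ≡ ipochᶠ (a ′) n i
  inv-at-poch a n i = trans (cong inv (at-poch a q n (proj₁ i))) (inv-poch ((a ′) i) ((q ′) i) n)

  φ-term : ℕ → ℂ
  φ-term n = ((poch y q n * poch (x * s) q n) / (poch q q n * poch (y * s) q n) ∵
                pochPair#0 {q} {y * s} {q} (q-nonVanishing {q} q<1) nv n) * t ^ n

  at-φ : ∀ n i → at (φ-term n) (proj₁ i) ≡ φ n i
  at-φ n i = cong₂ _⊗_
    (cong₂ _⊗_ (cong₂ _⊗_ (at-poch y q n (proj₁ i)) (at-poch (x * s) q n (proj₁ i)))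
      (trans (inv-⊗ (at (poch q q n) (proj₁ i)) (at (poch (y * s) q n) (proj₁ i)))
        (cong₂ _⊗_ (inv-at-poch q n i) (inv-at-poch (y * s) n i))))
    (at-^ t n (proj₁ i))

  at-expTerm : ∀ z n i → at (expTerm q q<1 z n) (proj₁ i) ≡ E (z ′) n i
  at-expTerm z n i = cong₂ _⊗_ (at-^ z n (proj₁ i)) (inv-at-poch q n i)

  at-∑φ : ∀ n i → at (∑< n φ-term) (proj₁ i) ≡ partialSum φ n i
  at-∑φ n i = trans (at-∑ n φ-term (proj₁ i)) (∑-cong n λ k _ → at-φ k i)

  Φ : ℂ
  Φ = diagonal (λ n → ∑< n φ-term)
    (cauchy-cong {partialSum φ} {λ n i → at (∑< n φ-term) (proj₁ i)} at-∑φ (partialSum-cauchy {φ} (φ-geo reg)))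

  Φ-sum : HasSum φ-term Φ
  Φ-sum = joint⇒⟶ {λ n → ∑< n φ-term} {Φ} (vanishing-cong
    {u = λ (n , i) → partialSum φ n i ⊖ partialSum φ (proj₁ i) i}
    {v = λ (n , i) → at (∑< n φ-term) (proj₁ i) ⊖ at Φ (proj₁ i)}
    (λ (n , i) → cong₂ _⊖_ (at-∑φ n i) (at-∑φ (proj₁ i) i))
    (joint {partialSum φ} {partialSum φ} (∼-refl (partialSum φ)) (partialSum-cauchy {φ} (φ-geo reg))))

  at-h : ∀ m i → at (h q q<1 m x y) (proj₁ i) ≡ H 0 m i
  at-h m i = trans (at-∑ (suc m) (λ k → qBinomial q q<1 m k * P q q<1 k x y) (proj₁ i)) (trans
    (∑-cong (suc m) λ k _ → trans
      (cong₂ _⊗_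
        (cong₂ _⊗_ (at-Q m i) (trans (inv-⊗ (at (poch q q k) (proj₁ i)) (at (poch q q (m ∸ k)) (proj₁ i)))
          (cong₂ _⊗_ (inv-at-poch q k i) (inv-at-poch q (m ∸ k) i))))
        (trans (at-∏ k (λ l → x - q ^ l * y) (proj₁ i))
          (∏-cong k λ l → cong (λ z → (x ′) i ⊖ z ⊗ (y ′) i) (at-^ q l (proj₁ i)))))
      -- The inserted 1 stands for (q⁰)ᵏ, the power that `H 0` carries in each term.
      (trans (solve 4 (λ Q a b p → Q :* (a :* b) :* p := Q :* (p :* a :* con 𝟙 :* b)) refl
          (Q m i) (iQ k i) (iQ (m ∸ k) i) (∏ᴳ k (λ l → (x ′) i ⊖ (q ′) i ↑ l ⊗ (y ′) i)))
        (cong (λ z → Q m i ⊗ (coef (x ′) (y ′) k i ⊗ z ⊗ iQ (m ∸ k) i)) (sym (𝟙↑ k)))))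
    (∑-⊗ˡ (suc m) (Q m i) (λ k → coef (x ′) (y ′) k i ⊗ ((q ′) i ↑ 0) ↑ k ⊗ iQ (m ∸ k) i)))
    where open ℚ[i]-Solver

  S*XS#0 : S * XS #0
  S*XS#0 =
    let C , 0<C , bd = positive-bound is⊗iA-bdd in
    bounded-inverse⇒#0 (S * XS) 0<C (K , λ k le → let i = k , le in
      ipochᶠ (s ′) k i ⊗ ipochᶠ A k i ,
      trans (cong (_⊗ (ipochᶠ (s ′) k i ⊗ ipochᶠ A k i))
          (cong₂ _⊗_ (poch-limit-at s (⊑r⇒bounded s⊑r) i) (poch-limit-at (x * s) (⊑r⇒bounded xs⊑r) i)))
        (trans (solve 4 (λ a b c d → a :* b :* (c :* d) := (a :* c) :* (b :* d)) refl
            (pochᶠ (s ′) k i) (pochᶠ A k i) (ipochᶠ (s ′) k i) (ipochᶠ A k i))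
          (trans (cong₂ _⊗_ (poch⊗ipoch {s ′} (⊑r⇒regular s⊑r) k i) (poch⊗ipoch {A} (⊑r⇒regular xs⊑r) k i)) (⊗-identityˡ 𝟙))) ,
      bd (k , i))
    where open ℚ[i]-Solver

  XT#0 : XT #0
  XT#0 =
    let C , 0<C , bd = positive-bound (⊑r⇒ipoch-bdd {T} xt⊑r) in
    bounded-inverse⇒#0 XT 0<C (K , λ k le → let i = k , le in
      ipochᶠ T k i ,
      trans (cong (_⊗ ipochᶠ T k i) (poch-limit-at (x * t) (⊑r⇒bounded xt⊑r) i)) (poch⊗ipoch {T} (⊑r⇒regular xt⊑r) k i) ,
      bd (k , i))

  denom#0 : S * XS * XT #0
  denom#0 = *-#0 {S * XS} {XT} S*XS#0 XT#0

  term : ℕ → ℕ → ℂ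
  term n m = h q q<1 (n ℕ.+ m) x y * expTerm q q<1 t n * expTerm q q<1 s m

  -- Only the prefactor is a limit; the other factor is a finite sum, the n-th coefficient of the
  -- Cauchy product of the ₂φ₁ series with the Euler series in xt.
  g : ℕ → ℂ
  g n = (YS / (S * XS) ∵ S*XS#0) * ∑< (suc n) (λ k → φ-term k * expTerm q q<1 (x * t) (n ∸ k))

  -- At index k the diagonal limit is by definition (a;q)_k at index k, so the statement for finite
  -- products applies unchanged.
  inv-at-poch-limit : ∀ a ba (i : From K) → inv (at (poch-limit a ba) (proj₁ i)) ≡ ipochᶠ (a ′) (proj₁ i) i
  inv-at-poch-limit a ba i = inv-at-poch a (proj₁ i) i

  inv-S*XS : ∀ i → inv (at (S * XS) (proj₁ i)) ≡ ipochᶠ (s ′) (proj₁ i) i ⊗ ipochᶠ A (proj₁ i) i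
  inv-S*XS i = trans (inv-⊗ (at S (proj₁ i)) (at XS (proj₁ i)))
    (cong₂ _⊗_ (inv-at-poch-limit s (⊑r⇒bounded s⊑r) i) (inv-at-poch-limit (x * s) (⊑r⇒bounded xs⊑r) i))

  at-g : ∀ n i → at (g n) (proj₁ i) ≡ V (proj₁ i) i ⊗ G reg n i
  at-g n i = cong₂ _⊗_
    (cong₂ _⊗_ (poch-limit-at (y * s) B-bounded i) (inv-S*XS i))
    (trans (at-∑ (suc n) (λ k → φ-term k * expTerm q q<1 (x * t) (n ∸ k)) (proj₁ i))
      (∑-cong (suc n) λ k _ → cong₂ _⊗_ (at-φ k i) (at-expTerm (x * t) (n ∸ k) i)))

  at-term : ∀ n M i → at (∑< M (term n)) (proj₁ i) ≡ inner reg n M i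
  at-term n M i = trans (at-∑ M (term n) (proj₁ i)) (∑-cong M λ m _ →
    cong₂ _⊗_ (cong₂ _⊗_ (at-h (n ℕ.+ m) i) (at-expTerm t n i)) (at-expTerm s m i))

  G-bounded : ∀ n → Bounded (G reg n)
  G-bounded n = bounded-∑ (suc n) {λ k i → φ k i ⊗ ψ (n ∸ k) i} λ k → bounded-⊗ {u = φ k} {v = ψ (n ∸ k)}
    (let C , bd = geo⇒bdd {φ} (φ-geo reg) in C , λ i → bd (k , i))
    (let C , bd = geo⇒bdd {ψ} ψ-geo in C , λ i → bd (n ∸ k , i))

  inner-sum : ∀ n → HasSum (term n) (g n)
  inner-sum n = joint⇒⟶ {λ M → ∑< M (term n)} {g n} (vanishing-cong
    {u = λ (M , i) → inner reg n M i ⊖ V (proj₁ i) i ⊗ G reg n i}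
    {v = λ (M , i) → at (∑< M (term n)) (proj₁ i) ⊖ at (g n) (proj₁ i)}
    (λ (M , i) → cong₂ _⊖_ (at-term n M i) (at-g n i))
    (joint {inner reg n} {λ M i → V M i ⊗ G reg n i} (inner-∼ reg n)
      (cauchy-⊗ {V} {λ _ → G reg n} V-bdd (const-bdd (G-bounded n)) V-cauchy (cauchy-const (G reg n)))))

  at-∑g : ∀ N i → at (∑< N g) (proj₁ i) ≡ V (proj₁ i) i ⊗ partialSum (G reg) N i
  at-∑g N i = trans (at-∑ N g (proj₁ i)) (trans (∑-cong N λ n _ → at-g n i) (∑-⊗ˡ N (V (proj₁ i) i) (λ n → G reg n i)))

  total : ℂ
  total = (YS / (S * XS * XT) ∵ denom#0) * Φ

  at-total : ∀ i → at total (proj₁ i) ≡ V (proj₁ i) i ⊗ ΦiT reg (proj₁ i) i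
  at-total i = trans
    (cong₂ _⊗_ (cong₂ _⊗_ (poch-limit-at (y * s) B-bounded i)
        (trans (inv-⊗ (at (S * XS) (proj₁ i)) (at XT (proj₁ i)))
          (cong₂ _⊗_ (inv-S*XS i) (inv-at-poch-limit (x * t) (⊑r⇒bounded xt⊑r) i))))
      (at-∑φ (proj₁ i) i))
    (solve 4 (λ b v w f → b :* (v :* w) :* f := b :* v :* (f :* w)) refl
      (pochᶠ B (proj₁ i) i) (ipochᶠ (s ′) (proj₁ i) i ⊗ ipochᶠ A (proj₁ i) i) (ipochᶠ T (proj₁ i) i) (partialSum φ (proj₁ i) i))
    where open ℚ[i]-Solver

  -- The values `g n` already contain `V` at the diagonal index, independent of N. It factors out as
  -- a bounded multiplier, and only the partial sums of `G` have to converge.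
  outer-sum : HasSum g total
  outer-sum = joint⇒⟶ {λ N → ∑< N g} {total} (vanishing-cong
    {u = λ (N , i) → V (proj₁ i) i ⊗ (partialSum (G reg) N i ⊖ ΦiT reg (proj₁ i) i)}
    {v = λ (N , i) → at (∑< N g) (proj₁ i) ⊖ at total (proj₁ i)}
    (λ (N , i) → trans (cong₂ _⊖_ (at-∑g N i) (at-total i))
      (solve 3 (λ v a b → v :* a :- v :* b := v :* (a :- b)) refl
        (V (proj₁ i) i) (partialSum (G reg) N i) (ΦiT reg (proj₁ i) i)))
    (vanishing-⊗ {b = λ (N , i) → V (proj₁ i) i} {u = λ (N , i) → partialSum (G reg) N i ⊖ ΦiT reg (proj₁ i) i}
      (let C , bd = V-bdd in C , λ (N , i) → bd (proj₁ i , i))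
      (joint {partialSum (G reg)} {ΦiT reg} (outer-∼ reg) (ΦiT-cauchy reg))))
    where open ℚ[i]-Solver

  double-sum : HasDoubleSum term total
  double-sum = g , inner-sum , outer-sum

theorem3p1 : (q x y s t : ℂ) (q<1 : ∣ q ∣< 1ℚ) →
    ∣ t ∣< 1ℚ → ∣ s ∣< 1ℚ → ∣ x * t ∣< 1ℚ → ∣ x * s ∣< 1ℚ →
    (ys≠q⁻ᵏ : NonVanishing (y * s) q) →
    ∃[ YS ] ∃[ S ] ∃[ XS ] ∃[ XT ] ∃[ Φ ]
    IsPoch∞ (y * s) q YS × IsPoch∞ s q S × IsPoch∞ (x * s) q XS × IsPoch∞ (x * t) q XT ×
    Is₂φ₁ q q<1 y (x * s) (y * s) ys≠q⁻ᵏ t Φ ×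
    (Σ[ denom#0 ∈ S * XS * XT #0 ]
    HasDoubleSum
    (λ n m → h q q<1 (n ℕ.+ m) x y * expTerm q q<1 t n * expTerm q q<1 s m)
    ((YS / (S * XS * XT) ∵ denom#0) * Φ))
theorem3p1 q x y s t q<1 t<1 s<1 xt<1 xs<1 ys≠q⁻ᵏ =
  YS , S , XS , XT , Φ , YS-limit , S-limit , XS-limit , XT-limit , Φ-sum , denom#0 , double-sum
  where
  open Conclusion q x y s t q<1 ys≠q⁻ᵏ (uniform-bounds q x y s t q<1 t<1 s<1 xt<1 xs<1 ys≠q⁻ᵏ)
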